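{- Assume the Exponential Time Hypothesis. Then every deterministic algorithm computing $\mathrm{MBPSP}^{*}$ on inputs of length $N$ requires time $N^{\Omega(\log\log N)}$.
   Context: A (deterministic) branching program (BP) on Boolean variables $x_1,\dots,x_n$ is a directed acyclic graph with exactly one source and two sinks, one labeled $0$ and one labeled $1$; every non-sink node is labeled by a variable and has exactly two outgoing edges, labeled $0$ and $1$. On an input one starts at the source and repeatedly follows the edge labeled with the value of the current node's variable until a sink is reached; the sink's label is the output. The size of a BP is its number of non-sink nodes. For a partial function $f^*:\{0,1\}^n\to\{0,1,*\}$, an extension is any total $f:\{0,1\}^n\to\{0,1\}$ agreeing with $f^*$ wherever $f^*\neq *$. The problem $\mathrm{MBPSP}^{*}$ (Partial Minimum Branching Program Size Problem) receives the full truth table of a partial function $f^*:\{0,1\}^n\to\{0,1,*\}$ (of length $N=2^n$) together with a size parameter $s\in[2^n]$, and outputs $1$ iff some extension of $f^*$ is computed by a BP of size at most $s$. The Exponential Time Hypothesis (ETH) states that 3-SAT on $n$ variables cannot be solved in deterministic time $2^{o(n)}$. -}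

module Defs where

open import Data.Nat using (ℕ; zero; suc; _+_; _*_; _^_; _≤_; _<_; ⌊_/2⌋; _%_; _≡ᵇ_)
open import Data.Fin using (Fin; zero; suc; toℕ; _↑ˡ_)
open import Data.Bool using (Bool; true; false; if_then_else_)
open import Data.List using (List; []; _∷_; _++_; length; replicate; concat; map)
open import Data.Vec using (Vec; toList; lookup) renaming (map to vmap)
open import Data.Maybe using (Maybe; just; nothing)
open import Data.Product using (Σ; ∃; ∃₂; _×_; _,_; proj₁; proj₂)
open import Data.Sum using (_⊎_; inj₁; inj₂)
open import Relation.Binary.PropositionalEquality using (_≡_; _≢_)
open import Relation.Nullary using (¬_)
open import Data.List.Relation.Unary.All using (All)
open import Data.Vec.Relation.Unary.Any using () renaming (Any to VAny)

-- Machine model: deterministic single-tape Turing machines.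
-- Input alphabet Fin σ; tape alphabet = blank (nothing) or Fin (σ + work),
-- input symbol i is written as  just (i ↑ˡ work).
-- Non-halting states Fin (suc states), start state zero.  A transition
-- into  inj₂ b  halts with output b.

data Move : Set where
  left right stay : Move

record TM (σ : ℕ) : Set where
  field
    states : ℕ
    work   : ℕ
    δ : Fin (suc states) → Maybe (Fin (σ + work)) →
        (Fin (suc states) ⊎ Bool) × Maybe (Fin (σ + work)) × Move

module _ {σ : ℕ} (M : TM σ) where
  open TM M

  Sym : Set
  Sym = Maybe (Fin (σ + work))

  -- state, cells left of the head (nearest first), head cell, cells right of the head
  record Config : Set where
    constructor conf
    field
      state : Fin (suc states)
      lft   : List Sym
      hd    : Sym
      rgt   : List Sym

  move : Fin (suc states) → List Sym → Sym → List Sym → Move → Config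
  move q []      w r       left  = conf q [] w r
  move q (a ∷ l) w r       left  = conf q l a (w ∷ r)
  move q l       w []      right = conf q (w ∷ l) nothing []
  move q l       w (a ∷ r) right = conf q (w ∷ l) a r
  move q l       w r       stay  = conf q l w r

  step : Config → Config ⊎ Bool
  step (conf q l h r) with δ q h
  ... | inj₂ b  , _ , _ = inj₂ b
  ... | inj₁ q' , w , m = inj₁ (move q' l w r m)

  exec : ℕ → Config ⊎ Bool → Config ⊎ Bool
  exec zero    c        = c
  exec (suc t) (inj₁ c) = exec t (step c)
  exec (suc t) (inj₂ b) = inj₂ b

  inSym : Fin σ → Sym
  inSym i = just (i ↑ˡ work)

  initConf : List (Fin σ) → Config
  initConf []      = conf zero [] nothing []
  initConf (a ∷ x) = conf zero [] (inSym a) (map inSym x)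

  HaltsWithin : List (Fin σ) → ℕ → Set
  HaltsWithin x t = ∃ λ b → exec t (inj₁ (initConf x)) ≡ inj₂ b

  Decides : List (Fin σ) → Set → Set
  Decides x P = ∃₂ λ t b → exec t (inj₁ (initConf x)) ≡ inj₂ b
                         × (b ≡ true → P) × (P → b ≡ true)

s0 s1 s2 s3 : Fin 4
s0 = zero
s1 = suc zero
s2 = suc (suc zero)
s3 = suc (suc (suc zero))

-- 3-SAT.  A literal is (polarity , variable); it is true under a iff a v ≡ polarity.

Lit : ℕ → Set
Lit n = Bool × Fin n

Clause : ℕ → Set
Clause n = Vec (Lit n) 3

CNF3 : ℕ → Set
CNF3 n = List (Clause n)

Satisfiable : {n : ℕ} → CNF3 n → Set
Satisfiable {n} φ = ∃ λ (a : Fin n → Bool) →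
  All (λ c → VAny (λ l → a (proj₂ l) ≡ proj₁ l) c) φ

encLit : {n : ℕ} → Lit n → List (Fin 4)
encLit (p , i) = (if p then s1 else s0) ∷ (replicate (toℕ i) s2 ++ (s3 ∷ []))

encCNF3 : (n : ℕ) → CNF3 n → List (Fin 4)
encCNF3 n φ = replicate n s1 ++ (s3 ∷ concat (map (λ c → concat (toList (vmap encLit c))) φ))

-- ETH: no algorithm decides 3-SAT in time 2^{o(n)} · poly(input length).
-- "time ≤ C·2^{n/k}·poly" is written  t ^ k ≤ c * 2 ^ n * (1 + |x|) ^ c .
ETH : Set
ETH = ¬ (Σ (TM 4) λ M →
          (∀ n (φ : CNF3 n) → Decides M (encCNF3 n φ) (Satisfiable φ))
        × (∀ k → 1 ≤ k → ∃ λ c → ∀ n (φ : CNF3 n) → ∃ λ t →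
              HaltsWithin M (encCNF3 n φ) t
            × t ^ k ≤ c * 2 ^ n * (suc (length (encCNF3 n φ))) ^ c))

data PVal : Set where
  p0 p1 star : PVal

bit : ℕ → ℕ → Bool
bit m zero    = (m % 2) ≡ᵇ 1
bit m (suc i) = bit ⌊ m /2⌋ i

assign : {n : ℕ} → Fin (2 ^ n) → Fin n → Bool
assign j i = bit (toℕ j) (toℕ i)

PartialTT : ℕ → Set
PartialTT n = Vec PVal (2 ^ n)

Extends : {n : ℕ} → PartialTT n → ((Fin n → Bool) → Bool) → Set
Extends {n} f* f = ∀ (j : Fin (2 ^ n)) →
    (lookup f* j ≡ p0 → f (assign j) ≡ false)
  × (lookup f* j ≡ p1 → f (assign j) ≡ true)

-- Branching programs.  BP n k has exactly (suc k) non-sink nodes,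
-- numbered in a topological order (edges go to strictly larger numbers,
-- so the graph is acyclic), and two sinks inj₂ false / inj₂ true.
-- Node zero is the source; the single-source requirement says every
-- other node, including both sinks, has an incoming edge.

record BP (n k : ℕ) : Set where
  field
    var  : Fin (suc k) → Fin n
    next : Fin (suc k) → Bool → Fin (suc k) ⊎ Bool
    topo : ∀ i b j → next i b ≡ inj₁ j → toℕ i < toℕ j
    nodePred : ∀ (j : Fin (suc k)) → toℕ j ≢ 0 → ∃₂ λ i b → next i b ≡ inj₁ j
    sinkPred : ∀ (c : Bool) → ∃₂ λ i b → next i b ≡ inj₂ c

data Reaches {n k : ℕ} (B : BP n k) (x : Fin n → Bool) : Fin (suc k) ⊎ Bool → Bool → Set where
  sink : ∀ b → Reaches B x (inj₂ b) b
  node : ∀ i b → Reaches B x (BP.next B i (x (BP.var B i))) b → Reaches B x (inj₁ i) b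

Computes : {n k : ℕ} → BP n k → ((Fin n → Bool) → Bool) → Set
Computes B f = ∀ x → Reaches B x (inj₁ zero) (f x)

-- size of a BP n k is suc k
MBPSP* : (n : ℕ) → PartialTT n → ℕ → Set
MBPSP* n f* s = ∃ λ (f : (Fin n → Bool) → Bool) → Extends f* f
  × ∃ λ k → suc k ≤ s × Σ (BP n k) λ B → Computes B f

encPVal : PVal → Fin 4
encPVal p0   = s0
encPVal p1   = s1
encPVal star = s2

binary : ℕ → ℕ → List (Fin 4)
binary zero    m = []
binary (suc w) m = (if (m % 2) ≡ᵇ 1 then s1 else s0) ∷ binary w ⌊ m /2⌋

encMBPSP : (n : ℕ) → PartialTT n → ℕ → List (Fin 4)
encMBPSP n f* s = toList (vmap encPVal f*) ++ (s3 ∷ binary (suc n) s)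

{-# OPTIONS --safe #-}
module Submission where

{- The reduction.  Let b be the least number with n ≤ Σ_{i<b} i 2^i (≤ b 2^b) and m = 2^b; then
   n = Θ(b m), and a 3-SAT variable v < n can be written v = r m + i with r < b, i < m.  An assignment
   is a map i ↦ value(i) < m whose r-th bit is the value of the variable r m + i.  The partial function
   has 9 m variables X_p i, Y_p j, D_p j (p < 3), and the intended extensions are the functions
       f_ρ = OR_{p,i} (X_p i ∧ Y_p (ρ_p i)) ∨ OR_{p,j} (D_p j ∧ Y_p j),
   which have branching programs with 9 m nodes: for every Y-variable y a chain of the variables matched
   to y, followed by y.  Since f_ρ (X_I, Y_J) = 1 iff ρ maps some element of I into J, a single row of the
   truth table can require that one of three conditions "bit r of ρ_p i is a" holds, one for each p; this
   encodes the clauses, and further rows force ρ_0 = ρ_1 = ρ_2.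

   Conversely, the rows with X = D = 0 or Y = 0 and the rows with a single D make every variable
   essential, so a program with at most 9 m nodes reads each variable at exactly one node.  Ordering the
   variables along the program, two inputs that pass through the same node can be spliced there.  By splicing,
   an X-variable x either determines a unique y after it ("right") or a unique y before it ("left"), and
   taking these as ρ(x), every accepted input contains some x together with ρ(x): this is checked on
   minimal accepted inputs.

   The time.  The truth table has 2^(9m) rows with m = O(n / log n), so it is written in time 2^o(n);
   and n'^n' = 2^O(n) for n' = 9 m, so that t^k ≤ n'^n' for all k makes t = 2^o(n).  The reduction is
   programmed on a machine with twelve stacks, which are kept on parallel tracks of the tape and of
   which one step is simulated by four sweeps over the tape. -}

open import Defs
open import Data.Nat
open import Data.Nat.Properties
open import Data.Nat.DivMod using (_/_; _%_; m%n<n; m≡m%n+[m/n]*n; m<n*o⇒m/o<n; [m+kn]%n≡m%n)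
open import Data.Nat.Solver using (module +-*-Solver)
open import Data.Fin using (Fin; zero; suc; toℕ; fromℕ<; inject₁; punchOut; #_; join; splitAt; combine; remQuot; _↑ʳ_)
import Data.Fin.Properties as Fin
open import Data.Bool using (Bool; true; false; if_then_else_; not; _∨_; _∧_) renaming (_≟_ to _≟ᵇ_)
open import Data.Bool.Properties using (¬-not; not-¬; ∨-identityʳ; ∨-idem; ∨-zeroʳ)
open import Data.Unit using (⊤; tt)
open import Data.Empty using (⊥; ⊥-elim)
open import Data.List using (List; []; _∷_; length; map; head; filter; allFin; concat; foldl; replicate; applyUpTo; _++_; _ʳ++_)
import Data.List.Properties as List
open import Data.List.Properties using (length-map; length-tabulate; length-applyUpTo; map-applyUpTo; length-++; length-replicate; map-++; map-replicate; ++-assoc; ++-identityʳ; ʳ++-ʳ++; ++-ʳ++; applyUpTo-∷ʳ)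
open import Data.List.Membership.Propositional using (_∈_)
open import Data.List.Membership.Propositional.Properties using (∈-filter⁺; ∈-filter⁻; ∈-allFin; ∈-map⁺; ∈-map⁻)
open import Data.List.Relation.Unary.Any using (here; there)
open import Data.List.Relation.Unary.All as All using (All; []; _∷_)
open import Data.List.Relation.Unary.AllPairs using ([]; _∷_)
open import Data.List.Relation.Unary.Unique.Propositional using (Unique)
open import Data.List.Relation.Unary.Unique.Propositional.Properties using (allFin⁺)
open import Data.Vec using (Vec; []; _∷_; lookup; zipWith; tabulate; toList; _[_]≔_) renaming (map to vmap; replicate to vreplicate)
open import Data.Vec.Properties using (lookup-map; lookup-zipWith; lookup-replicate; lookup∘tabulate; tabulate-cong)
open import Data.Vec.Relation.Unary.Any using (here; there) renaming (Any to VAny)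
open import Data.Maybe using (Maybe; just; nothing; maybe′) renaming (map to mapMaybe)
open import Data.Product using (Σ; ∃; ∃₂; _×_; _,_; proj₁; proj₂)
open import Data.Sum using (_⊎_; inj₁; inj₂) renaming (map to map⊎)
open import Relation.Nullary using (¬_; yes; no; Dec; does)
open import Relation.Nullary.Decidable using (_×-dec_; dec-true; dec-false)
open import Relation.Binary.PropositionalEquality
open import Relation.Binary.Definitions using (tri<; tri≈; tri>)


-- Finite types

-- The size bound equals the number of variables, and all rigidity comes from this: once every
-- variable is essential there is no spare node. The function computed by such a program need not be
-- one of the `f_ρ`, nor monotone, so the decoding is one-sided; this suffices because every
-- constraint on `ρ` is imposed by a row with value 1. The dummies `D_p j` serve the splicing: for
-- each Y-variable they provide inputs that pass through its node and whose value is known in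
-- advance. Three copies of the index set are used because in a single copy the index of one literal
-- could be matched into the target set of another, and the row of a clause would then be too easy
-- to satisfy. Packing `b` truth values into one `value(i)` saves the factor log n in the number of
-- variables, and this factor is the log log N of the bound. ETH speaks of one machine that achieves
-- every exponent `n / k`; hence the machine built here does not depend on `k`, and only the
-- constants of its time bound do.

record Enum (X : Set) : Set where
  field
    size    : ℕ
    enc     : X → Fin (suc size)
    dec     : Fin (suc size) → X
    dec-enc : ∀ x → dec (enc x) ≡ x

enum-⊤ : Enum ⊤
enum-⊤ = record { size = 0 ; enc = λ _ → zero ; dec = λ _ → tt ; dec-enc = λ _ → refl }

enum-Fin : ∀ n → Enum (Fin (suc n))
enum-Fin n = record { size = n ; enc = λ i → i ; dec = λ i → i ; dec-enc = λ _ → refl }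

enum-⊎ : {X Y : Set} → Enum X → Enum Y → Enum (X ⊎ Y)
enum-⊎ {X} {Y} a b = record { size = Enum.size a + suc (Enum.size b) ; enc = e ; dec = d ; dec-enc = de }
  where
  e : X ⊎ Y → Fin (suc (Enum.size a) + suc (Enum.size b))
  e s = join (suc (Enum.size a)) (suc (Enum.size b)) (map⊎ (Enum.enc a) (Enum.enc b) s)
  d : Fin (suc (Enum.size a) + suc (Enum.size b)) → X ⊎ Y
  d i = map⊎ (Enum.dec a) (Enum.dec b) (splitAt (suc (Enum.size a)) i)
  de : ∀ s → d (e s) ≡ s
  de s rewrite Fin.splitAt-join (suc (Enum.size a)) (suc (Enum.size b)) (map⊎ (Enum.enc a) (Enum.enc b) s) with s
  ... | inj₁ x = cong inj₁ (Enum.dec-enc a x)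
  ... | inj₂ y = cong inj₂ (Enum.dec-enc b y)

enum-× : {X Y : Set} → Enum X → Enum Y → Enum (X × Y)
enum-× {X} {Y} a b = record { size = Enum.size b + Enum.size a * suc (Enum.size b) ; enc = e ; dec = d ; dec-enc = de }
  where
  e : X × Y → Fin (suc (Enum.size a) * suc (Enum.size b))
  e (x , y) = combine (Enum.enc a x) (Enum.enc b y)
  both : Fin (suc (Enum.size a)) × Fin (suc (Enum.size b)) → X × Y
  both (i , j) = Enum.dec a i , Enum.dec b j
  d : Fin (suc (Enum.size a) * suc (Enum.size b)) → X × Y
  d i = both (remQuot {suc (Enum.size a)} (suc (Enum.size b)) i)
  de : ∀ s → d (e s) ≡ s
  de (x , y) = trans (cong both (Fin.remQuot-combine (Enum.enc a x) (Enum.enc b y)))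
                     (cong₂ _,_ (Enum.dec-enc a x) (Enum.dec-enc b y))

-- The simulation decodes only what it has encoded, so a one-sided inverse suffices and a code type
-- may be larger than the type it represents.
enum-retract : {X Y : Set} (to : X → Y) (from : Y → X) → (∀ x → from (to x) ≡ x) → Enum Y → Enum X
enum-retract to from eq a = record
  { size = Enum.size a ; enc = λ x → Enum.enc a (to x) ; dec = λ i → from (Enum.dec a i)
  ; dec-enc = λ x → trans (cong from (Enum.dec-enc a (to x))) (eq x) }

enum-Maybe : {X : Set} → Enum X → Enum (Maybe X)
enum-Maybe {X} a = enum-retract to from (λ { (just _) → refl ; nothing → refl }) (enum-⊎ enum-⊤ a)
  where
  to : Maybe X → ⊤ ⊎ X
  to nothing  = inj₁ tt
  to (just x) = inj₂ x
  from : ⊤ ⊎ X → Maybe X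
  from (inj₁ _) = nothing
  from (inj₂ x) = just x

enum-Bool : Enum Bool
enum-Bool = enum-retract to from (λ { true → refl ; false → refl }) (enum-Fin 1)
  where
  to : Bool → Fin 2
  to false = zero
  to true  = suc zero
  from : Fin 2 → Bool
  from zero    = false
  from (suc _) = true

enum-Vec : {X : Set} → Enum X → ∀ n → Enum (Vec X n)
enum-Vec a zero    = enum-retract (λ _ → tt) (λ _ → []) (λ { [] → refl }) enum-⊤
enum-Vec a (suc n) = enum-retract (λ { (x ∷ v) → x , v }) (λ (x , v) → x ∷ v) (λ { (x ∷ v) → refl }) (enum-× a (enum-Vec a n))

-- Stacks as tracks of a tape

lookup-ext : ∀ {X : Set} {n} {u v : Vec X n} → (∀ i → lookup u i ≡ lookup v i) → u ≡ v
lookup-ext {u = []}    {[]}    h = refl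
lookup-ext {u = x ∷ u} {y ∷ v} h = cong₂ _∷_ (h zero) (lookup-ext (λ i → h (suc i)))

data Act (A : Set) : Set where
  nop pop : Act A
  push    : A → Act A

actOn : {A : Set} → Act A → List A → List A
actOn nop      l       = l
actOn pop      []      = []
actOn pop      (_ ∷ l) = l
actOn (push a) l       = a ∷ l

length-actOn : {A : Set} (o : Act A) (l : List A) → length (actOn o l) ≤ suc (length l)
length-actOn nop      l       = n≤1+n _
length-actOn pop      []      = z≤n
length-actOn pop      (_ ∷ l) = m≤n⇒m≤1+n (n≤1+n _)
length-actOn (push a) l       = ≤-refl

module Stacks {K : ℕ} {A Q : Set} (δ : Q → Vec (Maybe A) K → (Q × Vec (Act A) K) ⊎ Bool) where

  Store : Set
  Store = Vec (List A) K

  after : Store → (Q × Vec (Act A) K) ⊎ Bool → (Q × Store) ⊎ Bool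
  after S (inj₁ (q , o)) = inj₁ (q , zipWith actOn o S)
  after S (inj₂ b)       = inj₂ b

  stackStep : Q × Store → (Q × Store) ⊎ Bool
  stackStep (q , S) = after S (δ q (vmap head S))

  infix 4 _⇒⟨_⟩_
  -- `done` exists at every `n`: the index is an upper bound on the number of steps, so that bounds
  -- can be added and weakened without exact counting.
  data _⇒⟨_⟩_ : Q × Store → ℕ → Q × Store → Set where
    done : ∀ {c n} → c ⇒⟨ n ⟩ c
    more : ∀ {c c′ c″ n} → stackStep c ≡ inj₁ c′ → c′ ⇒⟨ n ⟩ c″ → c ⇒⟨ suc n ⟩ c″

  ⇒-mono : ∀ {c c′ m n} → m ≤ n → c ⇒⟨ m ⟩ c′ → c ⇒⟨ n ⟩ c′
  ⇒-mono m≤n       done       = done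
  ⇒-mono (s≤s m≤n) (more e r) = more e (⇒-mono m≤n r)

  infixr 5 _⨾_
  _⨾_ : ∀ {c c′ c″ m n} → c ⇒⟨ m ⟩ c′ → c′ ⇒⟨ n ⟩ c″ → c ⇒⟨ m + n ⟩ c″
  _⨾_ {m = m} done r′ = ⇒-mono (m≤n+m _ m) r′
  more e r ⨾ r′       = more e (r ⨾ r′)

-- The stack content as a function of the height, counted from the bottom.
cellAt : {A : Set} → List A → ℕ → Maybe A
cellAt []      p = nothing
cellAt (a ∷ l) p with p ≟ length l
... | yes _ = just a
... | no  _ = cellAt l p

at-top : {A : Set} (a : A) (l : List A) → cellAt (a ∷ l) (length l) ≡ just a
at-top a l with length l ≟ length l
... | yes _  = refl
... | no  ne = ⊥-elim (ne refl)

at-other : {A : Set} (a : A) (l : List A) {p : ℕ} → p ≢ length l → cellAt (a ∷ l) p ≡ cellAt l p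
at-other a l {p} ne with p ≟ length l
... | yes e = ⊥-elim (ne e)
... | no  _ = refl

at-≥ : {A : Set} (l : List A) {p : ℕ} → length l ≤ p → cellAt l p ≡ nothing
at-≥ []      le = refl
at-≥ (a ∷ l) le = trans (at-other a l (λ e → <-irrefl (sym e) le)) (at-≥ l (<⇒≤ le))

at-nothing : {A : Set} (l : List A) (p : ℕ) → cellAt l p ≡ nothing → length l ≤ p
at-nothing []      p e = z≤n
at-nothing (a ∷ l) p e with p ≟ length l
at-nothing (a ∷ l) p () | yes _
... | no ne = ≤∧≢⇒< (at-nothing l p e) (λ e′ → ne (sym e′))

at-just : {A : Set} (l : List A) {p : ℕ} {a : A} → cellAt l p ≡ just a → p < length l
at-just l {p} e with p <? length l
... | yes lt = lt
... | no  nl with trans (sym e) (at-≥ l (≮⇒≥ nl))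
...   | ()

nthMaybe : {A : Set} → List A → ℕ → Maybe A
nthMaybe []      k       = nothing
nthMaybe (a ∷ l) zero    = just a
nthMaybe (a ∷ l) (suc k) = nthMaybe l k

at-below-ʳ++ : {A : Set} (l acc : List A) {p : ℕ} → p < length acc → cellAt (l ʳ++ acc) p ≡ cellAt acc p
at-below-ʳ++ []      acc lt = refl
at-below-ʳ++ (a ∷ l) acc lt = trans (at-below-ʳ++ l (a ∷ acc) (m≤n⇒m≤1+n lt)) (at-other a acc (<⇒≢ lt))

at-ʳ++ : {A : Set} (l acc : List A) (k : ℕ) → cellAt (l ʳ++ acc) (length acc + k) ≡ nthMaybe l k
at-ʳ++ []      acc k       = at-≥ acc (m≤m+n _ k)
at-ʳ++ (a ∷ l) acc zero    =
  trans (at-below-ʳ++ l (a ∷ acc) (s≤s (≤-reflexive (+-identityʳ (length acc)))))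
        (trans (cong (cellAt (a ∷ acc)) (+-identityʳ (length acc))) (at-top a acc))
at-ʳ++ (a ∷ l) acc (suc k) =
  trans (cong (cellAt (l ʳ++ (a ∷ acc))) (+-suc (length acc) k)) (at-ʳ++ l (a ∷ acc) k)

orElse : {A : Set} → Maybe A → Maybe A → Maybe A
orElse (just a) _ = just a
orElse nothing  m = m

-- What a head moving right remembers of a track: the last symbol seen, which is the top of the
-- stack once the sweep has passed its height.
lastBelow : {A : Set} → List A → ℕ → Maybe A
lastBelow l zero    = nothing
lastBelow l (suc p) = orElse (cellAt l p) (lastBelow l p)

lastBelow-head : {A : Set} (l : List A) (p : ℕ) → length l ≤ p → lastBelow l p ≡ head l
lastBelow-head []      zero    le = refl
lastBelow-head []      (suc p) le = lastBelow-head [] p z≤n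
lastBelow-head (a ∷ l) (suc p) (s≤s le) with p ≟ length l
... | yes refl = refl
... | no  ne   rewrite at-≥ l le =
  lastBelow-head (a ∷ l) p (≤∧≢⇒< le (λ e → ne (sym e)))

isBlank : {A : Set} {n : ℕ} → Vec (Maybe A) n → Bool
isBlank []            = true
isBlank (nothing ∷ v) = isBlank v
isBlank (just _ ∷ v)  = false

isBlank-true : ∀ {A : Set} {n} (v : Vec (Maybe A) n) → isBlank v ≡ true → ∀ i → lookup v i ≡ nothing
isBlank-true (nothing ∷ v) e zero    = refl
isBlank-true (nothing ∷ v) e (suc i) = isBlank-true v e i
isBlank-true (just x ∷ v)  () i

isBlank-false : ∀ {A : Set} {n} (v : Vec (Maybe A) n) → isBlank v ≡ false → ∃₂ λ i a → lookup v i ≡ just a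
isBlank-false (nothing ∷ v) e with isBlank-false v e
... | i , a , e′ = suc i , a , e′
isBlank-false (just x ∷ v)  e = zero , x , refl

popA : {A : Set} → Act A → Maybe A → Act A
popA pop (just _) = nop
popA o   _        = o

popW : {A : Set} → Act A → Maybe A → Maybe A
popW pop (just _) = nothing
popW o   m        = m

pushA : {A : Set} → Act A → Maybe A → Act A
pushA (push a) nothing = nop
pushA o        _       = o

pushW : {A : Set} → Act A → Maybe A → Maybe A
pushW (push a) nothing = just a
pushW o        m       = m

popPart : {A : Set} → Act A → List A → List A
popPart pop l = actOn pop l
popPart o   l = l

pushPart : {A : Set} → Act A → Maybe A
pushPart (push a) = just a
pushPart _        = nothing

pushMaybe : {A : Set} → Maybe A → List A → List A
pushMaybe nothing  l = l
pushMaybe (just a) l = a ∷ l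

actOn-parts : {A : Set} (o : Act A) (l : List A) → pushMaybe (pushPart o) (popPart o l) ≡ actOn o l
actOn-parts nop      l = refl
actOn-parts pop      l = refl
actOn-parts (push a) l = refl

-- One track during the leftward (popping) sweep; k bounds the height still to be inspected.
data Popping {A : Set} (l : List A) (o a : Act A) (tr : ℕ → Maybe A) (k : ℕ) : Set where
  pending  : a ≡ o → (∀ p → tr p ≡ cellAt l p) → (o ≡ pop → length l ≤ k) → Popping l o a tr k
  finished : o ≡ pop → a ≡ nop → (∀ p → tr p ≡ cellAt (actOn pop l) p) → Popping l o a tr k

-- Moving left, the first nonblank cell of a track is the top of its stack. Erasing it turns the
-- carried action into `nop`, so nothing below is erased.
Popping-step : ∀ {A : Set} {l : List A} {o a tr h} → Popping l o a tr (suc h) →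
  ∀ {tr′} → tr′ h ≡ popW a (tr h) → (∀ p → p ≢ h → tr′ p ≡ tr p) → Popping l o (popA a (tr h)) tr′ h
Popping-step {l = l} {nop} {tr = tr} {h} (pending refl t b) {tr′} e ne = pending refl go (λ ())
  where
  go : ∀ p → tr′ p ≡ cellAt l p
  go p with p ≟ h
  ... | yes refl = trans e (t p)
  ... | no  n    = trans (ne p n) (t p)
Popping-step {l = l} {push x} {tr = tr} {h} (pending refl t b) {tr′} e ne = pending refl go (λ ())
  where
  go : ∀ p → tr′ p ≡ cellAt l p
  go p with p ≟ h
  ... | yes refl = trans e (t p)
  ... | no  n    = trans (ne p n) (t p)
Popping-step {l = l} {pop} {tr = tr} {h} (pending refl t b) {tr′} e ne with tr h in eq
... | nothing = pending refl go (λ _ → at-nothing l h (trans (sym (t h)) eq))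
  where
  go : ∀ p → tr′ p ≡ cellAt l p
  go p with p ≟ h
  ... | yes refl = trans e (trans (sym eq) (t p))
  ... | no  n    = trans (ne p n) (t p)
... | just x = finished refl refl (go l t len)
  where
  len : length l ≡ suc h
  len = ≤-antisym (b refl) (at-just l (trans (sym (t h)) eq))
  go : ∀ l → (∀ p → tr p ≡ cellAt l p) → length l ≡ suc h → ∀ p → tr′ p ≡ cellAt (actOn pop l) p
  go (y ∷ l) t len p with p ≟ h
  ... | yes refl = trans e (sym (at-≥ l (≤-reflexive (suc-injective len))))
  ... | no  n    = trans (ne p n) (trans (t p) (at-other y l (λ e′ → n (trans e′ (suc-injective len)))))
Popping-step {l = l} {tr = tr} {h} (finished e₁ refl t) {tr′} e ne = finished e₁ refl go
  where
  go : ∀ p → tr′ p ≡ cellAt (actOn pop l) p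
  go p with p ≟ h
  ... | yes refl = trans e (t p)
  ... | no  n    = trans (ne p n) (t p)

-- A pop still pending at the left end has met no symbol: the stack was empty, and popping leaves it
-- so.
Popping-end : ∀ {A : Set} {l : List A} {o a tr} → Popping l o a tr 0 →
  (∀ p → tr p ≡ cellAt (popPart o l) p) × pushPart a ≡ pushPart o
Popping-end {o = nop}               (pending refl t b) = t , refl
Popping-end {o = push x}            (pending refl t b) = t , refl
Popping-end {l = l} {o = pop}       (pending refl t b) with l | b refl
... | [] | _ = t , refl
Popping-end                         (finished refl refl t) = t , refl

-- One track during the rightward (pushing) sweep with the head at height h.
data Pushing {A : Set} (l : List A) (o : Maybe A) (a : Act A) (tr : ℕ → Maybe A) (h : ℕ) : Set where
  pending  : pushPart a ≡ o → (∀ p → tr p ≡ cellAt l p) → (o ≢ nothing → h ≤ length l) → Pushing l o a tr h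
  finished : pushPart a ≡ nothing → (∀ p → tr p ≡ cellAt (pushMaybe o l) p) → Pushing l o a tr h

-- Moving right from the bottom, the first blank cell of a track is the place just above its top. A
-- blank cell therefore settles the track whatever its action was; the second conclusion records
-- this for the row at which the sweep turns.
Pushing-step : ∀ {A : Set} {l : List A} {o a tr h} → Pushing l o a tr h →
  ∀ {tr′} → tr′ h ≡ pushW a (tr h) → (∀ p → p ≢ h → tr′ p ≡ tr p) →
  Pushing l o (pushA a (tr h)) tr′ (suc h) × (tr h ≡ nothing → ∀ p → tr′ p ≡ cellAt (pushMaybe o l) p)
Pushing-step {l = l} {a = nop} {tr} {h} (pending refl t b) {tr′} e ne =
  pending refl go (λ n → ⊥-elim (n refl)) , (λ _ → go)
  where
  go : ∀ p → tr′ p ≡ cellAt l p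
  go p with p ≟ h
  ... | yes refl = trans e (t p)
  ... | no  n    = trans (ne p n) (t p)
Pushing-step {l = l} {a = pop} {tr} {h} (pending refl t b) {tr′} e ne =
  pending refl go (λ n → ⊥-elim (n refl)) , (λ _ → go)
  where
  go : ∀ p → tr′ p ≡ cellAt l p
  go p with p ≟ h
  ... | yes refl = trans e (t p)
  ... | no  n    = trans (ne p n) (t p)
Pushing-step {l = l} {a = push x} {tr} {h} (pending refl t b) {tr′} e ne with tr h in eq
... | just y = pending refl go (λ _ → at-just l (trans (sym (t h)) eq)) , (λ ())
  where
  go : ∀ p → tr′ p ≡ cellAt l p
  go p with p ≟ h
  ... | yes refl = trans e (trans (sym eq) (t p))
  ... | no  n    = trans (ne p n) (t p)
... | nothing = finished refl go , (λ _ → go)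
  where
  len : length l ≡ h
  len = ≤-antisym (at-nothing l h (trans (sym (t h)) eq)) (b (λ ()))
  go : ∀ p → tr′ p ≡ cellAt (x ∷ l) p
  go p with p ≟ h
  ... | yes refl = trans e (sym (trans (cong (cellAt (x ∷ l)) (sym len)) (at-top x l)))
  ... | no  n    = trans (ne p n) (trans (t p) (sym (at-other x l (λ e′ → n (trans e′ len)))))
Pushing-step {l = l} {o = o} {a = a} {tr} {h} (finished d t) {tr′} e ne =
  finished (keepA a d) go , (λ _ → go)
  where
  keepA : ∀ a → pushPart a ≡ nothing → pushPart (pushA a (tr h)) ≡ nothing
  keepA nop d = refl
  keepA pop d = refl
  keepW : ∀ a → pushPart a ≡ nothing → pushW a (tr h) ≡ tr h
  keepW nop d = refl
  keepW pop d = refl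
  go : ∀ p → tr′ p ≡ cellAt (pushMaybe o l) p
  go p with p ≟ h
  ... | yes refl = trans e (trans (keepW a d) (t p))
  ... | no  n    = trans (ne p n) (t p)

-- Multi-stack machines on a single-tape Turing machine

module Runs {σ : ℕ} (M : TM σ) where

  data Goes : Config M → ℕ → Config M → Set where
    done : ∀ {c n} → Goes c n c
    more : ∀ {c c′ c″ n} → step M c ≡ inj₁ c′ → Goes c′ n c″ → Goes c (suc n) c″

  Goes-mono : ∀ {c c′ m n} → m ≤ n → Goes c m c′ → Goes c n c′
  Goes-mono le       done       = done
  Goes-mono (s≤s le) (more e g) = more e (Goes-mono le g)

  Goes-trans : ∀ {c c′ c″ m n} → Goes c m c′ → Goes c′ n c″ → Goes c (m + n) c″
  Goes-trans {m = m} done h = Goes-mono (m≤n+m _ m) h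
  Goes-trans (more e g)   h = more e (Goes-trans g h)

  exec-inj₂ : ∀ n b → exec M n (inj₂ b) ≡ inj₂ b
  exec-inj₂ zero    b = refl
  exec-inj₂ (suc n) b = refl

  Goes-halt : ∀ {c n c′ b} → Goes c n c′ → step M c′ ≡ inj₂ b → exec M (suc n) (inj₁ c) ≡ inj₂ b
  Goes-halt {c = c} {n} {b = b} done e = trans (cong (exec M n) e) (exec-inj₂ n b)
  Goes-halt {n = suc n} (more e g) h = trans (cong (exec M (suc n)) e) (Goes-halt g h)

belows : {C : Set} → (ℕ → C) → ℕ → List C
belows T zero    = []
belows T (suc h) = T h ∷ belows T h

belows-cong : ∀ {C : Set} {T T′ : ℕ → C} h → (∀ p → p < h → T p ≡ T′ p) → belows T h ≡ belows T′ h
belows-cong zero    e = refl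
belows-cong (suc h) e = cong₂ _∷_ (e h ≤-refl) (belows-cong h (λ p lt → e p (m≤n⇒m≤1+n lt)))

nthOr : {X : Set} → X → List X → ℕ → X
nthOr d []      k       = d
nthOr d (a ∷ l) zero    = a
nthOr d (a ∷ l) (suc k) = nthOr d l k

update : {C : Set} → (ℕ → C) → ℕ → C → ℕ → C
update V h w p with p ≟ h
... | yes _ = w
... | no  _ = V p

update-same : ∀ {C : Set} (V : ℕ → C) h w → update V h w h ≡ w
update-same V h w with h ≟ h
... | yes _ = refl
... | no ne = ⊥-elim (ne refl)

update-other : ∀ {C : Set} (V : ℕ → C) h w p → p ≢ h → update V h w p ≡ V p
update-other V h w p ne with p ≟ h
... | yes e = ⊥-elim (ne e)
... | no  _ = refl

module Tracks {K′ : ℕ} {A Q : Set} (EA : Enum A) (EQ : Enum Q) (raw : Fin 4 → A) (q₀ : Q)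
              (δ : Q → Vec (Maybe A) (suc K′) → (Q × Vec (Act A) (suc K′)) ⊎ Bool) where

  open Stacks δ

  K : ℕ
  K = suc K′

  Row : Set
  Row = Vec (Maybe A) K

  Acts : Set
  Acts = Vec (Act A) K

  -- The flag marks the leftmost cell.
  Cell : Set
  Cell = Bool × Row

  data TState : Set where
    init        : TState
    collect     : Q → Row → TState
    popS pushS  : Q → Acts → TState
    back        : Q → TState

  abstract
    enum-Act : Enum (Act A)
    enum-Act = enum-retract to from (λ { nop → refl ; pop → refl ; (push _) → refl }) (enum-Maybe (enum-Maybe EA))
      where
      to : Act A → Maybe (Maybe A)
      to nop      = nothing
      to pop      = just nothing
      to (push a) = just (just a)
      from : Maybe (Maybe A) → Act A
      from nothing         = nop
      from (just nothing)  = pop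
      from (just (just a)) = push a

    enum-TState : Enum TState
    enum-TState = enum-retract to from
      (λ { init → refl ; (collect _ _) → refl ; (popS _ _) → refl ; (pushS _ _) → refl ; (back _) → refl })
      (enum-⊎ enum-⊤ (enum-⊎ (enum-× EQ (enum-Vec (enum-Maybe EA) K))
        (enum-⊎ (enum-× EQ (enum-Vec enum-Act K)) (enum-⊎ (enum-× EQ (enum-Vec enum-Act K)) EQ))))
      where
      Code : Set
      Code = ⊤ ⊎ ((Q × Row) ⊎ ((Q × Acts) ⊎ ((Q × Acts) ⊎ Q)))
      to : TState → Code
      to init          = inj₁ tt
      to (collect q v) = inj₂ (inj₁ (q , v))
      to (popS q o)    = inj₂ (inj₂ (inj₁ (q , o)))
      to (pushS q o)   = inj₂ (inj₂ (inj₂ (inj₁ (q , o))))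
      to (back q)      = inj₂ (inj₂ (inj₂ (inj₂ q)))
      from : Code → TState
      from (inj₁ _)                             = init
      from (inj₂ (inj₁ (q , v)))                = collect q v
      from (inj₂ (inj₂ (inj₁ (q , o))))         = popS q o
      from (inj₂ (inj₂ (inj₂ (inj₁ (q , o)))))  = pushS q o
      from (inj₂ (inj₂ (inj₂ (inj₂ q))))        = back q

    enum-Cell : Enum Cell
    enum-Cell = enum-× enum-Bool (enum-Vec (enum-Maybe EA) K)

    -- Machines start in state `zero`; `init` gets this code because it is the first summand of the
    -- sum.
    enc-init : Enum.enc enum-TState init ≡ zero
    enc-init = refl

  module S = Enum enum-TState
  module C = Enum enum-Cell

  none : Row
  none = vreplicate K nothing

  decide : Bool × Row → (Q × Acts) ⊎ Bool → (TState × Cell × Move) ⊎ Bool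
  decide c (inj₁ (q , o)) = inj₁ (popS q o , c , stay)
  decide c (inj₂ b)       = inj₂ b

  -- The tops are read in `collect`, at whose end the transition of the stack machine is chosen;
  -- `popS` and `pushS` carry it out. Right sweeps turn at the first row that is blank on all
  -- tracks, left sweeps at the flagged cell, since a machine cannot sense the left end of its tape.
  δC : TState → Cell → (TState × Cell × Move) ⊎ Bool
  δC init          (m , v) = inj₁ (collect q₀ none , (true , v) , stay)
  δC (collect q u) (m , v) =
    if isBlank v then decide (m , v) (δ q u)
                 else inj₁ (collect q (zipWith orElse v u) , (m , v) , right)
  δC (popS q o)    (m , v) =
    if m then inj₁ (pushS q (zipWith popA o v) , (m , zipWith popW o v) , stay)
         else inj₁ (popS q (zipWith popA o v) , (m , zipWith popW o v) , left)
  δC (pushS q o)   (m , v) =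
    if isBlank v then inj₁ (back q , (m , zipWith pushW o v) , stay)
                 else inj₁ (pushS q (zipWith pushA o v) , (m , zipWith pushW o v) , right)
  δC (back q)      (m , v) =
    if m then inj₁ (collect q none , (m , v) , stay)
         else inj₁ (back q , (m , v) , left)

  Letter : Set
  Letter = Maybe (Fin (4 + suc C.size))

  encC : Cell → Letter
  encC c = just (4 ↑ʳ C.enc c)

  decC′ : Fin 4 ⊎ Fin (suc C.size) → Cell
  decC′ (inj₁ i) = false , just (raw i) ∷ vreplicate K′ nothing
  decC′ (inj₂ e) = C.dec e

  -- An original input symbol reads as a row with that symbol on track 0, an untouched cell as a
  -- blank row. The input tape thus represents the initial stacks as it stands, up to the flag that
  -- `init` sets.
  decC : Letter → Cell
  decC nothing  = false , none
  decC (just k) = decC′ (splitAt 4 k)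

  decC-encC : ∀ c → decC (encC c) ≡ c
  decC-encC c = trans (cong decC′ (Fin.splitAt-↑ʳ 4 (suc C.size) (C.enc c))) (C.dec-enc c)

  result : (TState × Cell × Move) ⊎ Bool → (Fin (suc S.size) ⊎ Bool) × Letter × Move
  result (inj₁ (s , c , m)) = inj₁ (S.enc s) , encC c , m
  result (inj₂ b)           = inj₂ b , nothing , stay

  machine : TM 4
  machine = record { states = S.size ; work = suc C.size ; δ = λ s a → result (δC (S.dec s) (decC a)) }

  open Runs machine public

  nth : List Letter → ℕ → Letter
  nth = nthOr nothing

  -- The tape content is a function `T` of the position. `nth` extends the finite right half by
  -- blanks, so cells that were never visited need no separate treatment.
  record Rep (c : Config machine) (s : TState) (T : ℕ → Cell) (h : ℕ) : Set where
    field
      state≡ : Config.state c ≡ S.enc s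
      lft≡   : map decC (Config.lft c) ≡ belows T h
      hd≡    : decC (Config.hd c) ≡ T h
      rgt≡   : ∀ k → decC (nth (Config.rgt c) k) ≡ T (suc h + k)
  open Rep

  Rep-cong : ∀ {c s T T′ h} → (∀ p → T p ≡ T′ p) → Rep c s T h → Rep c s T′ h
  Rep-cong e r = record
    { state≡ = state≡ r ; lft≡ = trans (lft≡ r) (belows-cong _ (λ p _ → e p))
    ; hd≡ = trans (hd≡ r) (e _) ; rgt≡ = λ k → trans (rgt≡ r k) (e _) }

  step-result : ∀ {c s T h z} → Rep c s T h → δC s (T h) ≡ z →
    TM.δ machine (Config.state c) (Config.hd c) ≡ result z
  step-result {s = s} r e =
    cong result (trans (cong₂ δC (trans (cong S.dec (state≡ r)) (S.dec-enc s)) (hd≡ r)) e)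

  step-inj₁ : ∀ {c q w m} → TM.δ machine (Config.state c) (Config.hd c) ≡ (inj₁ q , w , m) →
    step machine c ≡ inj₁ (move machine q (Config.lft c) w (Config.rgt c) m)
  step-inj₁ {conf q l h r} e rewrite e = refl

  step-inj₂ : ∀ {c b w m} → TM.δ machine (Config.state c) (Config.hd c) ≡ (inj₂ b , w , m) →
    step machine c ≡ inj₂ b
  step-inj₂ {conf q l h r} e rewrite e = refl

  Arrives : Config machine → ℕ → TState → (ℕ → Cell) → ℕ → Set
  Arrives c n s T h = ∃ λ c′ → Goes c n c′ × Rep c′ s T h

  infixr 5 _then_
  _then_ : ∀ {c m s T h n s′ T′ h′} → Arrives c m s T h → (∀ {c′} → Rep c′ s T h → Arrives c′ n s′ T′ h′) →
    Arrives c (m + n) s′ T′ h′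
  (c′ , g , r) then k with k r
  ... | c″ , g′ , r′ = c″ , Goes-trans g g′ , r′

  Arrives-mono : ∀ {c m n s T h} → m ≤ n → Arrives c m s T h → Arrives c n s T h
  Arrives-mono le (c′ , g , r) = c′ , Goes-mono le g , r

  move-right-[] : ∀ {q l w} → move machine q l w [] right ≡ conf q (w ∷ l) nothing []
  move-right-[] {l = []}    = refl
  move-right-[] {l = _ ∷ _} = refl

  move-right-∷ : ∀ {q l w a r} → move machine q l w (a ∷ r) right ≡ conf q (w ∷ l) a r
  move-right-∷ {l = []}    = refl
  move-right-∷ {l = _ ∷ _} = refl

  move-stay : ∀ {q l w r} → move machine q l w r stay ≡ conf q l w r
  move-stay {l = []}    {r = []}    = refl
  move-stay {l = []}    {r = _ ∷ _} = refl
  move-stay {l = _ ∷ _} {r = []}    = refl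
  move-stay {l = _ ∷ _} {r = _ ∷ _} = refl

  move-left : ∀ {q a l w r} → move machine q (a ∷ l) w r left ≡ conf q l a (w ∷ r)
  move-left {r = []}    = refl
  move-left {r = _ ∷ _} = refl

  step-right : ∀ {c s T h s′ w T′} → Rep c s T h → δC s (T h) ≡ inj₁ (s′ , w , right) →
    T′ h ≡ w → (∀ p → p ≢ h → T′ p ≡ T p) → Arrives c 1 s′ T′ (suc h)
  step-right {c} {s} {T} {h} {s′} {w} {T′} r e e₁ e₂ = _ , more (step-inj₁ {c} (step-result r e)) done , rep c r
    where
    low : ∀ p → p < h → T p ≡ T′ p
    low p lt = sym (e₂ p (<⇒≢ lt))
    high : ∀ k → T (suc h + k) ≡ T′ (suc h + k)
    high k = sym (e₂ _ (λ e′ → <-irrefl (sym e′) (s≤s (m≤m+n h k))))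
    rep : ∀ c → Rep c s T h → Rep (move machine (S.enc s′) (Config.lft c) (encC w) (Config.rgt c) right) s′ T′ (suc h)
    rep (conf q l a []) r rewrite move-right-[] {S.enc s′} {l} {encC w} = record
      { state≡ = refl
      ; lft≡ = cong₂ _∷_ (trans (decC-encC w) (sym e₁)) (trans (lft≡ r) (belows-cong h low))
      ; hd≡ = trans (rgt≡ r 0) (trans (high 0) (cong T′ (+-identityʳ (suc h))))
      ; rgt≡ = λ k → trans (rgt≡ r (suc k)) (trans (high (suc k)) (cong T′ (+-suc (suc h) k))) }
    rep (conf q l a (a′ ∷ r′)) r rewrite move-right-∷ {S.enc s′} {l} {encC w} {a′} {r′} = record
      { state≡ = refl
      ; lft≡ = cong₂ _∷_ (trans (decC-encC w) (sym e₁)) (trans (lft≡ r) (belows-cong h low))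
      ; hd≡ = trans (rgt≡ r 0) (trans (high 0) (cong T′ (+-identityʳ (suc h))))
      ; rgt≡ = λ k → trans (rgt≡ r (suc k)) (trans (high (suc k)) (cong T′ (+-suc (suc h) k))) }

  step-stay : ∀ {c s T h s′ w T′} → Rep c s T h → δC s (T h) ≡ inj₁ (s′ , w , stay) →
    T′ h ≡ w → (∀ p → p ≢ h → T′ p ≡ T p) → Arrives c 1 s′ T′ h
  step-stay {c} {s} {T} {h} {s′} {w} {T′} r e e₁ e₂ = _ , more (step-inj₁ {c} (step-result r e)) done , rep c r
    where
    rep : ∀ c → Rep c s T h → Rep (move machine (S.enc s′) (Config.lft c) (encC w) (Config.rgt c) stay) s′ T′ h
    rep (conf q l a r′) r rewrite move-stay {S.enc s′} {l} {encC w} {r′} = record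
      { state≡ = refl
      ; lft≡ = trans (lft≡ r) (belows-cong h (λ p lt → sym (e₂ p (<⇒≢ lt))))
      ; hd≡ = trans (decC-encC w) (sym e₁)
      ; rgt≡ = λ k → trans (rgt≡ r k) (sym (e₂ _ (λ e′ → <-irrefl (sym e′) (s≤s (m≤m+n h k))))) }

  step-left : ∀ {c s T h s′ w T′} → Rep c s T (suc h) → δC s (T (suc h)) ≡ inj₁ (s′ , w , left) →
    T′ (suc h) ≡ w → (∀ p → p ≢ suc h → T′ p ≡ T p) → Arrives c 1 s′ T′ h
  step-left {c} {s} {T} {h} {s′} {w} {T′} r e e₁ e₂ = _ , more (step-inj₁ {c} (step-result r e)) done , rep c r
    where
    rep : ∀ c → Rep c s T (suc h) → Rep (move machine (S.enc s′) (Config.lft c) (encC w) (Config.rgt c) left) s′ T′ h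
    rep (conf q [] a r′) r with lft≡ r
    ... | ()
    rep (conf q (x ∷ l) a r′) r rewrite move-left {S.enc s′} {x} {l} {encC w} {r′} = record
      { state≡ = refl
      ; lft≡ = trans (List.∷-injectiveʳ (lft≡ r)) (belows-cong h (λ p lt → sym (e₂ p (<⇒≢ (m≤n⇒m≤1+n lt)))))
      ; hd≡ = trans (List.∷-injectiveˡ (lft≡ r)) (sym (e₂ h (<⇒≢ ≤-refl)))
      ; rgt≡ = λ { zero → trans (decC-encC w) (trans (sym e₁) (cong T′ (sym (+-identityʳ (suc h)))))
                 ; (suc k) → trans (rgt≡ r k) (trans (sym (e₂ _ (λ e′ → <-irrefl (sym e′) (s≤s (s≤s (m≤m+n h k))))))
                                                     (cong T′ (sym (+-suc (suc h) k)))) } }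

  mk : (ℕ → Row) → ℕ → Cell
  mk V p = (p ≡ᵇ 0) , V p

  mk-update : ∀ (V : ℕ → Row) h w p → p ≢ h → mk (update V h w) p ≡ mk V p
  mk-update V h w p ne = cong (_ ,_) (update-other V h w p ne)

  rows : Store → ℕ → Row
  rows S p = vmap (λ l → cellAt l p) S

  lookup-rows : ∀ S p i → lookup (rows S p) i ≡ cellAt (lookup S i) p
  lookup-rows S p i = lookup-map i (λ l → cellAt l p) S

  lastRow : Store → ℕ → Row
  lastRow S h = vmap (λ l → lastBelow l h) S

  zipWith-orElse : ∀ {n} (S : Vec (List A) n) h →
    zipWith orElse (vmap (λ l → cellAt l h) S) (vmap (λ l → lastBelow l h) S) ≡ vmap (λ l → lastBelow l (suc h)) S
  zipWith-orElse []      h = refl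
  zipWith-orElse (l ∷ S) h = cong (_ ∷_) (zipWith-orElse S h)

  Bounded : Store → ℕ → Set
  Bounded S H = ∀ i → length (lookup S i) ≤ H

  -- A stack fills an initial segment of its track, so a row blank on every track lies above all
  -- stacks. `fuel` bounds the distance to such a row through the height bound `h + fuel`.
  collect-sweep : ∀ {q} S fuel h → Bounded S (h + fuel) → ∀ {c} → Rep c (collect q (lastRow S h)) (mk (rows S)) h →
    ∃ λ h′ → h′ ≤ h + fuel × Bounded S h′ × isBlank (rows S h′) ≡ true
      × Arrives c fuel (collect q (vmap head S)) (mk (rows S)) h′
  collect-sweep {q} S fuel h B {c} r with isBlank (rows S h) in eq
  ... | true  = h , m≤m+n h fuel , short , eq ,
        subst (λ u → Arrives c fuel (collect q u) (mk (rows S)) h) heads (c , done , r)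
    where
    short : Bounded S h
    short i = at-nothing (lookup S i) h (trans (sym (lookup-rows S h i)) (isBlank-true (rows S h) eq i))
    heads : lastRow S h ≡ vmap head S
    heads = lookup-ext (λ i → trans (lookup-map i _ S)
              (trans (lastBelow-head (lookup S i) h (short i)) (sym (lookup-map i head S))))
  ... | false with isBlank-false (rows S h) eq
  ...   | i , a , e with fuel | B | <-≤-trans (at-just (lookup S i) (trans (sym (lookup-rows S h i)) e)) (B i)
  ...     | zero   | _  | lt = ⊥-elim (<-irrefl refl (≤-trans lt (≤-reflexive (+-identityʳ h))))
  ...     | suc f  | B  | lt with step-right {T′ = mk (rows S)} r δeq refl (λ _ _ → refl)
    where
    δeq : δC (collect q (lastRow S h)) (mk (rows S) h) ≡ inj₁ (collect q (lastRow S (suc h)) , mk (rows S) h , right)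
    δeq rewrite eq = cong (λ u → inj₁ (collect q u , mk (rows S) h , right)) (zipWith-orElse S h)
  ...       | c₁ , g , r₁ with collect-sweep S f (suc h) (λ i → ≤-trans (B i) (≤-reflexive (+-suc h f))) r₁
  ...         | h′ , le , s , bl , c₂ , g₂ , r₂ =
                h′ , ≤-trans le (≤-reflexive (sym (+-suc h f))) , s , bl , c₂ , Goes-trans g g₂ , r₂

  track : (ℕ → Row) → Fin K → ℕ → Maybe A
  track V i p = lookup (V p) i

  AllPopping : Store → Acts → Acts → (ℕ → Row) → ℕ → Set
  AllPopping S o a V k = ∀ i → Popping (lookup S i) (lookup o i) (lookup a i) (track V i) k

  popRows : Acts → (ℕ → Row) → ℕ → ℕ → Row
  popRows a V h = update V h (zipWith popW a (V h))

  AllPopping-step : ∀ S o a V h → AllPopping S o a V (suc h) → AllPopping S o (zipWith popA a (V h)) (popRows a V h) h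
  AllPopping-step S o a V h I i rewrite lookup-zipWith popA i a (V h) = Popping-step (I i)
    (trans (cong (λ v → lookup v i) (update-same V h _)) (lookup-zipWith popW i a (V h)))
    (λ p ne → cong (λ v → lookup v i) (update-other V h _ p ne))

  pop-sweep : ∀ {q} S o h V a → AllPopping S o a V (suc h) → ∀ {c} → Rep c (popS q a) (mk V) h →
    ∃₂ λ V′ a′ → Arrives c (suc h) (pushS q a′) (mk V′) 0 × AllPopping S o a′ V′ 0
  pop-sweep S o zero V a I r =
    popRows a V 0 , _ , step-stay r refl (cong (_ ,_) (update-same V 0 _)) (mk-update V 0 _) , AllPopping-step S o a V 0 I
  pop-sweep S o (suc h) V a I r
    with step-left {T′ = mk (popRows a V (suc h))} r refl (cong (_ ,_) (update-same V (suc h) _)) (mk-update V (suc h) _)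
  ... | c₁ , g , r₁ with pop-sweep S o h (popRows a V (suc h)) _ (AllPopping-step S o a V (suc h) I) r₁
  ...   | V″ , a″ , (c₂ , g₂ , r₂) , I″ = V″ , a″ , (c₂ , Goes-trans g g₂ , r₂) , I″

  AllPushing : Store → Vec (Maybe A) K → Acts → (ℕ → Row) → ℕ → Set
  AllPushing S o a V h = ∀ i → Pushing (lookup S i) (lookup o i) (lookup a i) (track V i) h

  pushRows : Acts → (ℕ → Row) → ℕ → ℕ → Row
  pushRows a V h = update V h (zipWith pushW a (V h))

  AllPushing-step : ∀ S o a V h → AllPushing S o a V h →
    AllPushing S o (zipWith pushA a (V h)) (pushRows a V h) (suc h)
    × (isBlank (V h) ≡ true → ∀ i p → track (pushRows a V h) i p ≡ cellAt (pushMaybe (lookup o i) (lookup S i)) p)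
  AllPushing-step S o a V h I = (λ i → proj₁ (both i)) , (λ e i → proj₂ (both i) (isBlank-true (V h) e i))
    where
    both : ∀ i → Pushing (lookup S i) (lookup o i) (lookup (zipWith pushA a (V h)) i) (track (pushRows a V h) i) (suc h)
      × (lookup (V h) i ≡ nothing → ∀ p → track (pushRows a V h) i p ≡ cellAt (pushMaybe (lookup o i) (lookup S i)) p)
    both i rewrite lookup-zipWith pushA i a (V h) = Pushing-step (I i)
      (trans (cong (λ v → lookup v i) (update-same V h _)) (lookup-zipWith pushW i a (V h)))
      (λ p ne → cong (λ v → lookup v i) (update-other V h _ p ne))

  -- A push is carried out at the first blank cell of its own track, hence no later than at the
  -- first row blank on all tracks: nothing is pending when the head turns.
  push-sweep : ∀ {q} S o fuel h V a → AllPushing S o a V h → (∀ i p → h + fuel ≤ p → lookup (V p) i ≡ nothing) →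
    ∀ {c} → Rep c (pushS q a) (mk V) h →
    ∃₂ λ V′ h′ → h′ ≤ h + fuel × Arrives c (suc fuel) (back q) (mk V′) h′
      × (∀ i p → track V′ i p ≡ cellAt (pushMaybe (lookup o i) (lookup S i)) p)
  push-sweep {q} S o fuel h V a I far r with isBlank (V h) in eq
  ... | true =
    pushRows a V h , h , m≤m+n h fuel ,
    Arrives-mono (s≤s z≤n) (step-stay r δeq (cong (_ ,_) (update-same V h _)) (mk-update V h _)) ,
    proj₂ (AllPushing-step S o a V h I) eq
    where
    δeq : δC (pushS q a) (mk V h) ≡ inj₁ (back q , ((h ≡ᵇ 0) , zipWith pushW a (V h)) , stay)
    δeq rewrite eq = refl
  ... | false with isBlank-false (V h) eq
  ...   | i , x , e with fuel | far
  ...     | zero | far with trans (sym e) (far i h (≤-reflexive (+-identityʳ h)))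
  ...       | ()
  push-sweep {q} S o fuel h V a I _ r | false | i , x , e | suc f | far
      with step-right {T′ = mk (pushRows a V h)} r δeq (cong (_ ,_) (update-same V h _)) (mk-update V h _)
    where
    δeq : δC (pushS q a) (mk V h) ≡ inj₁ (pushS q (zipWith pushA a (V h)) , ((h ≡ᵇ 0) , zipWith pushW a (V h)) , right)
    δeq rewrite eq = refl
  ... | c₁ , g , r₁ with push-sweep S o f (suc h) (pushRows a V h) _ (proj₁ (AllPushing-step S o a V h I))
          (λ j p le → trans (cong (λ v → lookup v j)
                        (update-other V h _ p (λ e′ → <-irrefl (sym e′) (≤-trans (s≤s (m≤m+n h f)) le))))
                      (far j p (≤-trans (≤-reflexive (+-suc h f)) le))) r₁
  ...   | V″ , h″ , le , (c₂ , g₂ , r₂) , fin =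
          V″ , h″ , ≤-trans le (≤-reflexive (sym (+-suc h f))) , (c₂ , Goes-trans g g₂ , r₂) , fin

  back-sweep : ∀ {q} V h → ∀ {c} → Rep c (back q) (mk V) h → Arrives c (suc h) (collect q none) (mk V) 0
  back-sweep V zero    r = step-stay r refl refl (λ _ _ → refl)
  back-sweep V (suc h) r = step-left r refl refl (λ _ _ → refl) then back-sweep V h

  -- Four sweeps, each of at most `H` moves and one turn.
  stepCost : ℕ → ℕ
  stepCost H = 4 * (H + 1)

  Ready : Config machine → Q → Store → Set
  Ready c q S = Rep c (collect q none) (mk (rows S)) 0

  lastRow-none : ∀ {n} (S : Vec (List A) n) → vreplicate n nothing ≡ vmap (λ l → lastBelow l 0) S
  lastRow-none []      = refl
  lastRow-none (l ∷ S) = cong (nothing ∷_) (lastRow-none S)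

  sim-step : ∀ {q S q′ S′ H c} → stackStep (q , S) ≡ inj₁ (q′ , S′) → Bounded S H → Ready c q S →
    (∃ λ c′ → Goes c (stepCost H) c′ × Ready c′ q′ S′) × Bounded S′ (suc H)
  sim-step {q} {S} {q′} {S′} {H} {c} e B r with δ q (vmap head S) in eqδ
  sim-step {q} {S} {H = H} {c} refl B r | inj₁ (q′ , o) = final , bounded
    where
    S₂ : Store
    S₂ = zipWith actOn o S
    bounded : Bounded S₂ (suc H)
    bounded i rewrite lookup-zipWith actOn i o S = ≤-trans (length-actOn (lookup o i) (lookup S i)) (s≤s (B i))
    Sp : Store
    Sp = zipWith popPart o S
    final : ∃ λ c′ → Goes c (stepCost H) c′ × Ready c′ q′ S₂
    final with collect-sweep {q} S H 0 B (subst (λ u → Rep c (collect q u) (mk (rows S)) 0) (lastRow-none S) r)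
    ... | h₁ , le₁ , B₁ , bl , (_ , g₁ , r₁) with step-stay {T′ = mk (rows S)} r₁ δeq refl (λ _ _ → refl)
      where
      δeq : δC (collect q (vmap head S)) (mk (rows S) h₁) ≡ inj₁ (popS q′ o , mk (rows S) h₁ , stay)
      δeq rewrite bl | eqδ = refl
    ... | (_ , g₂ , r₂) with pop-sweep S o h₁ (rows S) o
          (λ i → pending refl (λ p → lookup-rows S p i) (λ _ → m≤n⇒m≤1+n (B₁ i))) r₂
    ... | V₃ , a₃ , (_ , g₃ , r₃) , I₃ with push-sweep Sp (vmap pushPart o) H 0 V₃ a₃ Jn far r₃
      where
      tr : ∀ i p → track V₃ i p ≡ cellAt (popPart (lookup o i) (lookup S i)) p
      tr i = proj₁ (Popping-end (I₃ i))
      Jn : AllPushing Sp (vmap pushPart o) a₃ V₃ 0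
      Jn i rewrite lookup-zipWith popPart i o S | lookup-map i pushPart o =
        pending (proj₂ (Popping-end (I₃ i))) (tr i) (λ _ → z≤n)
      short : ∀ o (l : List A) → length (popPart o l) ≤ length l
      short nop      l       = ≤-refl
      short pop      []      = z≤n
      short pop      (_ ∷ l) = n≤1+n _
      short (push _) l       = ≤-refl
      far : ∀ i p → H ≤ p → lookup (V₃ p) i ≡ nothing
      far i p le = trans (tr i p) (at-≥ (popPart (lookup o i) (lookup S i))
                     (≤-trans (short (lookup o i) (lookup S i)) (≤-trans (B i) le)))
    ... | V₄ , h₄ , le₄ , (_ , g₄ , r₄) , fin with back-sweep V₄ h₄ r₄
    ... | c₅ , g₅ , r₅ =
      c₅ , Goes-mono time (Goes-trans g₁ (Goes-trans g₂ (Goes-trans g₃ (Goes-trans g₄ g₅)))) , Rep-cong same r₅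
      where
      time : H + (1 + (suc h₁ + (suc H + suc h₄))) ≤ 4 * (H + 1)
      time = begin
        H + (1 + (suc h₁ + (suc H + suc h₄))) ≤⟨ +-monoʳ-≤ H (s≤s (+-mono-≤ (s≤s le₁) (+-monoʳ-≤ (suc H) (s≤s le₄)))) ⟩
        H + (1 + (suc H + (suc H + suc H)))   ≡⟨ +-suc H _ ⟩
        suc H + (suc H + (suc H + suc H))     ≡⟨ cong (λ z → suc H + (suc H + (suc H + z))) (sym (+-identityʳ (suc H))) ⟩
        4 * suc H                             ≡⟨ cong (4 *_) (+-comm 1 H) ⟩
        4 * (H + 1)                           ∎
        where open ≤-Reasoning
      same : ∀ p → mk V₄ p ≡ mk (rows S₂) p
      same p = cong (_ ,_) (lookup-ext λ i → begin
        lookup (V₄ p) i                                             ≡⟨ fin i p ⟩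
        cellAt (pushMaybe (lookup (vmap pushPart o) i) (lookup Sp i)) p ≡⟨ cong₂ (λ m l → cellAt (pushMaybe m l) p) (lookup-map i pushPart o) (lookup-zipWith popPart i o S) ⟩
        cellAt (pushMaybe (pushPart (lookup o i)) (popPart (lookup o i) (lookup S i))) p ≡⟨ cong (λ l → cellAt l p) (actOn-parts (lookup o i) (lookup S i)) ⟩
        cellAt (actOn (lookup o i) (lookup S i)) p                      ≡⟨ cong (λ l → cellAt l p) (sym (lookup-zipWith actOn i o S)) ⟩
        cellAt (lookup S₂ i) p                                          ≡⟨ sym (lookup-rows S₂ p i) ⟩
        lookup (rows S₂ p) i                                        ∎)
        where open ≡-Reasoning

  Bounded-mono : ∀ S {m n} → m ≤ n → Bounded S m → Bounded S n
  Bounded-mono S le B i = ≤-trans (B i) le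

  -- One stack step raises a height by at most one, so `H + t` bounds all heights throughout, and
  -- each of the `t` steps is charged at that height. The slowdown is quadratic.
  sim-run : ∀ {q S q′ S′ t H c} → (q , S) ⇒⟨ t ⟩ (q′ , S′) → Bounded S H → Ready c q S →
    (∃ λ c′ → Goes c (t * stepCost (H + t)) c′ × Ready c′ q′ S′) × Bounded S′ (H + t)
  sim-run {S = S} {t = t} {H} {c} done B r = (c , done , r) , Bounded-mono S (m≤m+n H t) B
  sim-run {S′ = S′} {t = suc t} {H} (more {c′ = q₁ , S₁} e rest) B r with sim-step e B r
  ... | (c₁ , g₁ , r₁) , B₁ with sim-run rest B₁ r₁
  ... | (c₂ , g₂ , r₂) , B₂ =
    (c₂ , Goes-trans (Goes-mono (mono (m≤m+n H (suc t))) g₁)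
            (Goes-mono (*-monoʳ-≤ t (mono (≤-reflexive (sym (+-suc H t))))) g₂) , r₂) ,
    Bounded-mono S′ (≤-reflexive (sym (+-suc H t))) B₂
    where
    mono : ∀ {m n} → m ≤ n → stepCost m ≤ stepCost n
    mono le = *-monoʳ-≤ 4 (+-monoˡ-≤ 1 le)

  startStore : List (Fin 4) → Store
  startStore x = (map raw x ʳ++ []) ∷ vreplicate K′ []

  nthMaybe-raw : ∀ x k → decC (nth (map (inSym machine) x) k) ≡ (false , nthMaybe (map raw x) k ∷ vreplicate K′ nothing)
  nthMaybe-raw []      k       = refl
  nthMaybe-raw (a ∷ x) zero    = cong decC′ (Fin.splitAt-↑ˡ 4 a (suc C.size))
  nthMaybe-raw (a ∷ x) (suc k) = nthMaybe-raw x k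

  rows-empty : ∀ n p → vmap (λ l → cellAt {A} l p) (vreplicate n []) ≡ vreplicate n nothing
  rows-empty zero    p = refl
  rows-empty (suc n) p = cong (nothing ∷_) (rows-empty n p)

  nth-start : ∀ x p → decC (nth (map (inSym machine) x) p) ≡ (false , rows (startStore x) p)
  nth-start x p = trans (nthMaybe-raw x p) (cong (false ,_)
    (cong₂ _∷_ (sym (at-ʳ++ (map raw x) [] p)) (sym (rows-empty K′ p))))

  start-rep : ∀ x → Rep (initConf machine x) init (λ p → false , rows (startStore x) p) 0
  start-rep []      = record { state≡ = sym enc-init ; lft≡ = refl ; hd≡ = nth-start [] 0 ; rgt≡ = λ k → nth-start [] (suc k) }
  start-rep (a ∷ x) = record { state≡ = sym enc-init ; lft≡ = refl ; hd≡ = nth-start (a ∷ x) 0 ; rgt≡ = λ k → nth-start (a ∷ x) (suc k) }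

  start : ∀ x → ∃ λ c → Goes (initConf machine x) 1 c × Ready c q₀ (startStore x)
  start x = step-stay {T′ = mk (rows (startStore x))} (start-rep x) refl refl (λ { zero ne → ⊥-elim (ne refl) ; (suc p) ne → refl })

  start-bounded : ∀ x → Bounded (startStore x) (length x)
  start-bounded x zero    = ≤-reflexive (trans (List.length-ʳ++ (map raw x)) (trans (+-identityʳ _) (List.length-map raw x)))
  start-bounded x (suc i) rewrite lookup-replicate {A = List A} i [] = z≤n

  decide-halt : ∀ {S c b} z → after S z ≡ inj₂ b → decide c z ≡ inj₂ b
  decide-halt (inj₂ _) refl = refl

  -- The 2 stands for the step that sets the flag and the halting step; the final `n + t` is the
  -- `collect` sweep that precedes halting.
  runCost : ℕ → ℕ → ℕ
  runCost n t = 2 + (t * stepCost (n + t) + (n + t))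

  machine-halts : ∀ x {q S t b} → (q₀ , startStore x) ⇒⟨ t ⟩ (q , S) → stackStep (q , S) ≡ inj₂ b →
    exec machine (runCost (length x) t) (inj₁ (initConf machine x)) ≡ inj₂ b
  machine-halts x {q} {S} {t} {b} run h with start x
  ... | c₁ , g₁ , r₁ with sim-run run (start-bounded x) r₁
  ... | (c₂ , g₂ , r₂) , B₂
    with collect-sweep {q} S (length x + t) 0 B₂ (subst (λ u → Rep c₂ (collect q u) (mk (rows S)) 0) (lastRow-none S) r₂)
  ... | h₃ , _ , _ , bl , c₃ , g₃ , r₃ =
    Goes-halt (Goes-trans g₁ (Goes-trans g₂ g₃)) (step-inj₂ {c₃} (step-result r₃ δeq))
    where
    δeq : δC (collect q (vmap head S)) (mk (rows S) h₃) ≡ inj₂ b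
    δeq rewrite bl = decide-halt (δ q (vmap head S)) h

-- Read-once structure of minimal branching programs

true≢false : true ≢ false
true≢false ()

-- The order pos and the relation "the computation on x passes through v" of a
-- branching program in which every variable labels exactly one node.
record ReadOnce (n : ℕ) (f : (Fin n → Bool) → Bool) : Set₁ where
  field
    pos     : Fin n → ℕ
    pos-inj : ∀ {u v} → pos u ≡ pos v → u ≡ v
    Pass    : (Fin n → Bool) → Fin n → Set
    ext     : ∀ {x y} → (∀ u → x u ≡ y u) → f x ≡ f y
    sens    : ∀ {x y v} → (∀ u → u ≢ v → x u ≡ y u) → f x ≢ f y → Pass x v
    prefix  : ∀ {x w v} → Pass x v → (∀ u → pos u < pos v → w u ≡ x u) → Pass w v
    paste   : ∀ {x y v} → Pass x v → Pass y v → ∀ w → (∀ u → pos u < pos v → w u ≡ x u) →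
              (∀ u → pos v ≤ pos u → w u ≡ y u) → f w ≡ f y

module Evaluation {n k : ℕ} (B : BP n k) (f : (Fin n → Bool) → Bool) (comp : Computes B f) where
  open BP B

  Input : Set
  Input = Fin n → Bool

  Reaches-det : ∀ {x s b b′} → Reaches B x s b → Reaches B x s b′ → b ≡ b′
  Reaches-det (sink b)     (sink .b)     = refl
  Reaches-det (node i b r) (node .i _ s) = Reaches-det r s

  data Visits (x : Input) : Fin (suc k) → Set where
    source : Visits x zero
    follow : ∀ {i j} → Visits x i → next i (x (var i)) ≡ inj₁ j → Visits x j

  Reaches-next : ∀ {x i b} → Reaches B x (inj₁ i) b → Reaches B x (next i (x (var i))) b
  Reaches-next (node i b r) = r

  Visits-Reaches : ∀ {x i} → Visits x i → Reaches B x (inj₁ i) (f x)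
  Visits-Reaches {x} source       = comp x
  Visits-Reaches {x} (follow v e) = subst (λ s → Reaches B x s (f x)) e (Reaches-next (Visits-Reaches v))

  Visits-prefix : ∀ {x w i} → Visits x i → (∀ l → toℕ l < toℕ i → w (var l) ≡ x (var l)) → Visits w i
  Visits-prefix source agree = source
  Visits-prefix {x} {w} (follow {i} {j} v e) agree =
    follow (Visits-prefix v (λ l lt → agree l (<-trans lt (topo i _ j e))))
           (trans (cong (next i) (agree i (topo i _ j e))) e)

  -- Edges raise node numbers: from a node numbered at least `N`, only variables at such nodes are
  -- ever queried.
  Reaches-suffix : ∀ {x w s b} N → Reaches B x s b → (∀ j → s ≡ inj₁ j → N ≤ toℕ j) →
    (∀ l → N ≤ toℕ l → w (var l) ≡ x (var l)) → Reaches B w s b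
  Reaches-suffix N (sink b) high agree = sink b
  Reaches-suffix {x} {w} N (node i b r) high agree = node i b
    (subst (λ z → Reaches B w (next i z) b) (sym (agree i (high i refl)))
      (Reaches-suffix N r (λ j e → ≤-trans (high i refl) (<⇒≤ (topo i _ j e))) agree))

  f-ext : ∀ {x y} → (∀ u → x u ≡ y u) → f x ≡ f y
  f-ext {x} {y} e = Reaches-det (Reaches-suffix 0 (comp x) (λ _ _ → z≤n) (λ l _ → sym (e (var l)))) (comp y)

  -- Both inputs follow the same path until a node labelled `v` is met; without such a node they
  -- would end in the same sink.
  sensitive-visits : ∀ {x y v} → (∀ u → u ≢ v → x u ≡ y u) → f x ≢ f y → ∃ λ l → var l ≡ v × Visits x l
  sensitive-visits {x} {y} {v} agree ne with go (comp x) (λ { j refl → source })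
    where
    go : ∀ {s b} → Reaches B x s b → (∀ j → s ≡ inj₁ j → Visits x j) →
      (∃ λ l → var l ≡ v × Visits x l) ⊎ Reaches B y s b
    go (sink b) vis = inj₂ (sink b)
    go (node i b r) vis with var i Fin.≟ v
    ... | yes e = inj₁ (i , e , vis i refl)
    ... | no ne′ with go r (λ j e → follow (vis i refl) e)
    ...   | inj₁ found = inj₁ found
    ...   | inj₂ r′ = inj₂ (node i b (subst (λ z → Reaches B y (next i z) b) (agree _ ne′) r′))
  ... | inj₁ found = found
  ... | inj₂ r = ⊥-elim (ne (Reaches-det r (comp y)))

  module _ (small : suc k ≤ n)
           (essential : ∀ v → ∃₂ λ x y → (∀ u → u ≢ v → x u ≡ y u) × f x ≢ f y) where

    nodeOf : Fin n → Fin (suc k)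
    nodeOf v with essential v
    ... | x , y , agree , ne = proj₁ (sensitive-visits agree ne)

    var-nodeOf : ∀ v → var (nodeOf v) ≡ v
    var-nodeOf v with essential v
    ... | x , y , agree , ne = proj₁ (proj₂ (sensitive-visits agree ne))

    nodeOf-injective : ∀ {u v} → nodeOf u ≡ nodeOf v → u ≡ v
    nodeOf-injective {u} {v} e = trans (sym (var-nodeOf u)) (trans (cong var e) (var-nodeOf v))

    -- Pigeonhole: if `i` were missed by the injective `nodeOf`, removing it would embed `n`
    -- variables into `k < n` nodes.
    nodeOf-var : ∀ i → nodeOf (var i) ≡ i
    nodeOf-var i with Fin.any? (λ v → nodeOf v Fin.≟ i)
    ... | yes (v , refl) = cong nodeOf (var-nodeOf v)
    ... | no none = ⊥-elim (<-irrefl refl (≤-trans small (Fin.injective⇒≤ {f = g} g-inj)))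
      where
      g : Fin n → Fin k
      g v = punchOut {i = i} {j = nodeOf v} (λ e → none (v , sym e))
      g-inj : ∀ {u v} → g u ≡ g v → u ≡ v
      g-inj {u} {v} e = nodeOf-injective (Fin.punchOut-injective (λ e → none (u , sym e)) (λ e → none (v , sym e)) e)

    readOnce : ReadOnce n f
    readOnce = record
      { pos     = λ v → toℕ (nodeOf v)
      ; pos-inj = λ e → nodeOf-injective (Fin.toℕ-injective e)
      ; Pass    = λ x v → Visits x (nodeOf v)
      ; ext     = f-ext
      ; sens    = λ {x} {y} {v} agree ne → at-node agree ne
      ; prefix  = λ {x} {w} {v} → vprefix {x} {w} {v}
      ; paste   = λ {x} {y} {v} vx vy w lo hi → Reaches-det (Visits-Reaches (vprefix {x} {w} {v} vx lo))
                    (Reaches-suffix (toℕ (nodeOf v)) (Visits-Reaches vy) (λ { j refl → ≤-refl })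
                      (λ l le → hi (var l) (≤-trans le (≤-reflexive (cong toℕ (sym (nodeOf-var l)))))))
      }
      where
      at-node : ∀ {x y v} → (∀ u → u ≢ v → x u ≡ y u) → f x ≢ f y → Visits x (nodeOf v)
      at-node {x} agree ne with sensitive-visits agree ne
      ... | l , refl , vis = subst (Visits x) (sym (nodeOf-var l)) vis
      vprefix : ∀ {x w v} → Visits x (nodeOf v) → (∀ u → toℕ (nodeOf u) < toℕ (nodeOf v) → w u ≡ x u) → Visits w (nodeOf v)
      vprefix vx lo = Visits-prefix vx (λ l lt → lo (var l) (≤-<-trans (≤-reflexive (cong toℕ (nodeOf-var l))) lt))

-- Inputs as sets: cardinality and extremal elements

count : ∀ {n} → (Fin n → Bool) → ℕ
count {zero}  x = 0
count {suc n} x = (if x zero then 1 else 0) + count (λ i → x (suc i))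

_⊆ᵇ_ : ∀ {n} → (Fin n → Bool) → (Fin n → Bool) → Set
x ⊆ᵇ y = ∀ v → x v ≡ true → y v ≡ true

count-mono : ∀ {n} {x y : Fin n → Bool} → x ⊆ᵇ y → count x ≤ count y
count-mono {zero}  s = z≤n
count-mono {suc n} {x} {y} s = +-mono-≤ first (count-mono (λ v → s (suc v)))
  where
  first : (if x zero then 1 else 0) ≤ (if y zero then 1 else 0)
  first with x zero in e
  ... | false = z≤n
  ... | true rewrite s zero e = ≤-refl

count-strict : ∀ {n} {x y : Fin n → Bool} → x ⊆ᵇ y → ∀ v → y v ≡ true → x v ≡ false → count x < count y
count-strict {suc n} {x} {y} s zero yv xv rewrite yv | xv = s≤s (count-mono (λ v → s (suc v)))
count-strict {suc n} {x} {y} s (suc v) yv xv = +-mono-≤-< first (count-strict (λ v → s (suc v)) v yv xv)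
  where
  first : (if x zero then 1 else 0) ≤ (if y zero then 1 else 0)
  first with x zero in e
  ... | false = z≤n
  ... | true rewrite s zero e = ≤-refl

module _ (_⊑_ : ℕ → ℕ → Set) (tot : ∀ a b → a ⊑ b ⊎ b ⊑ a) (tr : ∀ {a b c} → a ⊑ b → b ⊑ c → a ⊑ c) where
  -- The order is a parameter so that the same proof yields last elements, with `_≤_`, and first
  -- elements, with `_≥_`.
  extremal : ∀ {n} (key : Fin n → ℕ) (p : Fin n → Bool) →
    (∀ v → p v ≡ false) ⊎ (∃ λ i → p i ≡ true × (∀ v → p v ≡ true → key v ⊑ key i))
  extremal {zero}  key p = inj₁ λ ()
  extremal {suc n} key p with p zero in e₀ | extremal (λ i → key (suc i)) (λ i → p (suc i))
  ... | false | inj₁ none = inj₁ λ { zero → e₀ ; (suc v) → none v }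
  ... | false | inj₂ (i , pi , best) = inj₂ (suc i , pi , λ { zero e → ⊥-elim (true≢false (trans (sym e) e₀)) ; (suc v) e → best v e })
  ... | true  | inj₁ none = inj₂ (zero , e₀ , λ { zero e → refl⊑ (key zero) ; (suc v) e → ⊥-elim (true≢false (trans (sym e) (none v))) })
    where
    refl⊑ : ∀ a → a ⊑ a
    refl⊑ a with tot a a
    ... | inj₁ r = r
    ... | inj₂ r = r
  ... | true  | inj₂ (i , pi , best) with tot (key zero) (key (suc i))
  ...   | inj₁ le = inj₂ (suc i , pi , λ { zero e → le ; (suc v) e → best v e })
  ...   | inj₂ ge = inj₂ (zero , e₀ , λ { zero e → refl⊑ (key zero) ; (suc v) e → tr (best v e) ge })
    where
    refl⊑ : ∀ a → a ⊑ a
    refl⊑ a with tot a a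
    ... | inj₁ r = r
    ... | inj₂ r = r

is : ∀ {n} → Fin n → Fin n → Bool
is j u = does (u Fin.≟ j)

is-same : ∀ {n} (j : Fin n) → is j j ≡ true
is-same j = dec-true (j Fin.≟ j) refl

is-other : ∀ {n} {j u : Fin n} → u ≢ j → is j u ≡ false
is-other {j = j} {u} ne = dec-false (u Fin.≟ j) ne

is-true : ∀ {n} {j u : Fin n} → is j u ≡ true → u ≡ j
is-true {j = j} {u} e with u Fin.≟ j
... | yes eq = eq
is-true () | no _

lt : ℕ → ℕ → Bool
lt a b = does (a <? b)

lt-true : ∀ {a b} → a < b → lt a b ≡ true
lt-true {a} {b} l = dec-true (a <? b) l

lt-false : ∀ {a b} → b ≤ a → lt a b ≡ false
lt-false {a} {b} l = dec-false (a <? b) (≤⇒≯ l)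

-- Extracting a matching from a read-once function

-- Here an X-variable is any variable with `isY v ≡ false`, dummies included. The hypotheses `noX`,
-- `noY`, `dummy` and `allY` abstract the rows whose value is the same for every matching, so that
-- the argument sees nothing of the formula.
module Matching {n : ℕ} {f : (Fin n → Bool) → Bool} (ro : ReadOnce n f)
  (isY : Fin n → Bool) (d : Fin n → Fin n) (d-x : ∀ j → isY j ≡ true → isY (d j) ≡ false)
  (noX : ∀ x → (∀ v → isY v ≡ false → x v ≡ false) → f x ≡ false)
  (noY : ∀ x → (∀ v → isY v ≡ true → x v ≡ false) → f x ≡ false)
  (dummy : ∀ x j → isY j ≡ true → x (d j) ≡ true → (∀ v → isY v ≡ false → v ≢ d j → x v ≡ false) → f x ≡ x j)
  (allY : ∀ x i → isY i ≡ false → x i ≡ true → (∀ v → isY v ≡ false → v ≢ i → x v ≡ false) →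
          (∀ v → isY v ≡ true → x v ≡ true) → f x ≡ true)
  where
  open ReadOnce ro

  Input : Set
  Input = Fin n → Bool

  clash : ∀ {A : Set} {b : Bool} → b ≡ true → b ≡ false → A
  clash e e′ = ⊥-elim (true≢false (trans (sym e) e′))

  Y≢X : ∀ {u v} → isY u ≡ true → isY v ≡ false → u ≢ v
  Y≢X yu xv refl = clash yu xv

  splice : Fin n → Input → Input → Input
  splice v x y u = if lt (pos u) (pos v) then x u else y u

  splice-< : ∀ {v u} x y → pos u < pos v → splice v x y u ≡ x u
  splice-< x y l rewrite lt-true l = refl

  splice-≥ : ∀ {v u} x y → pos v ≤ pos u → splice v x y u ≡ y u
  splice-≥ x y l rewrite lt-false l = refl

  splice-val : ∀ {v x y} → Pass x v → Pass y v → f (splice v x y) ≡ f y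
  splice-val {v} {x} {y} px py = paste px py (splice v x y) (λ u → splice-< x y) (λ u → splice-≥ x y)

  single : Fin n → Input → Input
  single i g u = if isY u then g u else is i u

  single-Y : ∀ i g {u} → isY u ≡ true → single i g u ≡ g u
  single-Y i g e rewrite e = refl

  single-i : ∀ i g → isY i ≡ false → single i g i ≡ true
  single-i i g e rewrite e = is-same i

  single-X : ∀ i g {u} → isY u ≡ false → u ≢ i → single i g u ≡ false
  single-X i g e ne rewrite e = is-other ne

  single-ext : ∀ {i g} x → x i ≡ true → (∀ v → isY v ≡ false → v ≢ i → x v ≡ false) →
    (∀ v → isY v ≡ true → x v ≡ g v) → f x ≡ f (single i g)
  single-ext {i} {g} x xi xX xY = ext same
    where
    same : ∀ u → x u ≡ single i g u
    same u with isY u in e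
    ... | true = xY u e
    ... | false with u Fin.≟ i
    ...   | yes refl = xi
    ...   | no ne = xX u e ne

  off : Input → Fin n → Input
  off x v u = if is v u then false else x u

  off-same : ∀ x v → off x v v ≡ false
  off-same x v rewrite is-same v = refl

  off-other : ∀ x {v u} → u ≢ v → off x v u ≡ x u
  off-other x ne rewrite is-other ne = refl

  differ : ∀ {x y v} → (∀ u → u ≢ v → x u ≡ y u) → f x ≡ true → f y ≡ false → Pass x v
  differ agree t e = sens agree (λ q → clash (trans (sym q) t) e)

  differ′ : ∀ {x y v} → (∀ u → u ≢ v → x u ≡ y u) → f x ≡ false → f y ≡ true → Pass x v
  differ′ agree t e = sens agree (λ q → clash (trans q e) t)

  -- Switching `i` off leaves no X and hence rejects, so an accepted input with `i` as its only X is
  -- sensitive to `i`.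
  pass-single : ∀ i g → isY i ≡ false → f (single i g) ≡ true → Pass (single i g) i
  pass-single i g xi t = differ {y = off (single i g) i} (λ u ne → sym (off-other (single i g) ne)) t
    (noX _ low)
    where
    low : ∀ v → isY v ≡ false → off (single i g) i v ≡ false
    low v e with v Fin.≟ i
    ... | yes refl = refl
    ... | no ne rewrite e = refl

  all₁ : Input
  all₁ _ = true

  single-all : ∀ i → isY i ≡ false → f (single i all₁) ≡ true
  single-all i xi = allY _ i xi (single-i i all₁ xi) (λ v → single-X i all₁) (λ v → single-Y i all₁)

  pass-all : ∀ i → isY i ≡ false → Pass (single i all₁) i
  pass-all i xi = pass-single i all₁ xi (single-all i xi)

  single-dummy : ∀ j g → isY j ≡ true → f (single (d j) g) ≡ g j
  single-dummy j g yj = trans (dummy _ j yj (single-i (d j) g (d-x j yj)) (λ v → single-X (d j) g)) (single-Y (d j) g yj)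

  -- The value of this input is its bit `j`, so flipping that bit matters. Such inputs are the
  -- probes of the splicing arguments: they pass through `j` for every choice of `g`.
  pass-dummy : ∀ j g → isY j ≡ true → Pass (single (d j) g) j
  pass-dummy j g yj = sens {y = single (d j) g′} agree ne
    where
    g′ : Input
    g′ u = if is j u then not (g j) else g u
    g′j : g′ j ≡ not (g j)
    g′j rewrite is-same j = refl
    agree : ∀ u → u ≢ j → single (d j) g u ≡ single (d j) g′ u
    agree u ne rewrite is-other ne = refl
    ne : f (single (d j) g) ≢ f (single (d j) g′)
    ne e = not-¬ {g j} refl (trans (sym (single-dummy j g yj)) (trans e (trans (single-dummy j g′ yj) g′j)))

  none : Input
  none _ = false

  below : Fin n → Input
  below i u = lt (pos u) (pos i)

  above : Fin n → Input
  above i u = lt (pos i) (pos u)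

  below+ : Fin n → Fin n → Input
  below+ i j u = below i u ∨ is j u

  above+ : Fin n → Fin n → Input
  above+ i j u = above i u ∨ is j u

  ∨-is-other : ∀ b {j u : Fin n} → u ≢ j → b ∨ is j u ≡ b
  ∨-is-other b ne rewrite is-other ne = ∨-identityʳ b

  -- On the side of `i` away from `j` the input agrees with `single i all₁`, which is known to be
  -- accepted and to pass through `i`; on the side of `j` the Y-variable `j` is the only one that
  -- may be on. Splicing at `i` can therefore produce these inputs.
  Right Left : Fin n → Fin n → Set
  Right i j = isY j ≡ true × pos i < pos j × f (single i (below+ i j)) ≡ true × f (single i (below i)) ≡ false
  Left  i j = isY j ≡ true × pos j < pos i × f (single i (above+ i j)) ≡ true × f (single i (above i)) ≡ false

  single-cong : ∀ i g h u → (isY u ≡ true → g u ≡ h u) → single i g u ≡ single i h u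
  single-cong i g h u e with isY u
  ... | true  = e refl
  ... | false = refl

  pass-below+ : ∀ {i j} → Right i j → Pass (single i (below+ i j)) j
  pass-below+ {i} {j} (_ , _ , t , e) =
    differ (λ u ne → single-cong i (below+ i j) (below i) u (λ _ → ∨-is-other (below i u) ne)) t e

  -- The cut is at `j₁`. If its dummy lies before it, the start of the first witness followed by the
  -- end of a probe is the second witness, but has the value 0 of the probe. Otherwise the start of
  -- a probe followed by the end of the first witness contains no X, but has value 1.
  Right-unique< : ∀ {i j₁ j₂} → isY i ≡ false → Right i j₁ → Right i j₂ → pos j₁ < pos j₂ → ⊥
  Right-unique< {i} {j₁} {j₂} xi R₁@(y₁ , i<j₁ , t₁ , e₁) (y₂ , i<j₂ , t₂ , e₂) j₁<j₂ with pos (d j₁) <? pos j₁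
  ... | yes dl = clash (trans wval′ t₂) (trans wval (trans (single-dummy j₁ (is j₂) y₁) (is-other j₁≢j₂)))
    where
    j₁≢j₂ : j₁ ≢ j₂
    j₁≢j₂ refl = <-irrefl refl j₁<j₂
    a y : Input
    a = single i (below+ i j₁)
    y = single (d j₁) (is j₂)
    wval : f (splice j₁ a y) ≡ f y
    wval = splice-val (pass-below+ R₁) (pass-dummy j₁ (is j₂) y₁)
    wX : ∀ v → isY v ≡ false → v ≢ i → splice j₁ a y v ≡ false
    wX v xv ne with pos v <? pos j₁
    ... | yes l = trans (splice-< a y l) (single-X i (below+ i j₁) xv ne)
    ... | no  l = trans (splice-≥ a y (≮⇒≥ l)) (single-X (d j₁) (is j₂) xv (λ { refl → l dl }))
    wY : ∀ v → isY v ≡ true → splice j₁ a y v ≡ below+ i j₂ v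
    wY v yv with pos v <? pos j₁
    ... | yes l = trans (splice-< a y l) (trans (single-Y i (below+ i j₁) yv)
          (trans (∨-is-other (below i v) {j₁} {v} (λ { refl → <-irrefl refl l }))
                 (sym (∨-is-other (below i v) {j₂} {v} (λ { refl → <-asym l j₁<j₂ })))))
    ... | no  l = trans (splice-≥ a y (≮⇒≥ l)) (trans (single-Y (d j₁) (is j₂) yv)
          (cong (_∨ is j₂ v) (sym (lt-false (≤-trans (<⇒≤ i<j₁) (≮⇒≥ l))))))
    wval′ : f (splice j₁ a y) ≡ f (single i (below+ i j₂))
    wval′ = single-ext _ (trans (splice-< a y i<j₁) (single-i i (below+ i j₁) xi)) wX wY
  ... | no dl = clash (trans wval t₁) (noX _ wX)
    where
    a y : Input
    a = single i (below+ i j₁)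
    y = single (d j₁) none
    wval : f (splice j₁ y a) ≡ f a
    wval = splice-val (pass-dummy j₁ none y₁) (pass-below+ R₁)
    wX : ∀ v → isY v ≡ false → splice j₁ y a v ≡ false
    wX v xv with pos v <? pos j₁
    ... | yes l = trans (splice-< y a l) (single-X (d j₁) _ xv (λ { refl → dl l }))
    ... | no  l = trans (splice-≥ y a (≮⇒≥ l)) (single-X i (below+ i j₁) xv (λ { refl → l i<j₁ }))

  pass-above : ∀ {i j} → Left i j → Pass (single i (above+ i j)) j × Pass (single i (above i)) j
  pass-above {i} {j} (_ , _ , t , e) = differ agree t e , differ′ (λ u ne → sym (agree u ne)) e t
    where
    agree : ∀ u → u ≢ j → single i (above+ i j) u ≡ single i (above i) u
    agree u ne = single-cong i (above+ i j) (above i) u (λ _ → ∨-is-other (above i u) ne)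

  -- Mirror image, with the cut at `j₂`. If its dummy lies before it, witness and then probe give an
  -- accepted input without X. Otherwise a probe with `j₁` on, followed by the end of the rejected
  -- `single i (above i)`, is the accepted witness for `j₁`.
  Left-unique< : ∀ {i j₁ j₂} → isY i ≡ false → Left i j₁ → Left i j₂ → pos j₁ < pos j₂ → ⊥
  Left-unique< {i} {j₁} {j₂} xi (y₁ , j₁<i , t₁ , e₁) L₂@(y₂ , j₂<i , t₂ , e₂) j₁<j₂ with pos (d j₂) <? pos j₂
  ... | yes dl = clash (trans wval (trans (single-dummy j₂ (is j₂) y₂) (is-same j₂))) (noX _ wX)
    where
    a y : Input
    a = single i (above+ i j₂)
    y = single (d j₂) (is j₂)
    wval : f (splice j₂ a y) ≡ f y
    wval = splice-val (proj₁ (pass-above L₂)) (pass-dummy j₂ (is j₂) y₂)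
    wX : ∀ v → isY v ≡ false → splice j₂ a y v ≡ false
    wX v xv with pos v <? pos j₂
    ... | yes l = trans (splice-< a y l) (single-X i (above+ i j₂) xv (λ { refl → <-asym l j₂<i }))
    ... | no  l = trans (splice-≥ a y (≮⇒≥ l)) (single-X (d j₂) (is j₂) xv (λ { refl → l dl }))
  ... | no dl = clash t₁ (trans (sym wval′) (trans wval e₂))
    where
    a y : Input
    a = single i (above i)
    y = single (d j₂) (is j₁)
    wval : f (splice j₂ y a) ≡ f a
    wval = splice-val (pass-dummy j₂ (is j₁) y₂) (proj₂ (pass-above L₂))
    wX : ∀ v → isY v ≡ false → v ≢ i → splice j₂ y a v ≡ false
    wX v xv ne with pos v <? pos j₂
    ... | yes l = trans (splice-< y a l) (single-X (d j₂) (is j₁) xv (λ { refl → dl l }))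
    ... | no  l = trans (splice-≥ y a (≮⇒≥ l)) (single-X i (above i) xv ne)
    wY : ∀ v → isY v ≡ true → splice j₂ y a v ≡ above+ i j₁ v
    wY v yv with pos v <? pos j₂
    ... | yes l = trans (splice-< y a l) (trans (single-Y (d j₂) (is j₁) yv)
          (cong (_∨ is j₁ v) (sym (lt-false (<⇒≤ (<-trans l j₂<i))))))
    ... | no  l = trans (splice-≥ y a (≮⇒≥ l)) (trans (single-Y i (above i) yv)
          (sym (∨-is-other (above i v) {j₁} {v} (λ { refl → l j₁<j₂ }))))
    wval′ : f (splice j₂ y a) ≡ f (single i (above+ i j₁))
    wval′ = single-ext _ (trans (splice-≥ y a (<⇒≤ j₂<i)) (single-i i (above i) xi)) wX wY

  Right? : ∀ i j → Dec (Right i j)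
  Right? i j = (isY j ≟ᵇ true) ×-dec (pos i <? pos j) ×-dec (f (single i (below+ i j)) ≟ᵇ true) ×-dec (f (single i (below i)) ≟ᵇ false)

  Left? : ∀ i j → Dec (Left i j)
  Left? i j = (isY j ≟ᵇ true) ×-dec (pos j <? pos i) ×-dec (f (single i (above+ i j)) ≟ᵇ true) ×-dec (f (single i (above i)) ≟ᵇ false)

  -- Right neighbours take precedence: a variable may have one neighbour of each kind.
  ρ : Fin n → Fin n
  ρ i with Fin.any? (Right? i)
  ... | yes (j , _) = j
  ... | no _ with Fin.any? (Left? i)
  ...   | yes (j , _) = j
  ...   | no _ = i

  ρ-Right : ∀ {i j} → isY i ≡ false → Right i j → ρ i ≡ j
  ρ-Right {i} {j} xi R with Fin.any? (Right? i)
  ... | no none′ = ⊥-elim (none′ (j , R))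
  ... | yes (j′ , R′) with <-cmp (pos j′) (pos j)
  ...   | tri< l _ _ = ⊥-elim (Right-unique< xi R′ R l)
  ...   | tri≈ _ e _ = pos-inj e
  ...   | tri> _ _ l = ⊥-elim (Right-unique< xi R R′ l)

  ρ-Left : ∀ {i j} → isY i ≡ false → (∀ j′ → ¬ Right i j′) → Left i j → ρ i ≡ j
  ρ-Left {i} {j} xi noR L with Fin.any? (Right? i)
  ... | yes (j′ , R′) = ⊥-elim (noR j′ R′)
  ... | no _ with Fin.any? (Left? i)
  ...   | no none′ = ⊥-elim (none′ (j , L))
  ...   | yes (j′ , L′) with <-cmp (pos j′) (pos j)
  ...     | tri< l _ _ = ⊥-elim (Left-unique< xi L′ L l)
  ...     | tri≈ _ e _ = pos-inj e
  ...     | tri> _ _ l = ⊥-elim (Left-unique< xi L L′ l)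

  Matched : Input → Set
  Matched u = ∃ λ i → isY i ≡ false × u i ≡ true × isY (ρ i) ≡ true × u (ρ i) ≡ true

  Matched? : ∀ u → Dec (Matched u)
  Matched? u = Fin.any? (λ i → (isY i ≟ᵇ false) ×-dec (u i ≟ᵇ true) ×-dec (isY (ρ i) ≟ᵇ true) ×-dec (u (ρ i) ≟ᵇ true))

  module Minimal (u : Input) (fu : f u ≡ true)
    (minimal : ∀ w v → u v ≡ true → w v ≡ false → w ⊆ᵇ u → f w ≡ false)
    (unmatched : ¬ Matched u) where

    pass-u : ∀ v → u v ≡ true → Pass u v
    pass-u v uv = differ {y = off u v} (λ t ne → sym (off-other u ne)) fu (minimal (off u v) v uv (off-same u v) sub)
      where
      sub : off u v ⊆ᵇ u
      sub t e with t Fin.≟ v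
      sub t () | yes _
      ... | no ne = e

    minimal-off : ∀ v → u v ≡ true → f (off u v) ≡ false
    minimal-off v uv = minimal (off u v) v uv (off-same u v) sub
      where
      sub : off u v ⊆ᵇ u
      sub t e with t Fin.≟ v
      sub t () | yes _
      ... | no ne = e

    -- With its dummy before `j`, the probe has nothing but `j` from `j` on. Its end, glued to the
    -- start of `u`, is accepted and contained in `u`; minimality then leaves nothing of `u` after
    -- `j`.
    right-top : ∀ {j v} → isY j ≡ true → u j ≡ true → pos (d j) < pos j → u v ≡ true → pos v ≤ pos j
    right-top {j} {v} yj uj dl uv with pos j <? pos v
    ... | no l = ≮⇒≥ l
    ... | yes l = clash (trans (splice-val (pass-u j uj) (pass-dummy j (is j) yj)) (trans (single-dummy j (is j) yj) (is-same j)))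
                        (minimal (splice j u y) v uv wv sub)
      where
      y : Input
      y = single (d j) (is j)
      ydv : ∀ t → pos j ≤ pos t → y t ≡ true → t ≡ j
      ydv t le e with isY t in yt
      ... | true = is-true {j = j} {t} e
      ... | false with is-true {j = d j} {t} e
      ...   | refl = ⊥-elim (<-irrefl refl (≤-trans dl le))
      wv : splice j u y v ≡ false
      wv = trans (splice-≥ u y (<⇒≤ l)) (¬-not (λ e → <-irrefl (cong pos (sym (ydv v (<⇒≤ l) e))) l))
      sub : splice j u y ⊆ᵇ u
      sub t e with pos t <? pos j
      ... | yes l′ = trans (sym (splice-< u y l′)) e
      ... | no  l′ with ydv t (≮⇒≥ l′) (trans (sym (splice-≥ u y (≮⇒≥ l′))) e)
      ...   | refl = uj

    -- With its dummy not before `j`, the probe is empty before `j`. Its start, glued to the end of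
    -- `u`, is accepted and contained in `u`, so `u` too is empty before `j`.
    left-bottom : ∀ {j v} → isY j ≡ true → u j ≡ true → pos j ≤ pos (d j) → u v ≡ true → pos j ≤ pos v
    left-bottom {j} {v} yj uj dl uv with pos v <? pos j
    ... | no l = ≮⇒≥ l
    ... | yes l = clash (trans (splice-val (pass-dummy j none yj) (pass-u j uj)) fu)
                        (minimal (splice j y u) v uv (trans (splice-< y u l) (yfalse v l)) sub)
      where
      y : Input
      y = single (d j) none
      yfalse : ∀ t → pos t < pos j → y t ≡ false
      yfalse t l with isY t in yt
      ... | true = refl
      ... | false = is-other {j = d j} {t} (λ { refl → <-irrefl refl (<-≤-trans l dl) })
      sub : splice j y u ⊆ᵇ u
      sub t e with pos t <? pos j
      ... | yes l′ = clash (trans (sym (splice-< y u l′)) e) (yfalse t l′)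
      ... | no  l′ = trans (sym (splice-≥ y u (≮⇒≥ l′))) e

    isX∧u : Input
    isX∧u v = not (isY v) ∧ u v

    isX∧u-true : ∀ v → isX∧u v ≡ true → isY v ≡ false × u v ≡ true
    isX∧u-true v e with isY v
    ... | false = refl , e
    isX∧u-true v () | true

    isX∧u-intro : ∀ v → isY v ≡ false → u v ≡ true → isX∧u v ≡ true
    isX∧u-intro v xv uv rewrite xv | uv = refl

    someX : ¬ (∀ v → isX∧u v ≡ false)
    someX all = clash fu (noX u (λ v xv → ¬-not (λ uv → clash (isX∧u-intro v xv uv) (all v))))

    -- Let `i` be the last X of `u`. Apart from `i` itself only `j` remains of `u` from `i` on, so
    -- putting the start of `single i all₁` in front of `u` and of `off u j` gives the two inputs in
    -- the definition of `Right i j`.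
    right-case : ∀ {j} → isY j ≡ true → u j ≡ true → pos (d j) < pos j → ⊥
    right-case {j} yj uj dl with extremal _≤_ ≤-total ≤-trans pos isX∧u
    ... | inj₁ all = someX all
    ... | inj₂ (i , ie , top) = unmatched (i , xi , ui , trans (cong isY ρi) yj , trans (cong u ρi) uj)
      where
      xi : isY i ≡ false
      xi = proj₁ (isX∧u-true i ie)
      ui : u i ≡ true
      ui = proj₂ (isX∧u-true i ie)
      i<j : pos i < pos j
      i<j = ≤∧≢⇒< (right-top yj uj dl ui) (λ e → Y≢X yj xi (sym (pos-inj e)))
      o : Input
      o = single i all₁
      upX : ∀ v → isY v ≡ false → v ≢ i → pos i ≤ pos v → u v ≡ false
      upX v xv ne le = ¬-not (λ uv → ne (pos-inj (≤-antisym (top v (isX∧u-intro v xv uv)) le)))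
      upY : ∀ v → isY v ≡ true → v ≢ j → pos i ≤ pos v → u v ≡ false
      upY v yv ne le = ¬-not λ uv → case v yv ne le uv
        where
        case : ∀ v → isY v ≡ true → v ≢ j → pos i ≤ pos v → u v ≡ true → ⊥
        case v yv ne le uv with pos (d v) <? pos v
        ... | yes l = ne (pos-inj (≤-antisym (right-top yj uj dl uv) (right-top yv uv l uj)))
        ... | no l = Y≢X yv xi (pos-inj (≤-antisym (left-bottom yv uv (≮⇒≥ l) ui) le))
      val : ∀ z g → Pass z i → (∀ v → isY v ≡ false → z v ≡ u v) →
        (∀ v → isY v ≡ true → pos i ≤ pos v → z v ≡ g v) →
        (∀ v → pos v < pos i → g v ≡ true) → f (single i g) ≡ f z
      val z g pz zX zY gl = trans (sym (single-ext (splice i o z) (trans (splice-≥ o z ≤-refl) (trans (zX i xi) ui)) wX wY))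
                           (splice-val (pass-all i xi) pz)
        where
        wX : ∀ v → isY v ≡ false → v ≢ i → splice i o z v ≡ false
        wX v xv ne with pos v <? pos i
        ... | yes l = trans (splice-< o z l) (single-X i _ xv ne)
        ... | no  l = trans (splice-≥ o z (≮⇒≥ l)) (trans (zX v xv) (upX v xv ne (≮⇒≥ l)))
        wY : ∀ v → isY v ≡ true → splice i o z v ≡ g v
        wY v yv with pos v <? pos i
        ... | yes l = trans (splice-< o z l) (trans (single-Y i _ yv) (sym (gl v l)))
        ... | no  l = trans (splice-≥ o z (≮⇒≥ l)) (zY v yv (≮⇒≥ l))
      zY₁ : ∀ v → isY v ≡ true → pos i ≤ pos v → u v ≡ below+ i j v
      zY₁ v yv le with v Fin.≟ j
      ... | yes refl = trans uj (sym (∨-zeroʳ (below i v)))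
      ... | no ne = trans (upY v yv ne le) (sym (trans (∨-identityʳ _) (lt-false le)))
      zY₂ : ∀ v → isY v ≡ true → pos i ≤ pos v → off u j v ≡ below i v
      zY₂ v yv le with v Fin.≟ j
      ... | yes refl = sym (lt-false le)
      ... | no ne = trans (upY v yv ne le) (sym (lt-false le))
      R : Right i j
      R = yj , i<j ,
          trans (val u (below+ i j) (pass-u i ui) (λ _ _ → refl) zY₁ (λ v l → cong (_∨ is j v) (lt-true l))) fu ,
          trans (val (off u j) (below i)
                   (prefix (pass-u i ui) (λ t l → off-other u (λ { refl → <-asym l i<j })))
                   (λ v xv → off-other u (λ e → Y≢X yj xv (sym e))) zY₂ (λ v l → lt-true l)) (minimal-off j uj)
      ρi : ρ i ≡ j
      ρi = ρ-Right xi R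

    -- With `right-case` excluded, every Y-variable of `u` is the first element of `u`; hence there
    -- is only one, `j`, and `i` is the first X after it.
    module LeftCase (j : Fin n) (yj : isY j ≡ true) (uj : u j ≡ true)
      (onlyj : ∀ t → isY t ≡ true → u t ≡ true → t ≡ j)
      (i : Fin n) (xi : isY i ≡ false) (ui : u i ≡ true)
      (bottom : ∀ v → isY v ≡ false → u v ≡ true → pos i ≤ pos v)
      (j<i : pos j < pos i) where

      o : Input
      o = single i all₁

      L : Left i j
      L = yj , j<i , t , e
        where
        wX : ∀ v → isY v ≡ false → v ≢ i → splice i u o v ≡ false
        wX v xv ne with pos v <? pos i
        ... | yes l = trans (splice-< u o l) (¬-not (λ uv → <⇒≱ l (bottom v xv uv)))
        ... | no  l = trans (splice-≥ u o (≮⇒≥ l)) (single-X i _ xv ne)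
        wY : ∀ v → isY v ≡ true → splice i u o v ≡ above+ i j v
        wY v yv with pos v <? pos i
        ... | no l = trans (splice-≥ u o (≮⇒≥ l)) (trans (single-Y i _ yv)
              (sym (cong (_∨ is j v) (lt-true (≤∧≢⇒< (≮⇒≥ l) (λ e → Y≢X yv xi (sym (pos-inj e))))))))
        ... | yes l with v Fin.≟ j
        ...   | yes refl = trans (splice-< u o l) (trans uj (sym (∨-zeroʳ _)))
        ...   | no ne = trans (splice-< u o l) (trans (¬-not (λ uv → ne (onlyj v yv uv)))
                  (sym (trans (∨-identityʳ _) (lt-false (<⇒≤ l)))))
        t : f (single i (above+ i j)) ≡ true
        t = trans (sym (single-ext (splice i u o) (trans (splice-≥ u o ≤-refl) (single-i i _ xi)) wX wY))
            (trans (splice-val (pass-u i ui) (pass-all i xi)) (single-all i xi))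
        a : Input
        a = single i (above i)
        afalse : ∀ v → pos v < pos i → a v ≡ false
        afalse v l with isY v in yv
        ... | true = lt-false (<⇒≤ l)
        ... | false = is-other {j = i} {v} (λ { refl → <-irrefl refl l })
        sub : splice i a u ⊆ᵇ u
        sub v e with pos v <? pos i
        ... | yes l = clash (trans (sym (splice-< a u l)) e) (afalse v l)
        ... | no  l = trans (sym (splice-≥ a u (≮⇒≥ l))) e
        e : f (single i (above i)) ≡ false
        e = ¬-not (λ t′ → clash (trans (splice-val (pass-single i (above i) xi t′) (pass-u i ui)) fu)
              (minimal (splice i a u) j uj (trans (splice-< a u j<i) (afalse j j<i)) sub))

      -- A right neighbour `j′` would override the left one. If `i` is the only X of `u`, then `u`
      -- is the rejected `b₀`. Otherwise let `i₂` be the next X. The input `b`, consisting of `j`,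
      -- `i` and `j′`, is accepted and passes through `j′`. If `i₂` precedes `j′`, then `b` passes
      -- through `i₂` and a splice there without X is accepted; if not, `u` passes through `j′` and
      -- a splice there without Y is accepted.
      noRight : ∀ j′ → ¬ Right i j′
      noRight j′ (yj′ , i<j′ , t , e) with extremal _≥_ (λ a b → ≤-total b a) (λ p q → ≤-trans q p) pos (λ v → isX∧u v ∧ not (is i v))
      ... | inj₁ all = clash fu (trans (ext same) b₀val)
        where
        a₀ b₀ : Input
        a₀ = single i (below i)
        b₀ = splice i u a₀
        pa : Pass (single i (below+ i j′)) i
        pa = pass-single i _ xi t
        pa₀ : Pass a₀ i
        pa₀ = prefix pa (λ v l → single-cong i (below i) (below+ i j′) v
                (λ _ → sym (∨-is-other (below i v) {j′} {v} (λ { refl → <-asym l i<j′ }))))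
        b₀val : f b₀ ≡ false
        b₀val = trans (splice-val (pass-u i ui) pa₀) e
        bool : ∀ {p q} → p ≡ true → q ≡ false → p ∧ not q ≡ true
        bool refl refl = refl
        high : ∀ v → pos i ≤ pos v → u v ≡ a₀ v
        high v le with isY v in yv
        ... | true = trans (¬-not (λ uv → <⇒≱ (subst (λ z → pos z < pos i) (sym (onlyj v yv uv)) j<i) le)) (sym (lt-false le))
        ... | false with v Fin.≟ i
        ...   | yes refl = ui
        ...   | no ne = ¬-not (λ uv → clash (bool (isX∧u-intro v yv uv) (is-other ne)) (all v))
        same : ∀ v → u v ≡ b₀ v
        same v with pos v <? pos i
        ... | yes l = sym (splice-< u a₀ l)
        ... | no  l = trans (high v (≮⇒≥ l)) (sym (splice-≥ u a₀ (≮⇒≥ l)))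
      ... | inj₂ (i₂ , ie , bot) = contra
        where
        split : ∀ p q → p ∧ not q ≡ true → p ≡ true × q ≡ false
        split true false e = refl , refl
        xu : isX∧u i₂ ≡ true
        xu = proj₁ (split _ _ ie)
        x₂ : isY i₂ ≡ false
        x₂ = proj₁ (isX∧u-true i₂ xu)
        u₂ : u i₂ ≡ true
        u₂ = proj₂ (isX∧u-true i₂ xu)
        i₂≢i : i₂ ≢ i
        i₂≢i e = clash (trans (cong (is i) e) (is-same i)) (proj₂ (split _ _ ie))
        i<i₂ : pos i < pos i₂
        i<i₂ = ≤∧≢⇒< (bottom i₂ x₂ u₂) (λ e → i₂≢i (sym (pos-inj e)))
        bool : ∀ {p q} → p ≡ true → q ≡ false → p ∧ not q ≡ true
        bool refl refl = refl
        a a₀ b b₀ : Input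
        a  = single i (below+ i j′)
        a₀ = single i (below i)
        b  = splice i u a
        b₀ = splice i u a₀
        pa : Pass a i
        pa = pass-single i _ xi t
        pa₀ : Pass a₀ i
        pa₀ = prefix pa (λ v l → single-cong i (below i) (below+ i j′) v
                (λ _ → sym (∨-is-other (below i v) {j′} {v} (λ { refl → <-asym l i<j′ }))))
        bval : f b ≡ true
        bval = trans (splice-val (pass-u i ui) pa) t
        b₀val : f b₀ ≡ false
        b₀val = trans (splice-val (pass-u i ui) pa₀) e
        pb : Pass b j′
        pb = differ {y = b₀} agree bval b₀val
          where
          agree : ∀ v → v ≢ j′ → b v ≡ b₀ v
          agree v ne with pos v <? pos i
          ... | yes l = trans (splice-< u a l) (sym (splice-< u a₀ l))
          ... | no  l = trans (splice-≥ u a (≮⇒≥ l)) (trans (single-cong i (below+ i j′) (below i) v (λ _ → ∨-is-other _ ne))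
                          (sym (splice-≥ u a₀ (≮⇒≥ l))))
        a≡u : ∀ v → pos v < pos i₂ → v ≢ j′ → pos i ≤ pos v → a v ≡ u v
        a≡u v l₂ ne le with isY v in yv
        ... | true = trans (trans (∨-is-other _ ne) (lt-false le))
                       (sym (¬-not (λ uv → <⇒≱ (subst (λ z → pos z < pos i) (sym (onlyj v yv uv)) j<i) le)))
        ... | false with v Fin.≟ i
        ...   | yes refl = sym ui
        ...   | no ne′ = sym (¬-not (λ uv → <⇒≱ l₂ (bot v (bool (isX∧u-intro v yv uv) (is-other ne′)))))
        b≡u : ∀ v → pos v < pos i₂ → v ≢ j′ → b v ≡ u v
        b≡u v l₂ ne with pos v <? pos i
        ... | yes l = splice-< u a l
        ... | no  l = trans (splice-≥ u a (≮⇒≥ l)) (a≡u v l₂ ne (≮⇒≥ l))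
        contra : ⊥
        contra with pos i₂ <? pos j′
        ... | yes l = clash (trans (splice-val (pass-all i₂ x₂) pb₂) bval) (noX _ wX)
          where
          pb₂ : Pass b i₂
          pb₂ = prefix (pass-u i₂ u₂) (λ v l′ → b≡u v l′ (λ { refl → <-asym l l′ }))
          o₂ : Input
          o₂ = single i₂ all₁
          wX : ∀ v → isY v ≡ false → splice i₂ o₂ b v ≡ false
          wX v xv with pos v <? pos i₂
          ... | yes l′ = trans (splice-< o₂ b l′) (single-X i₂ _ xv (λ { refl → <-irrefl refl l′ }))
          ... | no  l′ = trans (splice-≥ o₂ b (≮⇒≥ l′)) (trans (splice-≥ u a (≤-trans (<⇒≤ i<i₂) (≮⇒≥ l′)))
                           (single-X i (below+ i j′) xv (λ { refl → l′ i<i₂ })))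
        ... | no l = clash (trans (splice-val (pass-dummy j′ none yj′) pu) fu) (noY _ wY)
          where
          pu : Pass u j′
          pu = prefix pb (λ v l′ → sym (b≡u v (<-≤-trans l′ (≮⇒≥ l)) (λ { refl → <-irrefl refl l′ })))
          z : Input
          z = single (d j′) none
          wY : ∀ v → isY v ≡ true → splice j′ z u v ≡ false
          wY v yv with pos v <? pos j′
          ... | yes l′ = trans (splice-< z u l′) (single-Y _ _ yv)
          ... | no  l′ = trans (splice-≥ z u (≮⇒≥ l′))
                  (¬-not (λ uv → l′ (subst (λ t → pos t < pos j′) (sym (onlyj v yv uv)) (<-trans j<i i<j′))))

      contradiction′ : ⊥
      contradiction′ = unmatched (i , xi , ui , trans (cong isY ρi) yj , trans (cong u ρi) uj)
        where
        ρi : ρ i ≡ j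
        ρi = ρ-Left xi noRight L

    absurd : ⊥
    absurd with Fin.any? (λ j → (isY j ≟ᵇ true) ×-dec (u j ≟ᵇ true))
    ... | no none′ = clash fu (noY u (λ v yv → ¬-not (λ uv → none′ (v , yv , uv))))
    ... | yes (j , yj , uj) with extremal _≥_ (λ a b → ≤-total b a) (λ p q → ≤-trans q p) pos isX∧u
    ...   | inj₁ all = someX all
    ...   | inj₂ (i , ie , bot) = LeftCase.contradiction′ j yj uj onlyj i xi ui
              (λ v xv uv → bot v (isX∧u-intro v xv uv))
              (≤∧≢⇒< (lb yj uj ui) (λ e → Y≢X yj xi (pos-inj e)))
      where
      xi : isY i ≡ false
      xi = proj₁ (isX∧u-true i ie)
      ui : u i ≡ true
      ui = proj₂ (isX∧u-true i ie)
      lb : ∀ {j v} → isY j ≡ true → u j ≡ true → u v ≡ true → pos j ≤ pos v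
      lb {j} yj uj uv with pos (d j) <? pos j
      ... | yes l = ⊥-elim (right-case yj uj l)
      ... | no  l = left-bottom yj uj (≮⇒≥ l) uv
      onlyj : ∀ t → isY t ≡ true → u t ≡ true → t ≡ j
      onlyj t yt ut = pos-inj (≤-antisym (lb yt ut uj) (lb yj uj ut))

  -- Being matched is inherited by larger inputs. If `u` were unmatched, the induction hypothesis
  -- would reject everything properly inside it, so `u` would be minimal.
  matched-within : ∀ N u → count u < N → f u ≡ true → Matched u
  matched-within (suc N) u (s≤s c) fu with Matched? u
  ... | yes m = m
  ... | no nm = ⊥-elim (Minimal.absurd u fu minimal nm)
    where
    minimal : ∀ w v → u v ≡ true → w v ≡ false → w ⊆ᵇ u → f w ≡ false
    minimal w v uv wv sub = ¬-not λ fw → nm (lift (matched-within N w (<-≤-trans (count-strict sub v uv wv) c) fw))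
      where
      lift : Matched w → Matched u
      lift (i , xi , wi , yi , wρ) = i , xi , sub i wi , yi , sub (ρ i) wρ

  matched : ∀ u → f u ≡ true → Matched u
  matched u = matched-within (suc (count u)) u ≤-refl

-- Branching programs for matchings

some : {X : Set} → (X → Bool) → List X → Bool
some p []      = false
some p (a ∷ l) = p a ∨ some p l

some-intro : ∀ {X : Set} (p : X → Bool) {a l} → a ∈ l → p a ≡ true → some p l ≡ true
some-intro p (here refl) e rewrite e = refl
some-intro p {l = b ∷ l} (there m) e rewrite some-intro p m e = ∨-zeroʳ (p b)

some-elim : ∀ {X : Set} (p : X → Bool) l → some p l ≡ true → ∃ λ a → a ∈ l × p a ≡ true
some-elim p (a ∷ l) e with p a in eq
... | true  = a , here refl , eq
... | false with some-elim p l e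
...   | b , m , e′ = b , there m , e′

shift : ∀ {k} → Fin k ⊎ Bool → Fin (suc k) ⊎ Bool
shift (inj₁ i) = inj₁ (suc i)
shift (inj₂ b) = inj₂ b

-- Branching programs built by prepending nodes; edges point into the tail.
data Chain (n : ℕ) : ℕ → Set where
  []   : Chain n 0
  node : ∀ {k} → Fin n → (Bool → Fin k ⊎ Bool) → Chain n k → Chain n (suc k)

entry : ∀ k → Fin k ⊎ Bool
entry zero    = inj₂ false
entry (suc k) = inj₁ zero

module _ {n : ℕ} where

  run : ∀ {k} → Chain n k → (Fin n → Bool) → Fin k ⊎ Bool → Bool
  run c            x (inj₂ b)       = b
  run (node v e c) x (inj₁ zero)    = run c x (e (x v))
  run (node v e c) x (inj₁ (suc i)) = run c x (inj₁ i)

  runEntry : ∀ {k} → Chain n k → (Fin n → Bool) → Bool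
  runEntry {k} c x = run c x (entry k)

  varC : ∀ {k} → Chain n k → Fin k → Fin n
  varC (node v e c) zero    = v
  varC (node v e c) (suc i) = varC c i

  nextC : ∀ {k} → Chain n k → Fin k → Bool → Fin k ⊎ Bool
  nextC (node v e c) zero    b = shift (e b)
  nextC (node v e c) (suc i) b = shift (nextC c i b)

  run-shift : ∀ {k} v e (c : Chain n k) x s → run (node v e c) x (shift s) ≡ run c x s
  run-shift v e c x (inj₁ i) = refl
  run-shift v e []           x (inj₂ b) = refl
  run-shift v e (node _ _ _) x (inj₂ b) = refl

  run-next : ∀ {k} (c : Chain n k) x i → run c x (inj₁ i) ≡ run c x (nextC c i (x (varC c i)))
  run-next (node v e c) x zero    = sym (run-shift v e c x (e (x v)))
  run-next (node v e c) x (suc i) = trans (run-next c x i) (sym (run-shift v e c x (nextC c i (x (varC c i)))))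

  shift-inj₁ : ∀ {k} (s : Fin k ⊎ Bool) {j} → shift s ≡ inj₁ j → ∃ λ j′ → j ≡ suc j′ × s ≡ inj₁ j′
  shift-inj₁ (inj₁ i) refl = i , refl , refl

  topoC : ∀ {k} (c : Chain n k) i b j → nextC c i b ≡ inj₁ j → toℕ i < toℕ j
  topoC (node v e c) zero b j eq with shift-inj₁ (e b) eq
  ... | j′ , refl , _ = s≤s z≤n
  topoC (node v e c) (suc i) b j eq with shift-inj₁ (nextC c i b) eq
  ... | j′ , refl , eq′ = s≤s (topoC c i b j′ eq′)

  -- The incoming-edge conditions of `BP`. They survive prepending a node as soon as one of its
  -- edges leads to `entry`, the former source. The empty chain has no edges at all, hence the
  -- condition `k ≢ 0`.
  record Good {k : ℕ} (c : Chain n k) : Set where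
    field
      preds : ∀ j → toℕ j ≢ 0 → ∃₂ λ i b → nextC c i b ≡ inj₁ j
      sinks : k ≢ 0 → ∀ b → ∃₂ λ i b′ → nextC c i b′ ≡ inj₂ b
  open Good

  good-[] : Good []
  good-[] = record { preds = λ () ; sinks = λ ne → ⊥-elim (ne refl) }

  good-preds : ∀ {k v e} {c : Chain n k} → Good c → (∃ λ b → e b ≡ entry k) →
    ∀ j → toℕ j ≢ 0 → ∃₂ λ i b → nextC (node v e c) i b ≡ inj₁ j
  good-preds g _ zero ne = ⊥-elim (ne refl)
  good-preds {suc k} g (b , eb) (suc zero) ne = zero , b , cong shift eb
  good-preds {suc k} g _ (suc (suc j)) ne with preds g (suc j) (λ ())
  ... | i , b , eq = suc i , b , cong shift eq

  good-node : ∀ {k v e} {c : Chain n (suc k)} → Good c → (∃ λ b → e b ≡ entry (suc k)) → Good (node v e c)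
  good-node g t = record { preds = good-preds g t ; sinks = λ _ b → lift (sinks g (λ ()) b) }
    where
    lift : ∀ {b k v e} {c : Chain n k} → (∃₂ λ i b′ → nextC c i b′ ≡ inj₂ b) → ∃₂ λ i b′ → nextC (node v e c) i b′ ≡ inj₂ b
    lift (i , b′ , eq) = suc i , b′ , cong shift eq

  edgeY : ∀ k → Bool → Fin k ⊎ Bool
  edgeY k b = if b then inj₂ true else entry k

  good-Y : ∀ {k y} {c : Chain n k} → Good c → Good (node y (edgeY k) c)
  good-Y {k} {y} {c} g = record { preds = good-preds g (false , refl) ; sinks = λ _ → snk k c g }
    where
    snk : ∀ k (c : Chain n k) → Good c → ∀ b → ∃₂ λ i b′ → nextC (node y (edgeY k) c) i b′ ≡ inj₂ b
    snk k       c g true  = zero , true , refl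
    snk zero    c g false = zero , false , refl
    snk (suc k) c g false with sinks g (λ ()) false
    ... | i , b′ , eq = suc i , b′ , cong shift eq

  edgeX : ∀ {k} → Fin k → Bool → Fin k ⊎ Bool
  edgeX {k} y b = if b then inj₁ y else entry k

  addXs : ∀ {k} (xs : List (Fin n)) → Chain n k → Fin k → Chain n (length xs + k)
  addXs []       c y = c
  addXs (x ∷ xs) c y = node x (edgeX (length xs ↑ʳ y)) (addXs xs c y)

  edgeD : ∀ k → Bool → Fin (suc k) ⊎ Bool
  edgeD k b = if b then inj₁ zero else shift (entry k)

  -- A one at a member of `xs` or at `d` leads to the node of `y`; a zero at `d`, the last test,
  -- skips that node, so that `y` alone does not accept.
  group : ∀ {k} → Fin n → Fin n → (xs : List (Fin n)) → Chain n k → Chain n (length xs + suc (suc k))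
  group {k} y d xs c = addXs xs (node d (edgeD k) (node y (edgeY k) c)) (suc zero)

  good-addXs : ∀ {k} xs {c : Chain n (suc k)} {y} → Good c → Good (addXs xs c y)
  good-addXs []       g = g
  good-addXs {k} (x ∷ xs) {c} {y} g = go (length xs + suc k) (+-suc (length xs) k) (addXs xs c y) (length xs ↑ʳ y) (good-addXs xs g)
    where
    go : ∀ m → m ≡ suc (length xs + k) → (c : Chain n m) (y : Fin m) → Good c → Good (node x (edgeX y) c)
    go (suc m) _ c y g = good-node g (false , refl)

  good-group : ∀ {k} y d xs {c : Chain n k} → Good c → Good (group y d xs c)
  good-group y d xs g = good-addXs xs (good-node (good-Y g) (true , refl))

  run-raise : ∀ {k} xs (c : Chain n k) y x i → run (addXs xs c y) x (inj₁ (length xs ↑ʳ i)) ≡ run c x (inj₁ i)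
  run-raise []       c y x i = refl
  run-raise (v ∷ xs) c y x i = run-raise xs c y x i

  run-addXs : ∀ {k} xs (c : Chain n k) y x {r} → runEntry c x ≡ r →
    runEntry (addXs xs c y) x ≡ (if some x xs then run c x (inj₁ y) else r)
  run-addXs []       c y x e = e
  run-addXs (v ∷ xs) c y x e with x v
  ... | true  = run-raise xs c y x y
  ... | false = run-addXs xs c y x e

  run-Y : ∀ {k} y (c : Chain n k) x → run (node y (edgeY k) c) x (inj₁ zero) ≡ x y ∨ runEntry c x
  run-Y y [] x with x y
  ... | true  = refl
  ... | false = refl
  run-Y y (node _ _ _) x with x y
  ... | true  = refl
  ... | false = refl

  run-group : ∀ {k} y d xs (c : Chain n k) x → runEntry (group y d xs c) x ≡ ((x d ∨ some x xs) ∧ x y) ∨ runEntry c x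
  run-group {k} y d xs c x = trans (run-addXs xs (node d (edgeD k) c′) (suc zero) x refl) (trans (cong₂ (λ s r → if some x xs then s else r) (run-Y y c x) at-d) (table (x d) (some x xs) (x y) (runEntry c x)))
    where
    c′ : Chain n (suc k)
    c′ = node y (edgeY k) c
    at-d : run c′ x (edgeD k (x d)) ≡ (if x d then x y ∨ runEntry c x else runEntry c x)
    at-d with x d
    ... | true  = run-Y y c x
    ... | false = run-shift y (edgeY k) c x (entry k)
    table : ∀ d s y r → (if s then y ∨ r else (if d then y ∨ r else r)) ≡ ((d ∨ s) ∧ y) ∨ r
    table true  true  y r = refl
    table true  false y r = refl
    table false true  y r = refl
    table false false y r = refl

  toBP : ∀ {k} (c : Chain n k) → Good c → k ≢ 0 → ∃ λ k′ → suc k′ ≡ k × Σ (BP n k′) λ B → Computes B (runEntry c)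
  toBP {zero}  c g ne = ⊥-elim (ne refl)
  toBP {suc k} c g ne = k , refl , B , λ x → reach x (suc k) (inj₁ zero) (λ j _ → m≤n+m (suc k) (toℕ j))
    where
    B : BP n k
    B = record { var = varC c ; next = nextC c ; topo = topoC c ; nodePred = preds g ; sinkPred = sinks g (λ ()) }
    reach : ∀ x fuel s → (∀ j → s ≡ inj₁ j → suc k ≤ toℕ j + fuel) → Reaches B x s (run c x s)
    reach x fuel (inj₂ b) h = sink-case c
      where
      sink-case : ∀ {m} (c′ : Chain n m) → Reaches B x (inj₂ b) (run c′ x (inj₂ b))
      sink-case []           = sink b
      sink-case (node _ _ _) = sink b
    reach x zero (inj₁ i) h = ⊥-elim (<-irrefl refl (<-≤-trans (Fin.toℕ<n i) (≤-trans (h i refl) (≤-reflexive (+-identityʳ (toℕ i))))))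
    reach x (suc fuel) (inj₁ i) h = subst (Reaches B x (inj₁ i)) (sym (run-next c x i))
      (node i _ (reach x fuel (nextC c i (x (varC c i)))
        (λ j e → ≤-trans (h i refl) (≤-trans (≤-reflexive (+-suc (toℕ i) fuel)) (+-monoˡ-≤ fuel (topoC c i _ j e))))))

module Groups {n N : ℕ} (η d : Fin N → Fin n) (ρ : Fin n → Fin N) where

  members : List (Fin n) → Fin N → List (Fin n)
  members xs j = filter (λ i → ρ i Fin.≟ j) xs

  size : List (Fin n) → List (Fin N) → ℕ
  size xs []       = 0
  size xs (j ∷ js) = length (members xs j) + suc (suc (size xs js))

  chain : ∀ xs js → Chain n (size xs js)
  chain xs []       = []
  chain xs (j ∷ js) = group (η j) (d j) (members xs j) (chain xs js)

  good-chain : ∀ xs js → Good (chain xs js)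
  good-chain xs []       = good-[]
  good-chain xs (j ∷ js) = good-group (η j) (d j) (members xs j) (good-chain xs js)

  value : List (Fin n) → (Fin n → Bool) → Fin N → Bool
  value xs x j = (x (d j) ∨ some x (members xs j)) ∧ x (η j)

  run-chain : ∀ xs js x → runEntry (chain xs js) x ≡ some (value xs x) js
  run-chain xs []       x = refl
  run-chain xs (j ∷ js) x = trans (run-group (η j) (d j) (members xs j) (chain xs js) x)
                              (cong (value xs x j ∨_) (run-chain xs js x))

  members-none : ∀ i xs j → j ≢ ρ i → members (i ∷ xs) j ≡ members xs j
  members-none i xs j ne with ρ i Fin.≟ j
  ... | yes e = ⊥-elim (ne (sym e))
  ... | no _ = refl

  length-members : ∀ i xs j → length (members (i ∷ xs) j) ≤ suc (length (members xs j))
  length-members i xs j with ρ i Fin.≟ j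
  ... | yes _ = ≤-refl
  ... | no _  = n≤1+n _

  size-none : ∀ i xs js → All (ρ i ≢_) js → size (i ∷ xs) js ≡ size xs js
  size-none i xs []       []       = refl
  size-none i xs (j ∷ js) (ne ∷ h) = cong₂ (λ a b → length a + suc (suc b)) (members-none i xs j (λ e → ne (sym e))) (size-none i xs js h)

  -- A variable belongs to the group of `ρ i` only, and without repetitions in `js` this group is
  -- counted once.
  size-cons : ∀ i xs js → Unique js → size (i ∷ xs) js ≤ suc (size xs js)
  size-cons i xs []       _       = z≤n
  size-cons i xs (j ∷ js) (h ∷ u) with j Fin.≟ ρ i
  ... | yes refl = +-mono-≤ (length-members i xs j) (≤-reflexive (cong (λ b → suc (suc b)) (size-none i xs js h)))
  ... | no ne = ≤-trans (+-mono-≤ (≤-reflexive (cong length (members-none i xs j ne))) (s≤s (s≤s (size-cons i xs js u))))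
                        (≤-reflexive (+-suc _ _))

  size-[] : ∀ js → size [] js ≡ length js * 2
  size-[] []       = refl
  size-[] (j ∷ js) = cong (2 +_) (size-[] js)

  size-bound : ∀ xs js → Unique js → size xs js ≤ length xs + length js * 2
  size-bound []       js u = ≤-reflexive (size-[] js)
  size-bound (i ∷ xs) js u = ≤-trans (size-cons i xs js u) (s≤s (size-bound xs js u))

  value-dummy : ∀ xs {x j} → x (d j) ≡ true → x (η j) ≡ true → some (value xs x) (allFin N) ≡ true
  value-dummy xs {x} {j} e e′ = some-intro (value xs x) (∈-allFin j) (v e e′)
    where
    v : x (d j) ≡ true → x (η j) ≡ true → value xs x j ≡ true
    v e e′ rewrite e | e′ = refl

  value-member : ∀ xs {x i} → i ∈ xs → x i ≡ true → x (η (ρ i)) ≡ true → some (value xs x) (allFin N) ≡ true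
  value-member xs {x} {i} m e e′ = some-intro (value xs x) (∈-allFin (ρ i)) v
    where
    v : value xs x (ρ i) ≡ true
    v rewrite some-intro x (∈-filter⁺ (λ i′ → ρ i′ Fin.≟ ρ i) m refl) e | e′ | ∨-zeroʳ (x (d (ρ i))) = refl

  value-elim : ∀ xs x → some (value xs x) (allFin N) ≡ true → ∃ λ j → x (η j) ≡ true ×
    (x (d j) ≡ true ⊎ ∃ λ i → i ∈ xs × x i ≡ true × ρ i ≡ j)
  value-elim xs x e with some-elim (value xs x) (allFin N) e
  ... | j , _ , v with x (d j) in ed | some x (members xs j) in es | x (η j) in ey
  ...   | true  | _     | true = j , ey , inj₁ ed
  ...   | false | true  | true with some-elim x (members xs j) es
  ...     | i , m , xi with ∈-filter⁻ (λ i → ρ i Fin.≟ j) {xs = xs} m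
  ...       | m′ , e′ = j , ey , inj₂ (i , m′ , xi , e′)

-- Rows of the reduced truth table

-- A column of a row: the bits X₀ X₁ X₂ Y₀ Y₁ Y₂ D₀ D₁ D₂ at one index.
Col : Set
Col = Vec Bool 9

Flags : Set
Flags = Vec Bool 13

xk yk dk : Fin 3 → Fin 9
xk zero             = # 0
xk (suc zero)       = # 1
xk (suc (suc zero)) = # 2
yk zero             = # 3
yk (suc zero)       = # 4
yk (suc (suc zero)) = # 5
dk zero             = # 6
dk (suc zero)       = # 7
dk (suc (suc zero)) = # 8

infix 9 _!_
_!_ : ∀ {n} → Vec Bool n → Fin n → Bool
v ! i = lookup v i

-- In order: some X, some Y, some D together with its Y; then the common indices of the five pairs
-- of copies; then the indices missed by the Y-sets of these pairs. A flag of a row is the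
-- disjunction over its columns, so one pass with finite memory computes it; "all indices are
-- covered" is expressed as the absence of a missed index.
props : Col → Flags
props (x₀ ∷ x₁ ∷ x₂ ∷ y₀ ∷ y₁ ∷ y₂ ∷ d₀ ∷ d₁ ∷ d₂ ∷ []) =
  (x₀ ∨ x₁ ∨ x₂) ∷ (y₀ ∨ y₁ ∨ y₂) ∷ ((d₀ ∧ y₀) ∨ (d₁ ∧ y₁) ∨ (d₂ ∧ y₂)) ∷
  x₀ ∷ x₁ ∷ x₂ ∷ x₀ ∧ x₁ ∷ x₀ ∧ x₂ ∷
  not y₀ ∷ not y₁ ∷ not y₂ ∷ not (y₀ ∨ y₁) ∷ not (y₀ ∨ y₂) ∷ []

addFlags : Flags → Col → Flags
addFlags fl v = zipWith _∨_ fl (props v)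

noFlags : Flags
noFlags = vreplicate 13 false

flags : List Col → Flags
flags = foldl addFlags noFlags

-- Some index lies in both `X_p` and `X_q` while every index lies in `Y_p` or `Y_q`. If `ρ_p` and
-- `ρ_q` agree, their common value at that index is covered, so the entry 1 is justified. For
-- `p = q` it forces `ρ_p` to stay within its copy.
pairs : Flags → Bool
pairs fl = (fl ! # 3 ∧ not (fl ! # 8)) ∨ (fl ! # 4 ∧ not (fl ! # 9)) ∨ (fl ! # 5 ∧ not (fl ! # 10))
         ∨ (fl ! # 6 ∧ not (fl ! # 11)) ∨ (fl ! # 7 ∧ not (fl ! # 12))

-- Once some X and some Y are on, the entry is 1 or open, never 0: the constraints demand matches
-- and forbid none.
verdict : Flags → Bool → PVal
verdict fl hit =
  if not (fl ! # 1) then p0 else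
  if not (fl ! # 0) then (if fl ! # 2 then p1 else p0) else
  if pairs fl ∨ hit then p1 else star

meet : Col → Col → Col
meet = zipWith _∧_

ones zeros : Col
ones  = vreplicate 9 true
zeros = vreplicate 9 false

halve : List Col → List Col
halve (e ∷ o ∷ l) = meet e o ∷ halve l
halve _           = []

meetEven meetOdd : Col → List Col → Col
meetEven E (e ∷ o ∷ l) = meetEven (meet E e) l
meetEven E _           = E
meetOdd O (e ∷ o ∷ l)  = meetOdd (meet O o) l
meetOdd O _            = O

tableCol : Col → Col → Col → Col
tableCol E O v =
  v ! # 0 ∧ E ! # 3 ∷ v ! # 1 ∧ E ! # 4 ∷ v ! # 2 ∧ E ! # 5 ∷
  v ! # 0 ∧ O ! # 3 ∷ v ! # 1 ∧ O ! # 4 ∷ v ! # 2 ∧ O ! # 5 ∷ false ∷ false ∷ false ∷ []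

-- After `r` halvings, column `j` of `Y` is the conjunction over all indices that have `j` as their
-- bits from position `r` on. The even and odd conjunctions thus range over the indices whose bit
-- `r` is 0 or 1. Blocks have the length of `C`, so entry `r * m + i` belongs to the variable of
-- that number; its X-slots hold the tests for negative literals, its Y-slots those for positive
-- ones.
table : ℕ → List Col → List Col → List Col
table zero    Y C = []
table (suc b) Y C = map (tableCol (meetEven ones Y) (meetOdd ones Y)) C ++ table b (halve Y) C

litFlag : Fin 3 → Bool → Maybe Col → Bool
litFlag p pol nothing  = false
litFlag p pol (just w) = if pol then w ! yk p else w ! xk p

clauseHit : ∀ {n} → List Col → Clause n → Bool
clauseHit T ((a₀ , v₀) ∷ (a₁ , v₁) ∷ (a₂ , v₂) ∷ []) =
  ((true ∧ litFlag (# 0) a₀ (nthMaybe T (toℕ v₀))) ∧ litFlag (# 1) a₁ (nthMaybe T (toℕ v₁)))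
  ∧ litFlag (# 2) a₂ (nthMaybe T (toℕ v₂))

formulaHit : ∀ {n} → List Col → Bool → CNF3 n → Bool
formulaHit T h []      = h
formulaHit T h (c ∷ φ) = formulaHit T (h ∨ clauseHit T c) φ

abstract
  rowVal : ∀ {n} → ℕ → CNF3 n → List Col → PVal
  rowVal b φ C = verdict (flags C) (formulaHit (table b C C) false φ)

  rowVal-def : ∀ {n} b (φ : CNF3 n) C → rowVal b φ C ≡ verdict (flags C) (formulaHit (table b C C) false φ)
  rowVal-def b φ C = refl

colAt : ℕ → ℕ → Col
colAt j i = tabulate (λ c → bit j (9 * i + toℕ c))

rowCols : ℕ → ℕ → List Col
rowCols m j = applyUpTo (colAt j) m

abstract
  instanceOf : ∀ {n} b → CNF3 n → PartialTT (2 ^ b * 9)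
  instanceOf b φ = tabulate (λ j → rowVal b φ (rowCols (2 ^ b) (toℕ j)))

  instanceOf-def : ∀ {n} b (φ : CNF3 n) → instanceOf b φ ≡ tabulate (λ j → rowVal b φ (rowCols (2 ^ b) (toℕ j)))
  instanceOf-def b φ = refl

lookup-instanceOf : ∀ {n} b (φ : CNF3 n) j → lookup (instanceOf b φ) j ≡ rowVal b φ (rowCols (2 ^ b) (toℕ j))
lookup-instanceOf b φ j = trans (cong (λ v → lookup v j) (instanceOf-def b φ)) (lookup∘tabulate _ j)

∨-split : ∀ a {b} → a ∨ b ≡ true → a ≡ true ⊎ b ≡ true
∨-split true  e = inj₁ refl
∨-split false e = inj₂ e

∧-split : ∀ a {b} → a ∧ b ≡ true → a ≡ true × b ≡ true
∧-split true e = refl , e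

∧-intro : ∀ {a b} → a ≡ true → b ≡ true → a ∧ b ≡ true
∧-intro refl refl = refl

not-true : ∀ a → not a ≡ true → a ≡ false
not-true false e = refl

not-false : ∀ {a} → a ≡ false → not a ≡ true
not-false refl = refl

bool-dec : ∀ b → b ≡ true ⊎ b ≡ false
bool-dec true  = inj₁ refl
bool-dec false = inj₂ refl

foldl-flags-mono : ∀ fl C k → fl ! k ≡ true → foldl addFlags fl C ! k ≡ true
foldl-flags-mono fl []      k e = e
foldl-flags-mono fl (v ∷ C) k e = foldl-flags-mono (addFlags fl v) C k
  (trans (lookup-zipWith _∨_ k fl (props v)) (cong (_∨ props v ! k) e))

foldl-flags-intro : ∀ fl (g : ℕ → Col) m k i → i < m → props (g i) ! k ≡ true →
  foldl addFlags fl (applyUpTo g m) ! k ≡ true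
foldl-flags-intro fl g (suc m) k zero    _       e = foldl-flags-mono _ (applyUpTo (λ i → g (suc i)) m) k
  (trans (lookup-zipWith _∨_ k fl (props (g 0))) (trans (cong (fl ! k ∨_) e) (∨-zeroʳ _)))
foldl-flags-intro fl g (suc m) k (suc i) (s≤s l) e = foldl-flags-intro _ (λ i → g (suc i)) m k i l e

foldl-flags-elim : ∀ fl (g : ℕ → Col) m k → foldl addFlags fl (applyUpTo g m) ! k ≡ true →
  fl ! k ≡ true ⊎ ∃ λ i → i < m × props (g i) ! k ≡ true
foldl-flags-elim fl g zero    k e = inj₁ e
foldl-flags-elim fl g (suc m) k e with foldl-flags-elim (addFlags fl (g 0)) (λ i → g (suc i)) m k e
... | inj₂ (i , l , e′) = inj₂ (suc i , s≤s l , e′)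
... | inj₁ e′ with ∨-split (fl ! k) (trans (sym (lookup-zipWith _∨_ k fl (props (g 0)))) e′)
...   | inj₁ e″ = inj₁ e″
...   | inj₂ e″ = inj₂ (0 , s≤s z≤n , e″)

flags-intro : ∀ (g : ℕ → Col) m k i → i < m → props (g i) ! k ≡ true → flags (applyUpTo g m) ! k ≡ true
flags-intro = foldl-flags-intro noFlags

flags-elim : ∀ (g : ℕ → Col) m k → flags (applyUpTo g m) ! k ≡ true → ∃ λ i → i < m × props (g i) ! k ≡ true
flags-elim g m k e with foldl-flags-elim noFlags g m k e
... | inj₂ r = r
... | inj₁ e′ = ⊥-elim (true≢false (trans (sym e′) (lookup-replicate k false)))

-- Binary digits of natural numbers

even-bit : ∀ j → bit (j * 2) 0 ≡ false
even-bit j = cong (_≡ᵇ 1) ([m+kn]%n≡m%n 0 j 2)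

odd-bit : ∀ j → bit (suc (j * 2)) 0 ≡ true
odd-bit j = cong (_≡ᵇ 1) ([m+kn]%n≡m%n 1 j 2)

half-even : ∀ j → ⌊ j * 2 /2⌋ ≡ j
half-even zero    = refl
half-even (suc j) = cong suc (half-even j)

half-odd : ∀ j → ⌊ suc (j * 2) /2⌋ ≡ j
half-odd zero    = refl
half-odd (suc j) = cong suc (half-odd j)

data Parity : ℕ → Set where
  even : ∀ j → Parity (j * 2)
  odd  : ∀ j → Parity (suc (j * 2))

parityOf : ∀ n → Parity n
parityOf zero    = even 0
parityOf (suc n) with parityOf n
... | even j = odd j
... | odd j  = even (suc j)

double : Bool → ℕ → ℕ
double false j = j * 2
double true  j = suc (j * 2)

bit-double-0 : ∀ a j → bit (double a j) 0 ≡ a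
bit-double-0 false j = even-bit j
bit-double-0 true  j = odd-bit j

bit-double-suc : ∀ a j r → bit (double a j) (suc r) ≡ bit j r
bit-double-suc false j r = cong (λ z → bit z r) (half-even j)
bit-double-suc true  j r = cong (λ z → bit z r) (half-odd j)

undouble : ∀ n → ∃₂ λ a j → n ≡ double a j
undouble n with parityOf n
... | even j = false , j , refl
... | odd j  = true , j , refl

double-< : ∀ a j k → j < k → double a j < k * 2
double-< false j k l = *-monoˡ-< 2 l
double-< true  j k l = ≤-trans (≤-reflexive refl) (*-monoˡ-≤ 2 l)

double-<⁻ : ∀ a j k → double a j < k * 2 → j < k
double-<⁻ false j k l = *-cancelʳ-< 2 j k l
double-<⁻ true  j k l = *-cancelʳ-< 2 j k (≤-trans (n≤1+n _) l)

fromBits : ℕ → (ℕ → Bool) → ℕ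
fromBits zero    g = 0
fromBits (suc b) g = double (g 0) (fromBits b (λ r → g (suc r)))

fromBits-< : ∀ b g → fromBits b g < 2 ^ b
fromBits-< zero    g = s≤s z≤n
fromBits-< (suc b) g = <-≤-trans (double-< (g 0) _ (2 ^ b) (fromBits-< b (λ r → g (suc r)))) (≤-reflexive (*-comm (2 ^ b) 2))

bit-fromBits : ∀ b g r → r < b → bit (fromBits b g) r ≡ g r
bit-fromBits (suc b) g zero    _       = bit-double-0 (g 0) _
bit-fromBits (suc b) g (suc r) (s≤s l) = trans (bit-double-suc (g 0) _ r) (bit-fromBits b (λ r → g (suc r)) r l)

-- The table of literal conditions

halveFun : (ℕ → Col) → ℕ → Col
halveFun g j = meet (g (j * 2)) (g (suc (j * 2)))

halve-applyUpTo : ∀ (g : ℕ → Col) k → halve (applyUpTo g (k * 2)) ≡ applyUpTo (halveFun g) k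
halve-applyUpTo g zero    = refl
halve-applyUpTo g (suc k) = cong (halveFun g 0 ∷_) (halve-applyUpTo (λ i → g (suc (suc i))) k)

meet-true : ∀ (u v : Col) c → meet u v ! c ≡ true → u ! c ≡ true × v ! c ≡ true
meet-true u v c e = ∧-split (u ! c) (trans (sym (lookup-zipWith _∧_ c u v)) e)

meet-intro : ∀ (u v : Col) c → u ! c ≡ true → v ! c ≡ true → meet u v ! c ≡ true
meet-intro u v c e e′ = trans (lookup-zipWith _∧_ c u v) (∧-intro e e′)

meetBy : Bool → Col → List Col → Col
meetBy false = meetEven
meetBy true  = meetOdd

meetBy-intro : ∀ a E (g : ℕ → Col) k c → E ! c ≡ true → (∀ j → j < k → g (double a j) ! c ≡ true) →
  meetBy a E (applyUpTo g (k * 2)) ! c ≡ true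
meetBy-intro false E g zero    c e h = e
meetBy-intro true  E g zero    c e h = e
meetBy-intro false E g (suc k) c e h = meetBy-intro false _ (λ i → g (suc (suc i))) k c (meet-intro E (g 0) c e (h 0 (s≤s z≤n))) (λ j l → h (suc j) (s≤s l))
meetBy-intro true  E g (suc k) c e h = meetBy-intro true  _ (λ i → g (suc (suc i))) k c (meet-intro E (g 1) c e (h 0 (s≤s z≤n))) (λ j l → h (suc j) (s≤s l))

meetBy-elim : ∀ a E (g : ℕ → Col) k c → meetBy a E (applyUpTo g (k * 2)) ! c ≡ true →
  E ! c ≡ true × (∀ j → j < k → g (double a j) ! c ≡ true)
meetBy-elim false E g zero    c e = e , λ _ ()
meetBy-elim true  E g zero    c e = e , λ _ ()
meetBy-elim false E g (suc k) c e with meetBy-elim false _ (λ i → g (suc (suc i))) k c e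
... | e′ , h with meet-true E (g 0) c e′
...   | e₁ , e₂ = e₁ , λ { zero _ → e₂ ; (suc j) (s≤s l) → h j l }
meetBy-elim true E g (suc k) c e with meetBy-elim true _ (λ i → g (suc (suc i))) k c e
... | e′ , h with meet-true E (g 1) c e′
...   | e₁ , e₂ = e₁ , λ { zero _ → e₂ ; (suc j) (s≤s l) → h j l }

nthMaybe-++ˡ : ∀ {X : Set} (l l′ : List X) i → i < length l → nthMaybe (l ++ l′) i ≡ nthMaybe l i
nthMaybe-++ˡ (a ∷ l) l′ zero    lt = refl
nthMaybe-++ˡ (a ∷ l) l′ (suc i) (s≤s lt) = nthMaybe-++ˡ l l′ i lt

nthMaybe-++ʳ : ∀ {X : Set} (l l′ : List X) i → nthMaybe (l ++ l′) (length l + i) ≡ nthMaybe l′ i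
nthMaybe-++ʳ []      l′ i = refl
nthMaybe-++ʳ (a ∷ l) l′ i = nthMaybe-++ʳ l l′ i

nthMaybe-applyUpTo : ∀ {X : Set} (g : ℕ → X) m i → i < m → nthMaybe (applyUpTo g m) i ≡ just (g i)
nthMaybe-applyUpTo g (suc m) zero    l       = refl
nthMaybe-applyUpTo g (suc m) (suc i) (s≤s l) = nthMaybe-applyUpTo (λ i → g (suc i)) m i l

-- The Y-set need only contain the values whose bit `r` is `a`: a literal that holds guarantees a
-- match in every larger set as well.
Covers : (ℕ → Col) → ℕ → ℕ → Bool → Fin 9 → Set
Covers g b r a c = ∀ j → j < 2 ^ b → bit j r ≡ a → g j ! c ≡ true

Covers-halve : ∀ g b r a c → Covers g (suc b) (suc r) a c → Covers (halveFun g) b r a c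
Covers-halve g b r a c h j l e = meet-intro (g (j * 2)) (g (suc (j * 2))) c (at false) (at true)
  where
  at : ∀ z → g (double z j) ! c ≡ true
  at z = h (double z j) (<-≤-trans (double-< z j (2 ^ b) l) (≤-reflexive (*-comm (2 ^ b) 2))) (trans (bit-double-suc z j r) e)

Covers-halve⁻ : ∀ g b r a c → Covers (halveFun g) b r a c → Covers g (suc b) (suc r) a c
Covers-halve⁻ g b r a c h j l e with undouble j
... | z , j′ , refl = pick z
  where
  both : g (j′ * 2) ! c ≡ true × g (suc (j′ * 2)) ! c ≡ true
  both = meet-true (g (j′ * 2)) (g (suc (j′ * 2))) c
    (h j′ (double-<⁻ z j′ (2 ^ b) (<-≤-trans l (≤-reflexive (*-comm 2 (2 ^ b))))) (trans (sym (bit-double-suc z j′ r)) e))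
  pick : ∀ z → g (double z j′) ! c ≡ true
  pick false = proj₁ both
  pick true  = proj₂ both

litFlag-tableCol : ∀ p a (E O v : Col) → litFlag p a (just (tableCol E O v)) ≡ v ! xk p ∧ (if a then O else E) ! yk p
litFlag-tableCol zero             false E O v = refl
litFlag-tableCol zero             true  E O v = refl
litFlag-tableCol (suc zero)       false E O v = refl
litFlag-tableCol (suc zero)       true  E O v = refl
litFlag-tableCol (suc (suc zero)) false E O v = refl
litFlag-tableCol (suc (suc zero)) true  E O v = refl

ones-true : ∀ c → ones ! c ≡ true
ones-true c = lookup-replicate c true

module Table (gC : ℕ → Col) (m : ℕ) where

  C : List Col
  C = applyUpTo gC m

  at-first : ∀ (E O : Col) T i → i < m → nthMaybe (map (tableCol E O) C ++ T) i ≡ just (tableCol E O (gC i))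
  at-first E O T i l rewrite map-applyUpTo gC (tableCol E O) m =
    trans (nthMaybe-++ˡ (applyUpTo (λ i → tableCol E O (gC i)) m) T i (<-≤-trans l (≤-reflexive (sym (length-applyUpTo _ m)))))
          (nthMaybe-applyUpTo (λ i → tableCol E O (gC i)) m i l)

  at-rest : ∀ (E O : Col) T i → nthMaybe (map (tableCol E O) C ++ T) (m + i) ≡ nthMaybe T i
  at-rest E O T i = trans (cong (λ k → nthMaybe (map (tableCol E O) C ++ T) (k + i)) (sym len)) (nthMaybe-++ʳ (map (tableCol E O) C) T i)
    where
    len : length (map (tableCol E O) C) ≡ m
    len = trans (length-map (tableCol E O) C) (length-applyUpTo gC m)

  pickBy : ∀ a (E O : Col) (Y : List Col) → (if a then meetOdd ones Y else meetEven ones Y) ≡ meetBy a ones Y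
  pickBy false E O Y = refl
  pickBy true  E O Y = refl

  applyUpTo-2^ : ∀ (g : ℕ → Col) b → applyUpTo g (2 ^ suc b) ≡ applyUpTo g (2 ^ b * 2)
  applyUpTo-2^ g b = cong (applyUpTo g) (*-comm 2 (2 ^ b))

  halve-2^ : ∀ (g : ℕ → Col) b → halve (applyUpTo g (2 ^ suc b)) ≡ applyUpTo (halveFun g) (2 ^ b)
  halve-2^ g b = trans (cong halve (applyUpTo-2^ g b)) (halve-applyUpTo g (2 ^ b))

  table-intro : ∀ b (g : ℕ → Col) r i p a → r < b → i < m → gC i ! xk p ≡ true → Covers g b r a (yk p) →
    litFlag p a (nthMaybe (table b (applyUpTo g (2 ^ b)) C) (r * m + i)) ≡ true
  table-intro (suc b) g zero i p a _ l ex cov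
    rewrite at-first (meetEven ones (applyUpTo g (2 ^ suc b))) (meetOdd ones (applyUpTo g (2 ^ suc b)))
                     (table b (halve (applyUpTo g (2 ^ suc b))) C) i l
          | litFlag-tableCol p a (meetEven ones (applyUpTo g (2 ^ suc b))) (meetOdd ones (applyUpTo g (2 ^ suc b))) (gC i)
          | pickBy a ones ones (applyUpTo g (2 ^ suc b)) | applyUpTo-2^ g b =
    ∧-intro ex (meetBy-intro a ones g (2 ^ b) (yk p) (ones-true (yk p))
      (λ j lj → cov (double a j) (<-≤-trans (double-< a j (2 ^ b) lj) (≤-reflexive (*-comm (2 ^ b) 2))) (bit-double-0 a j)))
  table-intro (suc b) g (suc r) i p a (s≤s lr) l ex cov
    rewrite +-assoc m (r * m) i
          | at-rest (meetEven ones (applyUpTo g (2 ^ suc b))) (meetOdd ones (applyUpTo g (2 ^ suc b)))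
                    (table b (halve (applyUpTo g (2 ^ suc b))) C) (r * m + i)
          | halve-2^ g b =
    table-intro b (halveFun g) r i p a lr l ex (Covers-halve g b r a (yk p) cov)

  table-elim : ∀ b (g : ℕ → Col) r i p a → r < b → i < m →
    litFlag p a (nthMaybe (table b (applyUpTo g (2 ^ b)) C) (r * m + i)) ≡ true →
    gC i ! xk p ≡ true × Covers g b r a (yk p)
  table-elim (suc b) g zero i p a _ l e
    rewrite at-first (meetEven ones (applyUpTo g (2 ^ suc b))) (meetOdd ones (applyUpTo g (2 ^ suc b)))
                     (table b (halve (applyUpTo g (2 ^ suc b))) C) i l
          | litFlag-tableCol p a (meetEven ones (applyUpTo g (2 ^ suc b))) (meetOdd ones (applyUpTo g (2 ^ suc b))) (gC i)
          | pickBy a ones ones (applyUpTo g (2 ^ suc b)) | applyUpTo-2^ g b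
    with ∧-split (gC i ! xk p) e
  ... | ex , em = ex , cov
    where
    cov : Covers g (suc b) 0 a (yk p)
    cov j lj ej with undouble j
    ... | z , j′ , refl with trans (sym (bit-double-0 z j′)) ej
    ...   | refl = proj₂ (meetBy-elim a ones g (2 ^ b) (yk p) em) j′
                     (double-<⁻ a j′ (2 ^ b) (<-≤-trans lj (≤-reflexive (*-comm 2 (2 ^ b)))))
  table-elim (suc b) g (suc r) i p a (s≤s lr) l e
    rewrite +-assoc m (r * m) i
          | at-rest (meetEven ones (applyUpTo g (2 ^ suc b))) (meetOdd ones (applyUpTo g (2 ^ suc b)))
                    (table b (halve (applyUpTo g (2 ^ suc b))) C) (r * m + i)
          | halve-2^ g b
    with table-elim b (halveFun g) r i p a lr l e
  ... | ex , cov = ex , Covers-halve⁻ g b r a (yk p) cov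

-- Reading the verdict of a row

∨-introˡ : ∀ {a b} → a ≡ true → a ∨ b ≡ true
∨-introˡ refl = refl

∨-introʳ : ∀ a {b} → b ≡ true → a ∨ b ≡ true
∨-introʳ a refl = ∨-zeroʳ a

-- The pairs (p , q) for which common indices of X_p and X_q are tested against Y_p ∪ Y_q.
pairˡ pairʳ : Fin 5 → Fin 3
pairˡ zero                         = # 0
pairˡ (suc zero)                   = # 1
pairˡ (suc (suc zero))             = # 2
pairˡ (suc (suc (suc k)))          = # 0
pairʳ zero                         = # 0
pairʳ (suc zero)                   = # 1
pairʳ (suc (suc zero))             = # 2
pairʳ (suc (suc (suc zero)))       = # 1
pairʳ (suc (suc (suc (suc zero)))) = # 2

commonFlag uncoveredFlag : Fin 5 → Fin 13
commonFlag    zero                         = # 3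
commonFlag    (suc zero)                   = # 4
commonFlag    (suc (suc zero))             = # 5
commonFlag    (suc (suc (suc zero)))       = # 6
commonFlag    (suc (suc (suc (suc zero)))) = # 7
uncoveredFlag zero                         = # 8
uncoveredFlag (suc zero)                   = # 9
uncoveredFlag (suc (suc zero))             = # 10
uncoveredFlag (suc (suc (suc zero)))       = # 11
uncoveredFlag (suc (suc (suc (suc zero)))) = # 12

anyX-intro : ∀ v p → v ! xk p ≡ true → props v ! # 0 ≡ true
anyX-intro (x₀ ∷ x₁ ∷ x₂ ∷ _ ∷ _ ∷ _ ∷ _ ∷ _ ∷ _ ∷ []) zero             e = ∨-introˡ e
anyX-intro (x₀ ∷ x₁ ∷ x₂ ∷ _ ∷ _ ∷ _ ∷ _ ∷ _ ∷ _ ∷ []) (suc zero)       e = ∨-introʳ x₀ (∨-introˡ e)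
anyX-intro (x₀ ∷ x₁ ∷ x₂ ∷ _ ∷ _ ∷ _ ∷ _ ∷ _ ∷ _ ∷ []) (suc (suc zero)) e = ∨-introʳ x₀ (∨-introʳ x₁ e)

anyX-elim : ∀ v → props v ! # 0 ≡ true → ∃ λ p → v ! xk p ≡ true
anyX-elim (x₀ ∷ x₁ ∷ x₂ ∷ _ ∷ _ ∷ _ ∷ _ ∷ _ ∷ _ ∷ []) e with ∨-split x₀ e
... | inj₁ e₀ = # 0 , e₀
... | inj₂ e′ with ∨-split x₁ e′
...   | inj₁ e₁ = # 1 , e₁
...   | inj₂ e₂ = # 2 , e₂

anyY-intro : ∀ v p → v ! yk p ≡ true → props v ! # 1 ≡ true
anyY-intro (_ ∷ _ ∷ _ ∷ y₀ ∷ y₁ ∷ y₂ ∷ _ ∷ _ ∷ _ ∷ []) zero             e = ∨-introˡ e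
anyY-intro (_ ∷ _ ∷ _ ∷ y₀ ∷ y₁ ∷ y₂ ∷ _ ∷ _ ∷ _ ∷ []) (suc zero)       e = ∨-introʳ y₀ (∨-introˡ e)
anyY-intro (_ ∷ _ ∷ _ ∷ y₀ ∷ y₁ ∷ y₂ ∷ _ ∷ _ ∷ _ ∷ []) (suc (suc zero)) e = ∨-introʳ y₀ (∨-introʳ y₁ e)

anyY-elim : ∀ v → props v ! # 1 ≡ true → ∃ λ p → v ! yk p ≡ true
anyY-elim (_ ∷ _ ∷ _ ∷ y₀ ∷ y₁ ∷ y₂ ∷ _ ∷ _ ∷ _ ∷ []) e with ∨-split y₀ e
... | inj₁ e₀ = # 0 , e₀
... | inj₂ e′ with ∨-split y₁ e′
...   | inj₁ e₁ = # 1 , e₁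
...   | inj₂ e₂ = # 2 , e₂

anyDY-intro : ∀ v p → v ! dk p ≡ true → v ! yk p ≡ true → props v ! # 2 ≡ true
anyDY-intro (_ ∷ _ ∷ _ ∷ y₀ ∷ y₁ ∷ y₂ ∷ d₀ ∷ d₁ ∷ d₂ ∷ []) zero             e e′ = ∨-introˡ (∧-intro e e′)
anyDY-intro (_ ∷ _ ∷ _ ∷ y₀ ∷ y₁ ∷ y₂ ∷ d₀ ∷ d₁ ∷ d₂ ∷ []) (suc zero)       e e′ = ∨-introʳ (d₀ ∧ y₀) (∨-introˡ (∧-intro e e′))
anyDY-intro (_ ∷ _ ∷ _ ∷ y₀ ∷ y₁ ∷ y₂ ∷ d₀ ∷ d₁ ∷ d₂ ∷ []) (suc (suc zero)) e e′ = ∨-introʳ (d₀ ∧ y₀) (∨-introʳ (d₁ ∧ y₁) (∧-intro e e′))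

anyDY-elim : ∀ v → props v ! # 2 ≡ true → ∃ λ p → v ! dk p ≡ true × v ! yk p ≡ true
anyDY-elim (_ ∷ _ ∷ _ ∷ y₀ ∷ y₁ ∷ y₂ ∷ d₀ ∷ d₁ ∷ d₂ ∷ []) e with ∨-split (d₀ ∧ y₀) e
... | inj₁ e₀ = # 0 , ∧-split d₀ e₀
... | inj₂ e′ with ∨-split (d₁ ∧ y₁) e′
...   | inj₁ e₁ = # 1 , ∧-split d₁ e₁
...   | inj₂ e₂ = # 2 , ∧-split d₂ e₂

common-intro : ∀ k v → v ! xk (pairˡ k) ≡ true → v ! xk (pairʳ k) ≡ true → props v ! commonFlag k ≡ true
common-intro zero                         (_ ∷ _ ∷ _ ∷ _ ∷ _ ∷ _ ∷ _ ∷ _ ∷ _ ∷ []) e e′ = e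
common-intro (suc zero)                   (_ ∷ _ ∷ _ ∷ _ ∷ _ ∷ _ ∷ _ ∷ _ ∷ _ ∷ []) e e′ = e
common-intro (suc (suc zero))             (_ ∷ _ ∷ _ ∷ _ ∷ _ ∷ _ ∷ _ ∷ _ ∷ _ ∷ []) e e′ = e
common-intro (suc (suc (suc zero)))       (_ ∷ _ ∷ _ ∷ _ ∷ _ ∷ _ ∷ _ ∷ _ ∷ _ ∷ []) e e′ = ∧-intro e e′
common-intro (suc (suc (suc (suc zero)))) (_ ∷ _ ∷ _ ∷ _ ∷ _ ∷ _ ∷ _ ∷ _ ∷ _ ∷ []) e e′ = ∧-intro e e′

common-elim : ∀ k v → props v ! commonFlag k ≡ true → v ! xk (pairˡ k) ≡ true × v ! xk (pairʳ k) ≡ true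
common-elim zero                         (_ ∷ _ ∷ _ ∷ _ ∷ _ ∷ _ ∷ _ ∷ _ ∷ _ ∷ []) e = e , e
common-elim (suc zero)                   (_ ∷ _ ∷ _ ∷ _ ∷ _ ∷ _ ∷ _ ∷ _ ∷ _ ∷ []) e = e , e
common-elim (suc (suc zero))             (_ ∷ _ ∷ _ ∷ _ ∷ _ ∷ _ ∷ _ ∷ _ ∷ _ ∷ []) e = e , e
common-elim (suc (suc (suc zero)))       (x ∷ _ ∷ _ ∷ _ ∷ _ ∷ _ ∷ _ ∷ _ ∷ _ ∷ []) e = ∧-split x e
common-elim (suc (suc (suc (suc zero)))) (x ∷ _ ∷ _ ∷ _ ∷ _ ∷ _ ∷ _ ∷ _ ∷ _ ∷ []) e = ∧-split x e

uncovered : ∀ k v → props v ! uncoveredFlag k ≡ not (v ! yk (pairˡ k) ∨ v ! yk (pairʳ k))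
uncovered zero                         (_ ∷ _ ∷ _ ∷ y ∷ _ ∷ _ ∷ _ ∷ _ ∷ _ ∷ []) = cong not (sym (∨-idem y))
uncovered (suc zero)                   (_ ∷ _ ∷ _ ∷ _ ∷ y ∷ _ ∷ _ ∷ _ ∷ _ ∷ []) = cong not (sym (∨-idem y))
uncovered (suc (suc zero))             (_ ∷ _ ∷ _ ∷ _ ∷ _ ∷ y ∷ _ ∷ _ ∷ _ ∷ []) = cong not (sym (∨-idem y))
uncovered (suc (suc (suc zero)))       (_ ∷ _ ∷ _ ∷ _ ∷ _ ∷ _ ∷ _ ∷ _ ∷ _ ∷ []) = refl
uncovered (suc (suc (suc (suc zero)))) (_ ∷ _ ∷ _ ∷ _ ∷ _ ∷ _ ∷ _ ∷ _ ∷ _ ∷ []) = refl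

pairs-intro : ∀ k fl → fl ! commonFlag k ≡ true → fl ! uncoveredFlag k ≡ false → pairs fl ≡ true
pairs-intro zero fl e e′ = ∨-introˡ (∧-intro e (not-false e′))
pairs-intro (suc zero) fl e e′ = ∨-introʳ (fl ! # 3 ∧ not (fl ! # 8)) (∨-introˡ (∧-intro e (not-false e′)))
pairs-intro (suc (suc zero)) fl e e′ = ∨-introʳ (fl ! # 3 ∧ not (fl ! # 8)) (∨-introʳ (fl ! # 4 ∧ not (fl ! # 9)) (∨-introˡ (∧-intro e (not-false e′))))
pairs-intro (suc (suc (suc zero))) fl e e′ = ∨-introʳ (fl ! # 3 ∧ not (fl ! # 8)) (∨-introʳ (fl ! # 4 ∧ not (fl ! # 9))
  (∨-introʳ (fl ! # 5 ∧ not (fl ! # 10)) (∨-introˡ (∧-intro e (not-false e′)))))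
pairs-intro (suc (suc (suc (suc zero)))) fl e e′ = ∨-introʳ (fl ! # 3 ∧ not (fl ! # 8)) (∨-introʳ (fl ! # 4 ∧ not (fl ! # 9))
  (∨-introʳ (fl ! # 5 ∧ not (fl ! # 10)) (∨-introʳ (fl ! # 6 ∧ not (fl ! # 11)) (∧-intro e (not-false e′)))))

pairs-elim : ∀ fl → pairs fl ≡ true → ∃ λ k → fl ! commonFlag k ≡ true × fl ! uncoveredFlag k ≡ false
pairs-elim fl e with ∨-split (fl ! # 3 ∧ not (fl ! # 8)) e
... | inj₁ e₀ = # 0 , proj₁ (∧-split (fl ! # 3) e₀) , not-true _ (proj₂ (∧-split (fl ! # 3) e₀))
... | inj₂ e′ with ∨-split (fl ! # 4 ∧ not (fl ! # 9)) e′
...   | inj₁ e₀ = # 1 , proj₁ (∧-split (fl ! # 4) e₀) , not-true _ (proj₂ (∧-split (fl ! # 4) e₀))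
...   | inj₂ e″ with ∨-split (fl ! # 5 ∧ not (fl ! # 10)) e″
...     | inj₁ e₀ = # 2 , proj₁ (∧-split (fl ! # 5) e₀) , not-true _ (proj₂ (∧-split (fl ! # 5) e₀))
...     | inj₂ e‴ with ∨-split (fl ! # 6 ∧ not (fl ! # 11)) e‴
...       | inj₁ e₀ = # 3 , proj₁ (∧-split (fl ! # 6) e₀) , not-true _ (proj₂ (∧-split (fl ! # 6) e₀))
...       | inj₂ e₀ = # 4 , proj₁ (∧-split (fl ! # 7) e₀) , not-true _ (proj₂ (∧-split (fl ! # 7) e₀))

verdict-p1 : ∀ fl h → verdict fl h ≡ p1 → (fl ! # 0 ≡ false × fl ! # 2 ≡ true) ⊎ pairs fl ∨ h ≡ true
verdict-p1 fl h e with fl ! # 1 | fl ! # 0 | fl ! # 2 | pairs fl ∨ h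
verdict-p1 fl h () | false | _     | _     | _
verdict-p1 fl h () | true  | false | false | _
verdict-p1 fl h e  | true  | false | true  | _     = inj₁ (refl , refl)
verdict-p1 fl h e  | true  | true  | _     | true  = inj₂ refl
verdict-p1 fl h () | true  | true  | _     | false

verdict-p0 : ∀ fl h → verdict fl h ≡ p0 → fl ! # 1 ≡ false ⊎ (fl ! # 0 ≡ false × fl ! # 2 ≡ false)
verdict-p0 fl h e with fl ! # 1 | fl ! # 0 | fl ! # 2 | pairs fl ∨ h
verdict-p0 fl h e  | false | _     | _     | _     = inj₁ refl
verdict-p0 fl h e  | true  | false | false | _     = inj₂ (refl , refl)
verdict-p0 fl h () | true  | false | true  | _
verdict-p0 fl h () | true  | true  | _     | true
verdict-p0 fl h () | true  | true  | _     | false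

verdict-noY : ∀ fl h → fl ! # 1 ≡ false → verdict fl h ≡ p0
verdict-noY fl h e rewrite e = refl

verdict-noX : ∀ fl h → fl ! # 0 ≡ false → fl ! # 2 ≡ false → verdict fl h ≡ p0
verdict-noX fl h e e′ with fl ! # 1
... | false = refl
... | true rewrite e | e′ = refl

verdict-D : ∀ fl h → fl ! # 1 ≡ true → fl ! # 0 ≡ false → fl ! # 2 ≡ true → verdict fl h ≡ p1
verdict-D fl h e₁ e₀ e₂ rewrite e₁ | e₀ | e₂ = refl

verdict-X : ∀ fl h → fl ! # 1 ≡ true → fl ! # 0 ≡ true → pairs fl ∨ h ≡ true → verdict fl h ≡ p1
verdict-X fl h e₁ e₀ e rewrite e₁ | e₀ | e = refl

formulaHit-true : ∀ {n} T (φ : CNF3 n) → formulaHit T true φ ≡ true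
formulaHit-true T []      = refl
formulaHit-true T (c ∷ φ) = formulaHit-true T φ

formulaHit-intro : ∀ {n} T h (φ : CNF3 n) {c} → c ∈ φ → clauseHit T c ≡ true → formulaHit T h φ ≡ true
formulaHit-intro T h (c ∷ φ) (here refl) e rewrite e | ∨-zeroʳ h = formulaHit-true T φ
formulaHit-intro T h (c ∷ φ) (there m)   e = formulaHit-intro T _ φ m e

formulaHit-elim : ∀ {n} T h (φ : CNF3 n) → formulaHit T h φ ≡ true → h ≡ true ⊎ ∃ λ c → c ∈ φ × clauseHit T c ≡ true
formulaHit-elim T h []      e = inj₁ e
formulaHit-elim T h (c ∷ φ) e with formulaHit-elim T (h ∨ clauseHit T c) φ e
... | inj₂ (c′ , m , e′) = inj₂ (c′ , there m , e′)
... | inj₁ e′ with ∨-split h e′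
...   | inj₁ e″ = inj₁ e″
...   | inj₂ e″ = inj₂ (c , here refl , e″)

litHit : ∀ {n} → List Col → Clause n → Fin 3 → Bool
litHit T c p = litFlag p (proj₁ (lookup c p)) (nthMaybe T (toℕ (proj₂ (lookup c p))))

clauseHit-intro : ∀ {n} T (c : Clause n) → (∀ p → litHit T c p ≡ true) → clauseHit T c ≡ true
clauseHit-intro T (_ ∷ _ ∷ _ ∷ []) h = ∧-intro (∧-intro (h (# 0)) (h (# 1))) (h (# 2))

clauseHit-elim : ∀ {n} T (c : Clause n) → clauseHit T c ≡ true → ∀ p → litHit T c p ≡ true
clauseHit-elim T ((a₀ , v₀) ∷ (a₁ , v₁) ∷ (a₂ , v₂) ∷ []) e = at
  where
  L₀ L₁ : Bool
  L₀ = litFlag (# 0) a₀ (nthMaybe T (toℕ v₀))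
  L₁ = litFlag (# 1) a₁ (nthMaybe T (toℕ v₁))
  at : ∀ p → litHit T ((a₀ , v₀) ∷ (a₁ , v₁) ∷ (a₂ , v₂) ∷ []) p ≡ true
  at zero             = proj₁ (∧-split L₀ (proj₁ (∧-split (L₀ ∧ L₁) e)))
  at (suc zero)       = proj₂ (∧-split L₀ (proj₁ (∧-split (L₀ ∧ L₁) e)))
  at (suc (suc zero)) = proj₂ (∧-split (L₀ ∧ L₁) e)

VAny-elim : ∀ {X : Set} {P : X → Set} {k} {v : Vec X k} → VAny P v → ∃ λ p → P (lookup v p)
VAny-elim (here x)  = zero , x
VAny-elim (there a) with VAny-elim a
... | p , x = suc p , x

VAny-intro : ∀ {X : Set} {P : X → Set} {k} (v : Vec X k) p → P (lookup v p) → VAny P v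
VAny-intro (a ∷ v) zero    x = here x
VAny-intro (a ∷ v) (suc p) x = there (VAny-intro v p x)

extend : ∀ {n} → (Fin n → Bool) → ℕ → Bool
extend {n} a k with k <? n
... | yes l = a (fromℕ< l)
... | no  _ = false

extend-toℕ : ∀ {n} (a : Fin n → Bool) v → extend a (toℕ v) ≡ a v
extend-toℕ {n} a v with toℕ v <? n
... | yes l = cong a (Fin.fromℕ<-toℕ v l)
... | no nl = ⊥-elim (nl (Fin.toℕ<n v))

kind : Fin 9 → Fin 3
kind zero                                                  = # 0
kind (suc zero)                                            = # 1
kind (suc (suc zero))                                      = # 2
kind (suc (suc (suc zero)))                                = # 0
kind (suc (suc (suc (suc zero))))                          = # 1
kind (suc (suc (suc (suc (suc zero)))))                    = # 2
kind (suc (suc (suc (suc (suc (suc zero))))))              = # 0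
kind (suc (suc (suc (suc (suc (suc (suc zero)))))))        = # 1
kind (suc (suc (suc (suc (suc (suc (suc (suc zero))))))))  = # 2

data KindView : Fin 9 → Set where
  isX : ∀ p → KindView (xk p)
  isY : ∀ p → KindView (yk p)
  isD : ∀ p → KindView (dk p)

kindView : ∀ c → KindView c
kindView zero                                                 = isX (# 0)
kindView (suc zero)                                           = isX (# 1)
kindView (suc (suc zero))                                     = isX (# 2)
kindView (suc (suc (suc zero)))                               = isY (# 0)
kindView (suc (suc (suc (suc zero))))                         = isY (# 1)
kindView (suc (suc (suc (suc (suc zero)))))                   = isY (# 2)
kindView (suc (suc (suc (suc (suc (suc zero))))))             = isD (# 0)
kindView (suc (suc (suc (suc (suc (suc (suc zero)))))))       = isD (# 1)
kindView (suc (suc (suc (suc (suc (suc (suc (suc zero)))))))) = isD (# 2)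

kind-xk : ∀ p → kind (xk p) ≡ p
kind-xk zero             = refl
kind-xk (suc zero)       = refl
kind-xk (suc (suc zero)) = refl

kind-yk : ∀ p → kind (yk p) ≡ p
kind-yk zero             = refl
kind-yk (suc zero)       = refl
kind-yk (suc (suc zero)) = refl

kind-dk : ∀ p → kind (dk p) ≡ p
kind-dk zero             = refl
kind-dk (suc zero)       = refl
kind-dk (suc (suc zero)) = refl

yKind : Fin 9 → Bool
yKind (suc (suc (suc zero)))             = true
yKind (suc (suc (suc (suc zero))))       = true
yKind (suc (suc (suc (suc (suc zero))))) = true
yKind _                                  = false

yKind-xk : ∀ p → yKind (xk p) ≡ false
yKind-xk zero             = refl
yKind-xk (suc zero)       = refl
yKind-xk (suc (suc zero)) = refl

yKind-yk : ∀ p → yKind (yk p) ≡ true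
yKind-yk zero             = refl
yKind-yk (suc zero)       = refl
yKind-yk (suc (suc zero)) = refl

yKind-dk : ∀ p → yKind (dk p) ≡ false
yKind-dk zero             = refl
yKind-dk (suc zero)       = refl
yKind-dk (suc (suc zero)) = refl

-- Correctness of the reduction

module Reduction {n : ℕ} (b : ℕ) (φ : CNF3 n) (fits : n ≤ b * 2 ^ b) where

  m : ℕ
  m = 2 ^ b

  instance
    m-nonZero : NonZero m
    m-nonZero = m^n≢0 2 b

  Var : Set
  Var = Fin (m * 9)

  atVar : (Fin m × Fin 9 → Bool) → Var → Bool
  atVar h v = h (remQuot {m} 9 v)

  at-combine : ∀ h (i : Fin m) (c : Fin 9) → atVar h (combine i c) ≡ h (i , c)
  at-combine h i c = cong h (Fin.remQuot-combine i c)

  Matches : (ℕ → Col) → (Var → Bool) → Set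
  Matches g x = ∀ (i : Fin m) (c : Fin 9) → g (toℕ i) ! c ≡ x (combine i c)

  colAt-matches : ∀ (j : Fin (2 ^ (m * 9))) → Matches (colAt (toℕ j)) (assign j)
  colAt-matches j i c = trans (lookup∘tabulate (λ c → bit (toℕ j) (9 * toℕ i + toℕ c)) c)
                              (cong (bit (toℕ j)) (sym (Fin.toℕ-combine i c)))

  rowOf : (Var → Bool) → Fin (2 ^ (m * 9))
  rowOf x = fromℕ< (fromBits-< (m * 9) (extend x))

  assign-rowOf : ∀ x v → assign (rowOf x) v ≡ x v
  assign-rowOf x v = trans (cong (λ k → bit k (toℕ v)) (Fin.toℕ-fromℕ< (fromBits-< (m * 9) (extend x))))
    (trans (bit-fromBits (m * 9) (extend x) (toℕ v) (Fin.toℕ<n v)) (extend-toℕ x v))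

  set : (ℕ → Col) → List Col
  set g = applyUpTo g m

  val : (ℕ → Col) → PVal
  val g = rowVal b φ (set g)

  flag-intro : ∀ {g} k (i : Fin m) → props (g (toℕ i)) ! k ≡ true → flags (set g) ! k ≡ true
  flag-intro {g} k i e = flags-intro g m k (toℕ i) (Fin.toℕ<n i) e

  flag-elim : ∀ {g} k → flags (set g) ! k ≡ true → ∃ λ (i : Fin m) → props (g (toℕ i)) ! k ≡ true
  flag-elim {g} k e with flags-elim g m k e
  ... | i , l , e′ = fromℕ< l , trans (cong (λ z → props (g z) ! k) (Fin.toℕ-fromℕ< l)) e′

  flag-false : ∀ {g} k → (∀ (i : Fin m) → props (g (toℕ i)) ! k ≡ true → ⊥) → flags (set g) ! k ≡ false
  flag-false {g} k h = ¬-not (λ e → let (i , e′) = flag-elim {g} k e in h i e′)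

  module Lit (c : Clause n) (p : Fin 3) where
    var : Fin n
    var = proj₂ (lookup c p)
    pol : Bool
    pol = proj₁ (lookup c p)
    bitNo grp : ℕ
    bitNo = toℕ var / m
    grp   = toℕ var % m
    grp< : grp < m
    grp< = m%n<n (toℕ var) m
    bitNo< : bitNo < b
    bitNo< = m<n*o⇒m/o<n (<-≤-trans (Fin.toℕ<n var) fits)
    var≡ : toℕ var ≡ bitNo * m + grp
    var≡ = trans (m≡m%n+[m/n]*n (toℕ var) m) (+-comm grp (bitNo * m))
    grpF : Fin m
    grpF = fromℕ< grp<
    toℕ-grpF : toℕ grpF ≡ grp
    toℕ-grpF = Fin.toℕ-fromℕ< grp<

  litHit-intro : ∀ g c p → let open Lit c p in g grp ! xk p ≡ true → Covers g b bitNo pol (yk p) →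
    litHit (table b (set g) (set g)) c p ≡ true
  litHit-intro g c p ex cov = trans (cong (λ z → litFlag p pol (nthMaybe (table b (set g) (set g)) z)) var≡)
    (Table.table-intro g m b g bitNo grp p pol bitNo< grp< ex cov)
    where open Lit c p

  litHit-elim : ∀ g c p → let open Lit c p in litHit (table b (set g) (set g)) c p ≡ true →
    g grp ! xk p ≡ true × Covers g b bitNo pol (yk p)
  litHit-elim g c p e = Table.table-elim g m b g bitNo grp p pol bitNo< grp<
    (trans (cong (λ z → litFlag p pol (nthMaybe (table b (set g) (set g)) z)) (sym var≡)) e)
    where open Lit c p

  module Forward (a : Fin n → Bool) (sat : All (λ c → VAny (λ l → a (proj₂ l) ≡ proj₁ l) c) φ) where

    value# : ℕ → ℕ
    value# i = fromBits b (λ r → extend a (r * m + i))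

    valueOf : Fin m → Fin m
    valueOf i = fromℕ< (fromBits-< b (λ r → extend a (r * m + toℕ i)))

    toℕ-valueOf : ∀ i → toℕ (valueOf i) ≡ value# (toℕ i)
    toℕ-valueOf i = Fin.toℕ-fromℕ< (fromBits-< b (λ r → extend a (r * m + toℕ i)))

    ηOf : Fin m × Fin 3 → Var
    ηOf (j , p) = combine j (yk p)

    dOf : Fin m × Fin 3 → Var
    dOf (j , p) = combine j (dk p)

    xOf : Fin m × Fin 3 → Var
    xOf (j , p) = combine j (xk p)

    ρOf : Fin m × Fin 9 → Fin (m * 3)
    ρOf (i , c) = combine (valueOf i) (kind c)

    η d xv : Fin (m * 3) → Var
    η k  = ηOf (remQuot 3 k)
    d k  = dOf (remQuot 3 k)
    xv k = xOf (remQuot 3 k)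

    ρ : Var → Fin (m * 3)
    ρ v = ρOf (remQuot 9 v)

    open Groups η d ρ

    js : List (Fin (m * 3))
    js = allFin (m * 3)

    xs : List Var
    xs = map xv js

    f : (Var → Bool) → Bool
    f = runEntry (chain xs js)

    f-value : ∀ x → f x ≡ some (value xs x) js
    f-value = run-chain xs js

    f-D : ∀ x j p → x (combine j (dk p)) ≡ true → x (combine j (yk p)) ≡ true → f x ≡ true
    f-D x j p e e′ = trans (f-value x) (value-dummy xs {x} {combine j p}
      (trans (cong (λ z → x (dOf z)) (Fin.remQuot-combine j p)) e)
      (trans (cong (λ z → x (ηOf z)) (Fin.remQuot-combine j p)) e′))

    f-X : ∀ x i p → x (combine i (xk p)) ≡ true → x (combine (valueOf i) (yk p)) ≡ true → f x ≡ true
    f-X x i p e e′ = trans (f-value x) (value-member xs {x} {combine i (xk p)} mem e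
      (trans (cong x η≡) e′))
      where
      mem : combine i (xk p) ∈ xs
      mem = subst (_∈ xs) (cong xOf (Fin.remQuot-combine i p)) (∈-map⁺ xv (∈-allFin (combine i p)))
      η≡ : η (ρ (combine i (xk p))) ≡ combine (valueOf i) (yk p)
      η≡ = trans (cong (λ z → η (ρOf z)) (Fin.remQuot-combine i (xk p)))
             (trans (cong ηOf (Fin.remQuot-combine (valueOf i) (kind (xk p))))
                    (cong (λ q → combine (valueOf i) (yk q)) (kind-xk p)))

    f-elim : ∀ x → f x ≡ true → ∃₂ λ (j : Fin m) p → x (combine j (yk p)) ≡ true ×
      (x (combine j (dk p)) ≡ true ⊎ ∃₂ λ (i : Fin m) q → x (combine i (xk q)) ≡ true)
    f-elim x e with value-elim xs x (trans (sym (f-value x)) e)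
    ... | k , ey , inj₁ ed = proj₁ (remQuot {m} 3 k) , proj₂ (remQuot {m} 3 k) , ey , inj₁ ed
    ... | k , ey , inj₂ (i , mem , ei , _) with ∈-map⁻ xv mem
    ...   | k′ , _ , refl = proj₁ (remQuot {m} 3 k) , proj₂ (remQuot {m} 3 k) , ey ,
                            inj₂ (proj₁ (remQuot {m} 3 k′) , proj₂ (remQuot {m} 3 k′) , ei)

    module _ (g : ℕ → Col) (x : Var → Bool) (match : Matches g x) where

      -- A 1 has three possible causes: a dummy together with its Y; a pair, where the value of the
      -- common index is covered in one of the two copies; or a clause, where a true literal at
      -- place `p` supplies the match in copy `p`.
      sound₁ : val g ≡ p1 → f x ≡ true
      sound₁ e with verdict-p1 (flags (set g)) _ (trans (sym (rowVal-def b φ (set g))) e)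
      ... | inj₁ (_ , e₂) with flag-elim {g} (# 2) e₂
      ...   | i , e′ with anyDY-elim (g (toℕ i)) e′
      ...     | p , ed , ey = f-D x i p (trans (sym (match i (dk p))) ed) (trans (sym (match i (yk p))) ey)
      sound₁ e | inj₂ e′ with ∨-split (pairs (flags (set g))) e′
      ... | inj₁ pr with pairs-elim (flags (set g)) pr
      ...   | k , ec , eu with flag-elim {g} (commonFlag k) ec
      ...     | i , e″ with common-elim k (g (toℕ i)) e″
      ...       | el , er with ∨-split (g (toℕ (valueOf i)) ! yk (pairˡ k)) cover
        where
        cover : g (toℕ (valueOf i)) ! yk (pairˡ k) ∨ g (toℕ (valueOf i)) ! yk (pairʳ k) ≡ true
        cover with bool-dec (g (toℕ (valueOf i)) ! yk (pairˡ k) ∨ g (toℕ (valueOf i)) ! yk (pairʳ k))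
        ... | inj₁ t = t
        ... | inj₂ t = ⊥-elim (true≢false (trans (sym (flag-intro {g} (uncoveredFlag k) (valueOf i)
                         (trans (uncovered k (g (toℕ (valueOf i)))) (not-false t)))) eu))
      ...         | inj₁ ey = f-X x i (pairˡ k) (trans (sym (match i _)) el) (trans (sym (match (valueOf i) _)) ey)
      ...         | inj₂ ey = f-X x i (pairʳ k) (trans (sym (match i _)) er) (trans (sym (match (valueOf i) _)) ey)
      sound₁ e | inj₂ e′ | inj₂ hit with formulaHit-elim (table b (set g) (set g)) false φ hit
      ... | inj₁ ()
      ... | inj₂ (c , mem , ch) with VAny-elim (All.lookup sat mem)
      ...   | p , ap with litHit-elim g c p (clauseHit-elim (table b (set g) (set g)) c ch p)
      ...     | ex , cov = f-X x grpF p (trans (sym (match grpF (xk p))) (trans (cong (λ z → g z ! xk p) toℕ-grpF) ex))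
                 (trans (sym (match (valueOf grpF) (yk p))) (cov _ (Fin.toℕ<n (valueOf grpF)) bits))
        where
        open Lit c p
        bits : bit (toℕ (valueOf grpF)) bitNo ≡ pol
        bits = begin
          bit (toℕ (valueOf grpF)) bitNo       ≡⟨ cong (λ z → bit z bitNo) (toℕ-valueOf grpF) ⟩
          bit (value# (toℕ grpF)) bitNo        ≡⟨ bit-fromBits b _ bitNo bitNo< ⟩
          extend a (bitNo * m + toℕ grpF)      ≡⟨ cong (λ z → extend a (bitNo * m + z)) toℕ-grpF ⟩
          extend a (bitNo * m + grp)           ≡⟨ cong (extend a) (sym var≡) ⟩
          extend a (toℕ var)                   ≡⟨ extend-toℕ a var ⟩
          a var                                ≡⟨ ap ⟩
          pol                                  ∎
          where open ≡-Reasoning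

      sound₀ : val g ≡ p0 → f x ≡ false
      sound₀ e = ¬-not contra
        where
        contra : f x ≡ true → ⊥
        contra t with f-elim x t
        ... | j , p , ey , rest with verdict-p0 (flags (set g)) _ (trans (sym (rowVal-def b φ (set g))) e)
        ...   | inj₁ e₁ = true≢false (trans (sym (flag-intro {g} (# 1) j (anyY-intro (g (toℕ j)) p (trans (match j (yk p)) ey)))) e₁)
        ...   | inj₂ (e₀ , e₂) with rest
        ...     | inj₁ ed = true≢false (trans (sym (flag-intro {g} (# 2) j
                    (anyDY-intro (g (toℕ j)) p (trans (match j (dk p)) ed) (trans (match j (yk p)) ey)))) e₂)
        ...     | inj₂ (i , q , ex) = true≢false (trans (sym (flag-intro {g} (# 0) i (anyX-intro (g (toℕ i)) q (trans (match i (xk q)) ex)))) e₀)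

    extends : Extends (instanceOf b φ) f
    extends j =
      (λ e → sound₀ (colAt (toℕ j)) (assign j) (colAt-matches j) (trans (sym (lookup-instanceOf b φ j)) e)) ,
      (λ e → sound₁ (colAt (toℕ j)) (assign j) (colAt-matches j) (trans (sym (lookup-instanceOf b φ j)) e))

    length-js : length js ≡ m * 3
    length-js = length-tabulate {n = m * 3} (λ i → i)

    size≢0 : size xs js ≢ 0
    size≢0 e = m<n⇒n≢0 (*-monoˡ-< 3 (>-nonZero⁻¹ m)) (trans (sym length-js) (empty js e))
      where
      empty : ∀ js → size xs js ≡ 0 → length js ≡ 0
      empty []       e = refl
      empty (j ∷ js) e with trans (sym (+-suc (length (members xs j)) _)) e
      ... | ()

    size≤ : size xs js ≤ m * 9
    size≤ = begin
      size xs js                  ≤⟨ size-bound xs js (allFin⁺ (m * 3)) ⟩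
      length xs + length js * 2   ≡⟨ cong₂ (λ u w → u + w * 2) (trans (length-map xv js) length-js) length-js ⟩
      m * 3 + m * 3 * 2           ≡⟨ cong (m * 3 +_) (*-assoc m 3 2) ⟩
      m * 3 + m * 6               ≡⟨ sym (*-distribˡ-+ m 3 6) ⟩
      m * 9                       ∎
      where open ≤-Reasoning

    realisable : MBPSP* (m * 9) (instanceOf b φ) (m * 9)
    realisable with toBP (chain xs js) (good-chain xs js) size≢0
    ... | k , e , B , comp = f , extends , k , ≤-trans (≤-reflexive e) size≤ , B , comp

  forward : Satisfiable φ → MBPSP* (m * 9) (instanceOf b φ) (m * 9)
  forward (a , sat) = Forward.realisable a sat

  isYVar : Var → Bool
  isYVar v = yKind (proj₂ (remQuot {m} 9 v))

  isYVar-combine : ∀ (i : Fin m) c → isYVar (combine i c) ≡ yKind c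
  isYVar-combine i c = cong (λ z → yKind (proj₂ z)) (Fin.remQuot-combine i c)

  dummyOf : Fin m × Fin 9 → Var
  dummyOf (i , c) = combine i (dk (kind c))

  dVar : Var → Var
  dVar v = dummyOf (remQuot {m} 9 v)

  dVar-yk : ∀ (i : Fin m) p → dVar (combine i (yk p)) ≡ combine i (dk p)
  dVar-yk i p = trans (cong dummyOf (Fin.remQuot-combine i (yk p))) (cong (λ q → combine i (dk q)) (kind-yk p))

  data VarView : Var → Set where
    X : ∀ (i : Fin m) p → VarView (combine i (xk p))
    Y : ∀ (i : Fin m) p → VarView (combine i (yk p))
    D : ∀ (i : Fin m) p → VarView (combine i (dk p))

  varView : ∀ v → VarView v
  varView v = subst VarView (Fin.combine-remQuot {m} 9 v) (view (proj₁ (remQuot {m} 9 v)) (kindView (proj₂ (remQuot {m} 9 v))))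
    where
    view : ∀ (i : Fin m) {c} → KindView c → VarView (combine i c)
    view i (isX p) = X i p
    view i (isY p) = Y i p
    view i (isD p) = D i p

  isY-X : ∀ (i : Fin m) p → isYVar (combine i (xk p)) ≡ false
  isY-X i p = trans (isYVar-combine i (xk p)) (yKind-xk p)

  isY-Y : ∀ (i : Fin m) p → isYVar (combine i (yk p)) ≡ true
  isY-Y i p = trans (isYVar-combine i (yk p)) (yKind-yk p)

  isY-D : ∀ (i : Fin m) p → isYVar (combine i (dk p)) ≡ false
  isY-D i p = trans (isYVar-combine i (dk p)) (yKind-dk p)

  clashᵇ : ∀ {A : Set} {z : Bool} → z ≡ true → z ≡ false → A
  clashᵇ e e′ = ⊥-elim (true≢false (trans (sym e) e′))

  same-kind : ∀ {i j : Fin m} {c c′ : Fin 9} → combine i c ≡ combine j c′ → i ≡ j × c ≡ c′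
  same-kind {i} {j} {c} {c′} e = Fin.combine-injective i c j c′ e

  X≢D : ∀ {i j : Fin m} p q → combine i (xk p) ≢ combine j (dk q)
  X≢D {i} {j} p q e = disjoint p q (proj₂ (same-kind {i} {j} e))
    where
    disjoint : ∀ p q → xk p ≢ dk q
    disjoint zero             zero             ()
    disjoint zero             (suc zero)       ()
    disjoint zero             (suc (suc zero)) ()
    disjoint (suc zero)       zero             ()
    disjoint (suc zero)       (suc zero)       ()
    disjoint (suc zero)       (suc (suc zero)) ()
    disjoint (suc (suc zero)) zero             ()
    disjoint (suc (suc zero)) (suc zero)       ()
    disjoint (suc (suc zero)) (suc (suc zero)) ()

  dk-injective : ∀ {p q} → dk p ≡ dk q → p ≡ q
  dk-injective {p} {q} e = trans (sym (kind-dk p)) (trans (cong kind e) (kind-dk q))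

  yk-injective : ∀ {p q} → yk p ≡ yk q → p ≡ q
  yk-injective {p} {q} e = trans (sym (kind-yk p)) (trans (cong kind e) (kind-yk q))

  twice : Fin 3 → Fin 5
  twice zero             = # 0
  twice (suc zero)       = # 1
  twice (suc (suc zero)) = # 2

  twiceˡ : ∀ p → pairˡ (twice p) ≡ p
  twiceˡ zero             = refl
  twiceˡ (suc zero)       = refl
  twiceˡ (suc (suc zero)) = refl

  twiceʳ : ∀ p → pairʳ (twice p) ≡ p
  twiceʳ zero             = refl
  twiceʳ (suc zero)       = refl
  twiceʳ (suc (suc zero)) = refl

  pair-hit : ∀ {g} k (i : Fin m) → g (toℕ i) ! xk (pairˡ k) ≡ true → g (toℕ i) ! xk (pairʳ k) ≡ true →
    (∀ (j : Fin m) → g (toℕ j) ! yk (pairˡ k) ∨ g (toℕ j) ! yk (pairʳ k) ≡ true) → pairs (flags (set g)) ≡ true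
  pair-hit {g} k i el er cov = pairs-intro k (flags (set g)) (flag-intro {g} (commonFlag k) i (common-intro k (g (toℕ i)) el er))
    (flag-false {g} (uncoveredFlag k) (λ j e → true≢false (trans (sym (cov j)) (not-true _ (trans (sym (uncovered k (g (toℕ j)))) e)))))

  hitIn : (ℕ → Col) → Bool
  hitIn g = formulaHit (table b (set g) (set g)) false φ

  val-noY : ∀ g → flags (set g) ! # 1 ≡ false → val g ≡ p0
  val-noY g e = trans (rowVal-def b φ (set g)) (verdict-noY (flags (set g)) (hitIn g) e)

  val-noX : ∀ g → flags (set g) ! # 0 ≡ false → flags (set g) ! # 2 ≡ false → val g ≡ p0
  val-noX g e e′ = trans (rowVal-def b φ (set g)) (verdict-noX (flags (set g)) (hitIn g) e e′)

  val-D : ∀ g → flags (set g) ! # 1 ≡ true → flags (set g) ! # 0 ≡ false → flags (set g) ! # 2 ≡ true → val g ≡ p1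
  val-D g e₁ e₀ e₂ = trans (rowVal-def b φ (set g)) (verdict-D (flags (set g)) (hitIn g) e₁ e₀ e₂)

  val-X : ∀ g → flags (set g) ! # 1 ≡ true → flags (set g) ! # 0 ≡ true → pairs (flags (set g)) ∨ hitIn g ≡ true → val g ≡ p1
  val-X g e₁ e₀ e = trans (rowVal-def b φ (set g)) (verdict-X (flags (set g)) (hitIn g) e₁ e₀ e)

  module Decode (f : (Var → Bool) → Bool) (f₁ : ∀ x → (∀ g → Matches g x → val g ≡ p1) → f x ≡ true)
    (ρ : Var → Var)
    (matched : ∀ u → f u ≡ true → ∃ λ i → isYVar i ≡ false × u i ≡ true × isYVar (ρ i) ≡ true × u (ρ i) ≡ true) where

    -- Test inputs have all dummies off, so that a matched pair found in them starts at a variable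
    -- `X_p i`.
    byKind : (Fin m → Fin 3 → Bool) → (Fin m → Fin 3 → Bool) → ∀ (i : Fin m) {c} → KindView c → Bool
    byKind hx hy i (isX p) = hx i p
    byKind hx hy i (isY p) = hy i p
    byKind hx hy i (isD p) = false

    test : (Fin m → Fin 3 → Bool) → (Fin m → Fin 3 → Bool) → Fin m × Fin 9 → Bool
    test hx hy (i , c) = byKind hx hy i (kindView c)

    test-X : ∀ hx hy i p → test hx hy (i , xk p) ≡ hx i p
    test-X hx hy i zero             = refl
    test-X hx hy i (suc zero)       = refl
    test-X hx hy i (suc (suc zero)) = refl

    test-Y : ∀ hx hy i p → test hx hy (i , yk p) ≡ hy i p
    test-Y hx hy i zero             = refl
    test-Y hx hy i (suc zero)       = refl
    test-Y hx hy i (suc (suc zero)) = refl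

    test-D : ∀ hx hy i p → test hx hy (i , dk p) ≡ false
    test-D hx hy i zero             = refl
    test-D hx hy i (suc zero)       = refl
    test-D hx hy i (suc (suc zero)) = refl

    Result : (Fin m → Fin 3 → Bool) → (Fin m → Fin 3 → Bool) → Set
    Result hx hy = ∃₂ λ i p → ∃₂ λ j q → hx i p ≡ true × ρ (combine i (xk p)) ≡ combine j (yk q) × hy j q ≡ true

    abstract
      -- This is how information about `ρ` is extracted: if the row of a test input is 1, the input
      -- is accepted, and so `ρ` sends one of its X-variables to one of its Y-variables.
      probe : ∀ hx hy → (∃₂ λ i p → hx i p ≡ true) → (∃₂ λ j q → hy j q ≡ true) →
        (∀ g → (∀ i p → g (toℕ i) ! xk p ≡ hx i p) → (∀ j q → g (toℕ j) ! yk q ≡ hy j q) →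
          pairs (flags (set g)) ∨ hitIn g ≡ true) →
        Result hx hy
      probe hx hy (i₀ , p₀ , e₀) (j₀ , q₀ , e₁) h with matched u accepted
        where
        u : Var → Bool
        u v = atVar (test hx hy) v
        accepted : f u ≡ true
        accepted = f₁ u λ g match →
          let gX = λ i p → trans (match i (xk p)) (trans (at-combine (test hx hy) i (xk p)) (test-X hx hy i p))
              gY = λ j q → trans (match j (yk q)) (trans (at-combine (test hx hy) j (yk q)) (test-Y hx hy j q))
          in val-X g
               (flag-intro {g} (# 1) j₀ (anyY-intro (g (toℕ j₀)) q₀ (trans (gY j₀ q₀) e₁)))
               (flag-intro {g} (# 0) i₀ (anyX-intro (g (toℕ i₀)) p₀ (trans (gX i₀ p₀) e₀)))
               (h g gX gY)
      ... | v , xv , uv , yρ , uρ = decode (varView v) xv uv (varView (ρ v)) refl yρ uρ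
        where
        decode : ∀ {v w} → VarView v → isYVar v ≡ false → atVar (test hx hy) v ≡ true →
          VarView w → ρ v ≡ w → isYVar w ≡ true → atVar (test hx hy) w ≡ true →
          Result hx hy
        decode (X i p) xv uv (Y j q) e yw uw = i , p , j , q ,
          trans (sym (trans (at-combine (test hx hy) i (xk p)) (test-X hx hy i p))) uv , e ,
          trans (sym (trans (at-combine (test hx hy) j (yk q)) (test-Y hx hy j q))) uw
        decode (X i p) xv uv (X j q) e yw uw = clashᵇ yw (isY-X j q)
        decode (X i p) xv uv (D j q) e yw uw = clashᵇ yw (isY-D j q)
        decode (Y i p) xv uv w e yw uw = clashᵇ (isY-Y i p) xv
        decode (D i p) xv uv w e yw uw = clashᵇ (trans (sym (at-combine (test hx hy) i (dk p))) uv) (test-D hx hy i p)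

    abstract
      -- The test input has only `X_p i` and all of `Y_p` on, which leaves no other place for the
      -- match.
      own : ∀ p (i : Fin m) → ∃ λ (j : Fin m) → ρ (combine i (xk p)) ≡ combine j (yk p)
      own p i = decode (probe hx hy (i , p , xp) (i , p , is-same p) hitting)
        where
        hx hy : Fin m → Fin 3 → Bool
        hx i′ p′ = is i i′ ∧ is p p′
        hy _ q = is p q
        xp : hx i p ≡ true
        xp = ∧-intro (is-same i) (is-same p)
        hitting : ∀ g → (∀ i p → g (toℕ i) ! xk p ≡ hx i p) → (∀ j q → g (toℕ j) ! yk q ≡ hy j q) →
          pairs (flags (set g)) ∨ hitIn g ≡ true
        hitting g gX gY = ∨-introˡ (pair-hit {g} (twice p) i
          (trans (cong (λ q → g (toℕ i) ! xk q) (twiceˡ p)) (trans (gX i p) xp))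
          (trans (cong (λ q → g (toℕ i) ! xk q) (twiceʳ p)) (trans (gX i p) xp))
          (λ j → ∨-introˡ (trans (cong (λ q → g (toℕ j) ! yk q) (twiceˡ p)) (trans (gY j p) (is-same p)))))
        decode : Result hx hy → ∃ λ (j : Fin m) → ρ (combine i (xk p)) ≡ combine j (yk p)
        decode (i′ , p′ , j , q , ex , e , ey) = j ,
          subst₂ (λ (i″ : Fin m) p″ → ρ (combine i″ (xk p″)) ≡ combine j (yk p)) (is-true {j = i} {i′} (proj₁ (∧-split (is i i′) ex)))
            (is-true {j = p} {p′} (proj₂ (∧-split (is i i′) ex)))
            (trans e (cong (λ q″ → combine j (yk q″)) (is-true {j = p} {q} ey)))

    value : Fin 3 → Fin m → Fin m
    value p i = proj₁ (own p i)

    ρ-value : ∀ {i : Fin m} {p} {j : Fin m} {q} → ρ (combine i (xk p)) ≡ combine j (yk q) → j ≡ value p i × q ≡ p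
    ρ-value {i} {p} {j} {q} e = proj₁ k , yk-injective (proj₂ k)
      where
      k : j ≡ value p i × yk q ≡ yk p
      k = same-kind {j} {value p i} {yk q} {yk p} (trans (sym e) (proj₂ (own p i)))

    -- On are `X_l i` and `X_r i`, all of `Y_l` except at `j = value l i`, and `Y_r` at `j` only.
    -- The pair rule makes the row 1, copy `l` cannot supply the match, and copy `r` can do so only
    -- at `j`.
    value-agree : ∀ k → pairˡ k ≢ pairʳ k → ∀ i → value (pairʳ k) i ≡ value (pairˡ k) i
    value-agree k l≢r i = decode (probe hx hy (i , l , xl) (j , r , yr) hitting)
      where
      l r : Fin 3
      l = pairˡ k
      r = pairʳ k
      j : Fin m
      j = value l i
      hx hy : Fin m → Fin 3 → Bool
      hx i′ p = is i i′ ∧ (is l p ∨ is r p)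
      hy j′ q = (is l q ∧ not (is j j′)) ∨ (is r q ∧ is j j′)
      xl : hx i l ≡ true
      xl = ∧-intro (is-same i) (∨-introˡ (is-same l))
      xr : hx i r ≡ true
      xr = ∧-intro (is-same i) (∨-introʳ (is l r) (is-same r))
      yr : hy j r ≡ true
      yr = ∨-introʳ (is l r ∧ not (is j j)) (∧-intro (is-same r) (is-same j))
      cover : ∀ j′ → hy j′ l ∨ hy j′ r ≡ true
      cover j′ with bool-dec (is j j′)
      ... | inj₁ e = ∨-introʳ (hy j′ l) (∨-introʳ (is l r ∧ not (is j j′)) (∧-intro (is-same r) e))
      ... | inj₂ e = ∨-introˡ (∨-introˡ (∧-intro (is-same l) (not-false e)))
      hitting : ∀ g → (∀ i p → g (toℕ i) ! xk p ≡ hx i p) → (∀ j q → g (toℕ j) ! yk q ≡ hy j q) →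
        pairs (flags (set g)) ∨ hitIn g ≡ true
      hitting g gX gY = ∨-introˡ (pair-hit {g} k i (trans (gX i l) xl) (trans (gX i r) xr)
        (λ j′ → trans (cong₂ _∨_ (gY j′ l) (gY j′ r)) (cover j′)))
      at-l : hy j l ≡ true → ⊥
      at-l ey with ∨-split (is l l ∧ not (is j j)) ey
      ... | inj₁ z = clashᵇ (is-same j) (not-true (is j j) (proj₂ (∧-split (is l l) z)))
      ... | inj₂ z = l≢r (is-true {j = r} {l} (proj₁ (∧-split (is r l) z)))
      at-r : ∀ j′ → hy j′ r ≡ true → j′ ≡ j
      at-r j′ ey with ∨-split (is l r ∧ not (is j j′)) ey
      ... | inj₁ z = ⊥-elim (l≢r (sym (is-true {j = l} {r} (proj₁ (∧-split (is l r) z)))))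
      ... | inj₂ z = is-true {j = j} {j′} (proj₂ (∧-split (is r r) z))
      decode′ : ∀ {i′ p j′ q} → i′ ≡ i → (is l p ≡ true ⊎ is r p ≡ true) → j′ ≡ value p i′ → q ≡ p → hy j′ q ≡ true →
        value r i ≡ j
      decode′ {i′} {p} {j′} {q} e (inj₁ pl) ej eq ey = ⊥-elim (at-l (subst₂ (λ a c → hy a c ≡ true)
        (trans ej (cong₂ value p≡l e)) (trans eq p≡l) ey))
        where
        p≡l : p ≡ l
        p≡l = is-true {j = l} {p} pl
      decode′ {i′} {p} {j′} {q} e (inj₂ pr) ej eq ey = at-r (value r i) (subst₂ (λ a c → hy a c ≡ true)
        (trans ej (cong₂ value p≡r e)) (trans eq p≡r) ey)
        where
        p≡r : p ≡ r
        p≡r = is-true {j = r} {p} pr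
      decode : Result hx hy → value r i ≡ j
      decode (i′ , p , j′ , q , ex , e , ey) = decode′ {i′} {p} {j′} {q} (is-true {j = i} {i′} (proj₁ (∧-split (is i i′) ex)))
        (∨-split (is l p) (proj₂ (∧-split (is i i′) ex))) (proj₁ (ρ-value {i′} {p} {j′} {q} e)) (proj₂ (ρ-value {i′} {p} {j′} {q} e)) ey

    value-0 : ∀ p i → value p i ≡ value (# 0) i
    value-0 zero             i = refl
    value-0 (suc zero)       i = value-agree (# 3) (λ ()) i
    value-0 (suc (suc zero)) i = value-agree (# 4) (λ ()) i

    assignment : Fin n → Bool
    assignment v = bit (toℕ (value (# 0) (fromℕ< (m%n<n (toℕ v) m)))) (toℕ v / m)

    -- In each copy `p` the test input has the index of literal `p` on and exactly those values that
    -- make this literal true. The match found therefore names a true literal.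
    clause-true : ∀ c → c ∈ φ → VAny (λ l → assignment (proj₂ l) ≡ proj₁ l) c
    clause-true c mem = decode (probe hx hy (Lit.grpF c (# 0) , # 0 , is-same (Lit.grpF c (# 0)))
                                  (j₀ , # 0 , hy-true j₀ (# 0) j₀-bit) hitting)
      where
      hx hy : Fin m → Fin 3 → Bool
      hx i p = is (Lit.grpF c p) i
      hy j q = does (bit (toℕ j) (Lit.bitNo c q) ≟ᵇ Lit.pol c q)
      hy-true : ∀ j q → bit (toℕ j) (Lit.bitNo c q) ≡ Lit.pol c q → hy j q ≡ true
      hy-true j q e = dec-true (_ ≟ᵇ _) e
      -- The row must contain some Y; the value with all bits equal to the polarity of the first
      -- literal provides one.
      bound : fromBits b (λ _ → Lit.pol c (# 0)) < m
      bound = fromBits-< b (λ _ → Lit.pol c (# 0))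
      j₀ : Fin m
      j₀ = fromℕ< bound
      j₀-bit : bit (toℕ j₀) (Lit.bitNo c (# 0)) ≡ Lit.pol c (# 0)
      j₀-bit = trans (cong (λ z → bit z (Lit.bitNo c (# 0))) (Fin.toℕ-fromℕ< bound))
                     (bit-fromBits b _ (Lit.bitNo c (# 0)) (Lit.bitNo< c (# 0)))
      hitting : ∀ g → (∀ i p → g (toℕ i) ! xk p ≡ hx i p) → (∀ j q → g (toℕ j) ! yk q ≡ hy j q) →
        pairs (flags (set g)) ∨ hitIn g ≡ true
      hitting g gX gY = ∨-introʳ (pairs (flags (set g))) (formulaHit-intro (table b (set g) (set g)) false φ mem
        (clauseHit-intro (table b (set g) (set g)) c lit))
        where
        lit : ∀ p → litHit (table b (set g) (set g)) c p ≡ true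
        lit p = litHit-intro g c p
          (trans (cong (λ z → g z ! xk p) (sym (Lit.toℕ-grpF c p))) (trans (gX (Lit.grpF c p) p) (is-same (Lit.grpF c p))))
          (λ j l e → trans (cong (λ z → g z ! yk p) (sym (Fin.toℕ-fromℕ< l)))
             (trans (gY (fromℕ< l) p) (hy-true (fromℕ< l) p (trans (cong (λ z → bit z (Lit.bitNo c p)) (Fin.toℕ-fromℕ< l)) e))))
      from-does : ∀ x y → does (x ≟ᵇ y) ≡ true → x ≡ y
      from-does true  true  e = refl
      from-does false false e = refl
      decode : Result hx hy → VAny (λ l → assignment (proj₂ l) ≡ proj₁ l) c
      decode (i , p , j , q , ex , e , ey) = VAny-intro c p
        (trans (cong (λ z → bit (toℕ z) (Lit.bitNo c p)) (sym j≡))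
          (from-does (bit (toℕ j) (Lit.bitNo c p)) (Lit.pol c p) (subst (λ q′ → hy j q′ ≡ true) (proj₂ (ρ-value {i} {p} {j} {q} e)) ey)))
        where
        j≡ : j ≡ value (# 0) (Lit.grpF c p)
        j≡ = trans (proj₁ (ρ-value {i} {p} {j} {q} e)) (trans (cong (value p) (is-true {j = Lit.grpF c p} {i} ex)) (value-0 p (Lit.grpF c p)))

    satisfiable : Satisfiable φ
    satisfiable = assignment , All.tabulate (λ {c} mem → clause-true c mem)

  module Backward (f : (Var → Bool) → Bool) (extends : Extends (instanceOf b φ) f)
    {k : ℕ} (small : suc k ≤ m * 9) (B : BP (m * 9) k) (comp : Computes B f) where

    open Evaluation B f comp using (f-ext; readOnce)

    row-match : ∀ x → Matches (colAt (toℕ (rowOf x))) x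
    row-match x i c = trans (colAt-matches (rowOf x) i c) (assign-rowOf x (combine i c))

    f₁ : ∀ x → (∀ g → Matches g x → val g ≡ p1) → f x ≡ true
    f₁ x h = trans (f-ext (λ u → sym (assign-rowOf x u)))
      (proj₂ (extends (rowOf x)) (trans (lookup-instanceOf b φ (rowOf x)) (h _ (row-match x))))

    f₀ : ∀ x → (∀ g → Matches g x → val g ≡ p0) → f x ≡ false
    f₀ x h = trans (f-ext (λ u → sym (assign-rowOf x u)))
      (proj₁ (extends (rowOf x)) (trans (lookup-instanceOf b φ (rowOf x)) (h _ (row-match x))))

    no-X : ∀ x → (∀ v → isYVar v ≡ false → x v ≡ false) → f x ≡ false
    no-X x h = f₀ x λ g match → val-noX g
      (flag-false {g} (# 0) λ i e → let (p , ex) = anyX-elim (g (toℕ i)) e in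
        clashᵇ (trans (sym (match i (xk p))) ex) (h _ (isY-X i p)))
      (flag-false {g} (# 2) λ i e → let (p , ed , _) = anyDY-elim (g (toℕ i)) e in
        clashᵇ (trans (sym (match i (dk p))) ed) (h _ (isY-D i p)))

    no-Y : ∀ x → (∀ v → isYVar v ≡ true → x v ≡ false) → f x ≡ false
    no-Y x h = f₀ x λ g match → val-noY g
      (flag-false {g} (# 1) λ i e → let (p , ey) = anyY-elim (g (toℕ i)) e in
        clashᵇ (trans (sym (match i (yk p))) ey) (h _ (isY-Y i p)))

    dummy-YD : ∀ x (i : Fin m) p → x (combine i (dk p)) ≡ true →
      (∀ v → isYVar v ≡ false → v ≢ combine i (dk p) → x v ≡ false) → f x ≡ x (combine i (yk p))
    dummy-YD x i p xd others with bool-dec (x (combine i (yk p)))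
    ... | inj₁ t = trans (f₁ x λ g match → val-D g
          (flag-intro {g} (# 1) i (anyY-intro (g (toℕ i)) p (trans (match i (yk p)) t)))
          (flag-false {g} (# 0) λ i′ e → let (q , ex) = anyX-elim (g (toℕ i′)) e in
            clashᵇ (trans (sym (match i′ (xk q))) ex) (others _ (isY-X i′ q) (X≢D q p)))
          (flag-intro {g} (# 2) i (anyDY-intro (g (toℕ i)) p (trans (match i (dk p)) xd) (trans (match i (yk p)) t)))) (sym t)
    ... | inj₂ t = trans (f₀ x λ g match → val-noX g
          (flag-false {g} (# 0) λ i′ e → let (q , ex) = anyX-elim (g (toℕ i′)) e in
            clashᵇ (trans (sym (match i′ (xk q))) ex) (others _ (isY-X i′ q) (X≢D q p)))
          (flag-false {g} (# 2) λ i′ e → let (q , ed , ey) = anyDY-elim (g (toℕ i′)) e in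
            noDY i′ q (trans (sym (match i′ (dk q))) ed) (trans (sym (match i′ (yk q))) ey))) (sym t)
      where
      noDY : ∀ (i′ : Fin m) q → x (combine i′ (dk q)) ≡ true → x (combine i′ (yk q)) ≡ true → ⊥
      noDY i′ q ed ey with combine i′ (dk q) Fin.≟ combine i (dk p)
      ... | no ne = clashᵇ ed (others _ (isY-D i′ q) ne)
      ... | yes e = clashᵇ (subst₂ (λ i″ p″ → x (combine i″ (yk p″)) ≡ true) (proj₁ (same-kind {i′} {i} {dk q} {dk p} e))
                            (dk-injective {q} {p} (proj₂ (same-kind {i′} {i} {dk q} {dk p} e))) ey) t

    dummy-Y : ∀ x v → isYVar v ≡ true → x (dVar v) ≡ true →
      (∀ u → isYVar u ≡ false → u ≢ dVar v → x u ≡ false) → f x ≡ x v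
    dummy-Y x v yv xd others with varView v
    ... | X i p = clashᵇ yv (isY-X i p)
    ... | D i p = clashᵇ yv (isY-D i p)
    ... | Y i p rewrite dVar-yk i p = dummy-YD x i p xd others

    all-Y : ∀ x v → isYVar v ≡ false → x v ≡ true → (∀ u → isYVar u ≡ false → u ≢ v → x u ≡ false) →
      (∀ u → isYVar u ≡ true → x u ≡ true) → f x ≡ true
    all-Y x v xv t others ys with varView v
    ... | Y i p = clashᵇ (isY-Y i p) xv
    ... | D i p = f₁ x λ g match → val-D g
          (flag-intro {g} (# 1) i (anyY-intro (g (toℕ i)) p (trans (match i (yk p)) (ys _ (isY-Y i p)))))
          (flag-false {g} (# 0) λ i′ e → let (q , ex) = anyX-elim (g (toℕ i′)) e in
            clashᵇ (trans (sym (match i′ (xk q))) ex) (others _ (isY-X i′ q) (X≢D q p)))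
          (flag-intro {g} (# 2) i (anyDY-intro (g (toℕ i)) p (trans (match i (dk p)) t) (trans (match i (yk p)) (ys _ (isY-Y i p)))))
    ... | X i p = f₁ x λ g match → val-X g
          (flag-intro {g} (# 1) i (anyY-intro (g (toℕ i)) p (trans (match i (yk p)) (ys _ (isY-Y i p)))))
          (flag-intro {g} (# 0) i (anyX-intro (g (toℕ i)) p (trans (match i (xk p)) t)))
          (∨-introˡ (pair-hit {g} (twice p) i
            (trans (cong (λ q → g (toℕ i) ! xk q) (twiceˡ p)) (trans (match i (xk p)) t))
            (trans (cong (λ q → g (toℕ i) ! xk q) (twiceʳ p)) (trans (match i (xk p)) t))
            (λ j → ∨-introˡ (trans (match j _) (ys _ (isY-Y j (pairˡ (twice p))))))))

    dVar-x : ∀ v → isYVar v ≡ true → isYVar (dVar v) ≡ false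
    dVar-x v yv = isY-D (proj₁ (remQuot {m} 9 v)) (kind (proj₂ (remQuot {m} 9 v)))

    -- With all Y-variables on, a variable of type X or D decides between `all-Y` and `no-X`; with
    -- its dummy on, a Y-variable decides between `dummy-Y` and `no-Y`.
    essential : ∀ v → ∃₂ λ x y → (∀ u → u ≢ v → x u ≡ y u) × f x ≢ f y
    essential v with isYVar v in yv
    ... | false = x , y , agree , λ e → clashᵇ (trans (sym e) fx) fy
      where
      x y : Var → Bool
      x u = isYVar u ∨ is v u
      y u = isYVar u
      agree : ∀ u → u ≢ v → x u ≡ y u
      agree u ne rewrite is-other ne with isYVar u
      ... | true  = refl
      ... | false = refl
      fx : f x ≡ true
      fx = all-Y x v yv (∨-introʳ (isYVar v) (is-same v)) (λ u xu ne → trans (agree u ne) xu) (λ u yu → ∨-introˡ yu)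
      fy : f y ≡ false
      fy = no-X y (λ u xu → xu)
    ... | true = x , y , agree , λ e → clashᵇ (trans (sym e) fx) fy
      where
      x y : Var → Bool
      x u = is (dVar v) u ∨ is v u
      y u = is (dVar v) u
      or-false : ∀ {p q} → q ≡ false → p ∨ q ≡ p
      or-false {true}  refl = refl
      or-false {false} refl = refl
      agree : ∀ u → u ≢ v → x u ≡ y u
      agree u ne = or-false (is-other ne)
      xv : x v ≡ true
      xv = ∨-introʳ (is (dVar v) v) (is-same v)
      fx : f x ≡ true
      fx = trans (dummy-Y x v yv (∨-introˡ (is-same (dVar v)))
             (λ u xu ne → trans (agree u (λ { refl → clashᵇ yv xu })) (is-other ne))) xv
      fy : f y ≡ false
      fy = no-Y y (λ u yu → is-other {j = dVar v} {u} (λ { refl → clashᵇ yu (dVar-x v yv) }))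

    satisfiable : Satisfiable φ
    satisfiable = Decode.satisfiable f f₁ ρ matched
      where open Matching (readOnce small essential) isYVar dVar dVar-x no-X no-Y dummy-Y all-Y using (ρ; matched)

  backward : MBPSP* (m * 9) (instanceOf b φ) (m * 9) → Satisfiable φ
  backward (f , extends , k , small , B , comp) = Backward.satisfiable f extends small B comp

-- The program computing the reduction

isZero : ∀ {n} → Vec Bool n → Bool
isZero []          = true
isZero (true ∷ v)  = false
isZero (false ∷ v) = isZero v

decrement : ∀ {n} → Vec Bool n → Vec Bool n
decrement []          = []
decrement (true ∷ v)  = false ∷ v
decrement (false ∷ v) = true ∷ decrement v

module Program (M : TM 4) where

  Letter : Set
  Letter = Sym M

  A : Set
  A = Letter ⊎ Col

  MState : Set
  MState = Fin (suc (TM.states M))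

  raw : Fin 4 → A
  raw i = inj₁ (inSym M i)

  -- `grow` to `dblR` determine `b` and create `2 ^ b` columns; `pad` to `padR`, with `padk` and
  -- `fix`, write the size parameter; `scan` to `revT` compute flags and table of a row; `clause`,
  -- `walk`, `resto` evaluate the formula on it; `endF`, `clrU` emit the entry; `dec`, `decR` pass
  -- to the preceding row; `sim`, `simL`, `simW` run `M`.
  data Q : Set where
    rev cnt grow growB growC growC′ growD dbl dbl1 dblR pad padB padZ padR dec decR : Q
    padk fix           : Fin 8 → Q
    scan copy tab      : Flags → Q
    tab1               : Flags → Col → Q
    split splR app     : Flags → Col → Col → Q
    split1             : Flags → Col → Col → Col → Q
    appR revT          : Flags → Q
    clause resto       : Flags → Bool → Fin 3 → Bool → Q
    walk               : Flags → Bool → Fin 3 → Bool → Bool → Q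
    endF clrU          : Flags → Bool → Q
    sim simL           : MState → Q
    simW               : MState → Letter → Bool → Q

  -- `In`, `F`: read and unread part of the formula. `N`: variables not yet accommodated, in unary.
  -- `B`: `b` in unary. `C`, with scratch `D`: the columns of the row. `Y`, with scratch `W`: the
  -- columns being halved. `T`, `U`: the table on both sides of the reading position. `R`, `L`: the
  -- output, which becomes the tape of `M` from the head rightwards and to its left.
  In F N B C D Y W T U R L : Fin 12
  In = # 0
  F  = # 1
  N  = # 2
  B  = # 3
  C  = # 4
  D  = # 5
  Y  = # 6
  W  = # 7
  T  = # 8
  U  = # 9
  R  = # 10
  L  = # 11

  Acts : Set
  Acts = Vec (Act A) 12

  none : Acts
  none = vreplicate 12 nop

  on : Fin 12 → Act A → Acts → Acts
  on i o v = v [ i ]≔ o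

  Result : Set
  Result = (Q × Acts) ⊎ Bool

  go : Q → Acts → Result
  go q o = inj₁ (q , o)

  digit′ : ∀ {w} → Fin 4 ⊎ Fin w → Maybe (Fin 4)
  digit′ (inj₁ i) = just i
  digit′ (inj₂ _) = nothing

  digit : Maybe A → Maybe (Fin 4)
  digit (just (inj₁ (just k))) = digit′ (splitAt 4 k)
  digit _                      = nothing

  isDigit : Fin 4 → Maybe A → Bool
  isDigit k m = maybe′ (λ i → does (i Fin.≟ k)) false (digit m)

  colOf : A → Col
  colOf (inj₁ _) = zeros
  colOf (inj₂ v) = v

  letterOf : Maybe A → Letter
  letterOf (just (inj₁ s)) = s
  letterOf _               = nothing

  move→ : Fin 12 → Fin 12 → Maybe A → Q → Q → Result
  move→ i j m q q′ = maybe′ (λ a → go q (on i pop (on j (push a) none))) (go q′ none) m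

  -- Used from 7 down to 0: four pops make room for 1, 0, 0, 1, the digits of 9. With the `b` zeros
  -- that `padZ` puts in front, lowest digit first, this is `9 * 2 ^ b`.
  digits : Fin 8 → Act A
  digits zero                         = push (raw s1)
  digits (suc zero)                   = push (raw s0)
  digits (suc (suc zero))             = push (raw s0)
  digits (suc (suc (suc zero)))       = push (raw s1)
  digits (suc (suc (suc (suc _))))    = pop

  before : ∀ {n} → (Fin n → Q) → Q → Fin (suc n) → Q
  before f q zero    = q
  before f q (suc i) = f i

  down : Fin 8 → (Fin 8 → Q) → Q → Q
  down k f q = before (λ i → f (inject₁ i)) q k

  nextLit : Flags → Bool → Fin 3 → Bool → Q
  nextLit fl hit zero             ok = clause fl hit (# 1) ok
  nextLit fl hit (suc zero)       ok = clause fl hit (# 2) ok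
  nextLit fl hit (suc (suc zero)) ok = clause fl (hit ∨ ok) (# 0) true

  simulate : (MState ⊎ Bool) × Letter × Move → Result
  simulate (inj₂ b , _ , _)     = inj₂ b
  simulate (inj₁ q , w , right) = go (sim q) (on R pop (on L (push (inj₁ w)) none))
  simulate (inj₁ q , w , left)  = go (simW q w true) (on R pop none)
  simulate (inj₁ q , w , stay)  = go (simW q w false) (on R pop none)

  δ : Q → Vec (Maybe A) 12 → Result
  δ rev    t = move→ In F (lookup t In) rev cnt
  δ cnt    t = if isDigit s1 (lookup t F) then go cnt (on F pop (on N (push (raw s0)) none))
                                          else go grow (on F pop (on C (push (inj₂ zeros)) none))
  -- A round takes `b * 2 ^ b` symbols off `N`, adds one to `B` and doubles `C`. Copying alone
  -- achieves this, and the rounds end at the least `b` with `n ≤ cap b`.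
  δ grow   t = maybe′ (λ _ → go growB none) (go pad none) (lookup t N)
  δ growB  t = move→ B W (lookup t B) growC growD
  δ growC  t = maybe′ (λ a → go growC (on C pop (on D (push a) (on N pop none)))) (go growC′ none) (lookup t C)
  δ growC′ t = move→ D C (lookup t D) growC′ growB
  δ growD  t = maybe′ (λ a → go growD (on W pop (on B (push a) none))) (go dbl (on B (push (raw s0)) none)) (lookup t W)
  δ dbl    t = move→ C D (lookup t C) dbl1 dblR
  δ dbl1   t = go dbl (on D (push (inj₂ zeros)) none)
  δ dblR   t = move→ D C (lookup t D) dblR grow
  δ pad    t = maybe′ (λ a → go (padk (# 7)) (on C pop (on D (push (inj₂ ones)) (on R (push (raw s0)) none))))
                      (go padB (on R (push (raw s0)) none)) (lookup t C)
  δ (padk k) t = go (down k padk pad) (on R (push (raw s0)) none)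
  δ padB   t = maybe′ (λ a → go padB (on B pop (on W (push a) (on R pop none)))) (go (fix (# 7)) none) (lookup t B)
  δ (fix k) t = go (down k fix padZ) (on R (digits k) none)
  δ padZ   t = maybe′ (λ a → go padZ (on W pop (on R (push (raw s0)) none))) (go padR (on R (push (raw s3)) none)) (lookup t W)
  δ padR   t = move→ D C (lookup t D) padR (scan noFlags)
  δ (scan fl) t = maybe′ (λ a → go (scan (addFlags fl (colOf a))) (on C pop (on D (push a) none))) (go (copy fl) none) (lookup t C)
  δ (copy fl) t = maybe′ (λ a → go (copy fl) (on D pop (on C (push a) (on Y (push a) none)))) (go (tab fl) none) (lookup t D)
  δ (tab fl)  t = maybe′ (λ a → go (tab1 fl (colOf a)) (on Y pop none)) (go (revT fl) none) (lookup t Y)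
  δ (tab1 fl e) t = maybe′ (λ a → go (split fl (meet ones e) (meet ones (colOf a))) (on Y pop (on W (push (inj₂ (meet e (colOf a)))) none)))
                           (go (revT fl) none) (lookup t Y)
  δ (split fl E O) t = maybe′ (λ a → go (split1 fl E O (colOf a)) (on Y pop none)) (go (splR fl E O) none) (lookup t Y)
  δ (split1 fl E O e) t = maybe′ (λ a → go (split fl (meet E e) (meet O (colOf a))) (on Y pop (on W (push (inj₂ (meet e (colOf a)))) none)))
                           (go (splR fl E O) none) (lookup t Y)
  δ (splR fl E O) t = move→ W Y (lookup t W) (splR fl E O) (app fl E O)
  δ (app fl E O)  t = maybe′ (λ a → go (app fl E O) (on C pop (on D (push a) (on T (push (inj₂ (tableCol E O (colOf a)))) none))))
                             (go (appR fl) none) (lookup t C)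
  δ (appR fl) t = move→ D C (lookup t D) (appR fl) (tab fl)
  δ (revT fl) t = move→ T U (lookup t T) (revT fl) (clause fl false (# 0) true)
  δ (clause fl hit p ok) t = maybe′ (λ a → go (walk fl hit p ok (isDigit s1 (just a))) (on F pop (on In (push a) none)))
                             (go (endF fl hit) none) (lookup t F)
  δ (walk fl hit p ok pol) t =
    if isDigit s2 (lookup t F)
      then go (walk fl hit p ok pol) (on F pop (on In (push (raw s2)) (maybe′ (λ w → on U pop (on T (push w) none)) none (lookup t U))))
      else go (resto fl hit p (ok ∧ litFlag p pol (mapMaybe colOf (lookup t U)))) (on F pop (on In (push (raw s3)) none))
  δ (resto fl hit p ok) t = move→ T U (lookup t T) (resto fl hit p ok) (nextLit fl hit p ok)
  δ (endF fl hit) t = move→ In F (lookup t In) (endF fl hit) (clrU fl hit)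
  δ (clrU fl hit) t = maybe′ (λ _ → go (clrU fl hit) (on U pop none)) (go dec (on R (push (raw (encPVal (verdict fl hit)))) none)) (lookup t U)
  δ dec    t = maybe′ (λ a → if isZero (colOf a) then go dec (on C pop (on D (push (inj₂ ones)) none))
                             else go decR (on C pop (on D (push (inj₂ (decrement (colOf a)))) none)))
                      (go (sim zero) none) (lookup t C)
  δ decR   t = move→ D C (lookup t D) decR (scan noFlags)
  δ (sim q)  t = simulate (TM.δ M q (letterOf (lookup t R)))
  δ (simW q w z) t = go (if z then simL q else sim q) (on R (push (inj₁ w)) none)
  -- An empty `L` means that the head is at the left end, where `move` leaves it in place.
  δ (simL q) t = move→ L R (lookup t L) (sim q) (sim q)

  -- All parameters that some state outside the `sim` group may carry; a state lacking one stores a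
  -- default in its place.
  Payload : Set
  Payload = Flags × Col × Col × Col × Bool × Bool × Bool × Fin 3 × Fin 8

  Code : Set
  Code = (Fin 17 × Payload) ⊎ (Fin 16 × Payload) ⊎ (Fin 2 × MState) ⊎ (MState × Letter × Bool)

  encode : Q → Code
  encode q = to q
    where
    z : Col
    z = zeros
    pay : Flags → Col → Col → Col → Bool → Bool → Bool → Fin 3 → Fin 8 → Payload
    pay fl E O e h ok pol p k = fl , E , O , e , h , ok , pol , p , k
    p₀ : Payload
    p₀ = pay noFlags z z z false false false (# 0) (# 0)
    to : Q → Code
    to rev    = inj₁ (# 0 , p₀)
    to cnt    = inj₁ (# 1 , p₀)
    to grow   = inj₁ (# 2 , p₀)
    to growB  = inj₁ (# 3 , p₀)
    to growC  = inj₁ (# 4 , p₀)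
    to growC′ = inj₁ (# 5 , p₀)
    to growD  = inj₁ (# 6 , p₀)
    to dbl    = inj₁ (# 7 , p₀)
    to dbl1   = inj₁ (# 8 , p₀)
    to dblR   = inj₁ (# 9 , p₀)
    to pad    = inj₁ (# 10 , p₀)
    to padB   = inj₁ (# 11 , p₀)
    to padZ   = inj₁ (# 12 , p₀)
    to padR   = inj₁ (# 13 , p₀)
    to dec    = inj₁ (# 14 , p₀)
    to decR   = inj₁ (# 15 , p₀)
    to (padk k) = inj₁ (# 16 , pay noFlags z z z false false false (# 0) k)
    to (fix k)  = inj₂ (inj₁ (# 0 , pay noFlags z z z false false false (# 0) k))
    to (scan fl) = inj₂ (inj₁ (# 1 , pay fl z z z false false false (# 0) (# 0)))
    to (copy fl) = inj₂ (inj₁ (# 2 , pay fl z z z false false false (# 0) (# 0)))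
    to (tab fl)  = inj₂ (inj₁ (# 3 , pay fl z z z false false false (# 0) (# 0)))
    to (tab1 fl e)  = inj₂ (inj₁ (# 4 , pay fl z z e false false false (# 0) (# 0)))
    to (split fl E O)  = inj₂ (inj₁ (# 5 , pay fl E O z false false false (# 0) (# 0)))
    to (splR fl E O)   = inj₂ (inj₁ (# 6 , pay fl E O z false false false (# 0) (# 0)))
    to (app fl E O)    = inj₂ (inj₁ (# 7 , pay fl E O z false false false (# 0) (# 0)))
    to (split1 fl E O e) = inj₂ (inj₁ (# 8 , pay fl E O e false false false (# 0) (# 0)))
    to (appR fl)  = inj₂ (inj₁ (# 9 , pay fl z z z false false false (# 0) (# 0)))
    to (revT fl)  = inj₂ (inj₁ (# 10 , pay fl z z z false false false (# 0) (# 0)))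
    to (clause fl h p ok)   = inj₂ (inj₁ (# 11 , pay fl z z z h ok false p (# 0)))
    to (resto fl h p ok)    = inj₂ (inj₁ (# 12 , pay fl z z z h ok false p (# 0)))
    to (walk fl h p ok pol) = inj₂ (inj₁ (# 13 , pay fl z z z h ok pol p (# 0)))
    to (endF fl h) = inj₂ (inj₁ (# 14 , pay fl z z z h false false (# 0) (# 0)))
    to (clrU fl h) = inj₂ (inj₁ (# 15 , pay fl z z z h false false (# 0) (# 0)))
    to (sim q)  = inj₂ (inj₂ (inj₁ (# 0 , q)))
    to (simL q) = inj₂ (inj₂ (inj₁ (# 1 , q)))
    to (simW q w z) = inj₂ (inj₂ (inj₂ (q , w , z)))

  decodeAt : ℕ → Payload → Q
  decodeAt 0  _ = rev
  decodeAt 1  _ = cnt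
  decodeAt 2  _ = grow
  decodeAt 3  _ = growB
  decodeAt 4  _ = growC
  decodeAt 5  _ = growC′
  decodeAt 6  _ = growD
  decodeAt 7  _ = dbl
  decodeAt 8  _ = dbl1
  decodeAt 9  _ = dblR
  decodeAt 10 _ = pad
  decodeAt 11 _ = padB
  decodeAt 12 _ = padZ
  decodeAt 13 _ = padR
  decodeAt 14 _ = dec
  decodeAt 15 _ = decR
  decodeAt _ (fl , E , O , e , h , ok , pol , p , k) = padk k

  decodeAt′ : ℕ → Payload → Q
  decodeAt′ 0 (fl , E , O , e , h , ok , pol , p , k) = fix k
  decodeAt′ 1 (fl , E , O , e , h , ok , pol , p , k) = scan fl
  decodeAt′ 2 (fl , E , O , e , h , ok , pol , p , k) = copy fl
  decodeAt′ 3 (fl , E , O , e , h , ok , pol , p , k) = tab fl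
  decodeAt′ 4 (fl , E , O , e , h , ok , pol , p , k) = tab1 fl e
  decodeAt′ 5 (fl , E , O , e , h , ok , pol , p , k) = split fl E O
  decodeAt′ 6 (fl , E , O , e , h , ok , pol , p , k) = splR fl E O
  decodeAt′ 7 (fl , E , O , e , h , ok , pol , p , k) = app fl E O
  decodeAt′ 8 (fl , E , O , e , h , ok , pol , p , k) = split1 fl E O e
  decodeAt′ 9 (fl , E , O , e , h , ok , pol , p , k) = appR fl
  decodeAt′ 10 (fl , E , O , e , h , ok , pol , p , k) = revT fl
  decodeAt′ 11 (fl , E , O , e , h , ok , pol , p , k) = clause fl h p ok
  decodeAt′ 12 (fl , E , O , e , h , ok , pol , p , k) = resto fl h p ok
  decodeAt′ 13 (fl , E , O , e , h , ok , pol , p , k) = walk fl h p ok pol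
  decodeAt′ 14 (fl , E , O , e , h , ok , pol , p , k) = endF fl h
  decodeAt′ _  (fl , E , O , e , h , ok , pol , p , k) = clrU fl h

  decode : Code → Q
  decode (inj₁ (k , p))              = decodeAt (toℕ k) p
  decode (inj₂ (inj₁ (k , p)))       = decodeAt′ (toℕ k) p
  decode (inj₂ (inj₂ (inj₁ (zero , q))))    = sim q
  decode (inj₂ (inj₂ (inj₁ (suc _ , q))))   = simL q
  decode (inj₂ (inj₂ (inj₂ (q , w , z))))   = simW q w z

  decode-encode : ∀ q → decode (encode q) ≡ q
  decode-encode rev    = refl
  decode-encode cnt    = refl
  decode-encode grow   = refl
  decode-encode growB  = refl
  decode-encode growC  = refl
  decode-encode growC′ = refl
  decode-encode growD  = refl
  decode-encode dbl    = refl
  decode-encode dbl1   = refl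
  decode-encode dblR   = refl
  decode-encode pad    = refl
  decode-encode padB   = refl
  decode-encode padZ   = refl
  decode-encode padR   = refl
  decode-encode dec    = refl
  decode-encode decR   = refl
  decode-encode (padk k) = refl
  decode-encode (fix k)  = refl
  decode-encode (scan fl) = refl
  decode-encode (copy fl) = refl
  decode-encode (tab fl)  = refl
  decode-encode (tab1 fl e) = refl
  decode-encode (split fl E O) = refl
  decode-encode (splR fl E O) = refl
  decode-encode (app fl E O) = refl
  decode-encode (split1 fl E O e) = refl
  decode-encode (appR fl) = refl
  decode-encode (revT fl) = refl
  decode-encode (clause fl h p ok) = refl
  decode-encode (resto fl h p ok) = refl
  decode-encode (walk fl h p ok pol) = refl
  decode-encode (endF fl h) = refl
  decode-encode (clrU fl h) = refl
  decode-encode (sim q)  = refl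
  decode-encode (simL q) = refl
  decode-encode (simW q w z) = refl

  abstract
    enum-Letter : Enum Letter
    enum-Letter = enum-Maybe (enum-Fin (3 + TM.work M))

    enum-Col : Enum Col
    enum-Col = enum-Vec enum-Bool 9

    enum-A : Enum A
    enum-A = enum-⊎ enum-Letter enum-Col

    enum-Payload : Enum Payload
    enum-Payload = enum-× (enum-Vec enum-Bool 13) (enum-× enum-Col (enum-× enum-Col (enum-× enum-Col
      (enum-× enum-Bool (enum-× enum-Bool (enum-× enum-Bool (enum-× (enum-Fin 2) (enum-Fin 7))))))))

    enum-Q : Enum Q
    enum-Q = enum-retract encode decode decode-encode
      (enum-⊎ (enum-× (enum-Fin 16) enum-Payload) (enum-⊎ (enum-× (enum-Fin 15) enum-Payload)
        (enum-⊎ (enum-× (enum-Fin 1) (enum-Fin (TM.states M)))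
                (enum-× (enum-Fin (TM.states M)) (enum-× enum-Letter enum-Bool)))))

  open Stacks δ public

-- Runs of the individual phases

ʳ++-involutive : ∀ {X : Set} (l : List X) → (l ʳ++ []) ʳ++ [] ≡ l
ʳ++-involutive l = trans (ʳ++-ʳ++ l) (++-identityʳ l)

popN : {X : Set} → ℕ → List X → List X
popN zero    l = l
popN (suc k) l = popN k (actOn pop l)

length-actOn-pop : ∀ {X : Set} (l : List X) → length (actOn pop l) ≡ length l ∸ 1
length-actOn-pop []      = refl
length-actOn-pop (_ ∷ l) = refl

length-popN : ∀ {X : Set} k (l : List X) → length (popN k l) ≡ length l ∸ k
length-popN zero    l = refl
length-popN (suc k) l = trans (length-popN k (actOn pop l)) (trans (cong (_∸ k) (length-actOn-pop l)) (∸-+-assoc (length l) 1 k))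

popN-+ : ∀ {X : Set} j k (l : List X) → popN (j + k) l ≡ popN k (popN j l)
popN-+ zero    k l = refl
popN-+ (suc j) k l = popN-+ j k (actOn pop l)

pushN : {X : Set} → X → ℕ → List X → List X
pushN x zero    l = l
pushN x (suc k) l = pushN x k (x ∷ l)

pushN-replicate : ∀ {X : Set} (x : X) k l → pushN x k l ≡ replicate k x ++ l
pushN-replicate x zero    l = refl
pushN-replicate x (suc k) l = trans (pushN-replicate x k (x ∷ l)) (swap k)
  where
  swap : ∀ k → replicate k x ++ x ∷ l ≡ x ∷ replicate k x ++ l
  swap zero    = refl
  swap (suc k) = cong (x ∷_) (swap k)

length-pushN : ∀ {X : Set} (x : X) k l → length (pushN x k l) ≡ k + length l
length-pushN x k l = trans (cong length (pushN-replicate x k l)) (trans (length-++ (replicate k x)) (cong (_+ length l) (length-replicate k)))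

-- Decrement of a number in base 512, lowest digit first; `nothing` reports that it was zero and
-- thereby ends the loop over the rows.
decList : List Col → Maybe (List Col)
decList []      = nothing
decList (v ∷ l) = if isZero v then mapMaybe (ones ∷_) (decList l) else just (decrement v ∷ l)

module Exec (M : TM 4) where
  open Program M

  List′ : Set
  List′ = List A

  st : List′ → List′ → List′ → List′ → List′ → List′ → List′ → List′ → List′ → List′ → List′ → List′ → Store
  st i f n b c d y w t u r l = i ∷ f ∷ n ∷ b ∷ c ∷ d ∷ y ∷ w ∷ t ∷ u ∷ r ∷ l ∷ []

  cols : List Col → List′
  cols = map inj₂

  module _ {n b c d y w t u r l : List′} where

    rev-run : ∀ i f → (rev , st i f n b c d y w t u r l) ⇒⟨ suc (length i) ⟩ (cnt , st [] (i ʳ++ f) n b c d y w t u r l)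
    rev-run []      f = more refl done
    rev-run (a ∷ i) f = more refl (rev-run i (a ∷ f))

    endF-run : ∀ fl hit i f → (endF fl hit , st i f n b c d y w t u r l) ⇒⟨ suc (length i) ⟩ (clrU fl hit , st [] (i ʳ++ f) n b c d y w t u r l)
    endF-run fl hit []      f = more refl done
    endF-run fl hit (a ∷ i) f = more refl (endF-run fl hit i (a ∷ f))

  cnt-run : ∀ k rest {i n b c d y w t u r l} →
    (cnt , st i (map raw (replicate k s1 ++ s3 ∷ rest)) n b c d y w t u r l) ⇒⟨ suc k ⟩
    (grow , st i (map raw rest) (pushN (raw s0) k n) b (inj₂ zeros ∷ c) d y w t u r l)
  cnt-run zero    rest = more refl done
  cnt-run (suc k) rest = more refl (cnt-run k rest)

  growC-run : ∀ cs d {i f n b y w t u r l} →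
    (growC , st i f n b cs d y w t u r l) ⇒⟨ suc (length cs) ⟩ (growC′ , st i f (popN (length cs) n) b [] (cs ʳ++ d) y w t u r l)
  growC-run []       d = more refl done
  growC-run (a ∷ cs) d = more refl (growC-run cs (a ∷ d))

  growC′-run : ∀ ds c {i f n b y w t u r l} →
    (growC′ , st i f n b c ds y w t u r l) ⇒⟨ suc (length ds) ⟩ (growB , st i f n b (ds ʳ++ c) [] y w t u r l)
  growC′-run []       c = more refl done
  growC′-run (a ∷ ds) c = more refl (growC′-run ds (a ∷ c))

  length-ʳ++-[] : ∀ {X : Set} (l : List X) → length (l ʳ++ []) ≡ length l
  length-ʳ++-[] l = trans (List.length-ʳ++ l) (+-identityʳ _)

  growB-run : ∀ bs cs {i f n w y t u r l} →
    (growB , st i f n bs cs [] y w t u r l) ⇒⟨ suc (length bs * (3 + (length cs + length cs))) ⟩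
    (growD , st i f (popN (length bs * length cs) n) [] cs [] y (bs ʳ++ w) t u r l)
  growB-run []       cs = more refl done
  growB-run (a ∷ bs) cs {i} {f} {n} {w} {y} {t} {u} {r} {l} = ⇒-mono (≤-reflexive time)
    (more refl (growC-run cs [] ⨾ growC′-run (cs ʳ++ []) [] ⨾
      subst₂ (λ c′ n′ → (growB , st i f (popN (length cs) n) bs c′ [] y (a ∷ w) t u r l) ⇒⟨ suc (length bs * (3 + (length cs + length cs))) ⟩
                        (growD , st i f n′ [] cs [] y (bs ʳ++ (a ∷ w)) t u r l))
             (sym (ʳ++-involutive cs)) (sym (popN-+ (length cs) (length bs * length cs) n))
             (growB-run bs cs)))
    where
    time : suc (suc (length cs) + (suc (length (cs ʳ++ [])) + suc (length bs * (3 + (length cs + length cs)))))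
         ≡ suc (3 + (length cs + length cs) + length bs * (3 + (length cs + length cs)))
    time = trans (cong (λ k → suc (suc (length cs) + (suc k + suc X))) (length-ʳ++-[] cs)) (cong (λ z → suc (suc z)) (begin
      length cs + suc (length cs + suc X)     ≡⟨ cong (length cs +_) (cong suc (+-suc (length cs) X)) ⟩
      length cs + suc (suc (length cs + X))   ≡⟨ +-suc (length cs) _ ⟩
      suc (length cs + suc (length cs + X))   ≡⟨ cong suc (+-suc (length cs) _) ⟩
      suc (suc (length cs + (length cs + X))) ≡⟨ cong (λ z → suc (suc z)) (sym (+-assoc (length cs) (length cs) X)) ⟩
      suc (suc (length cs + length cs + X))   ∎))
      where
      open ≡-Reasoning
      X : ℕ
      X = length bs * (3 + (length cs + length cs))

  growD-run : ∀ ws b {i f n c d y t u r l} →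
    (growD , st i f n b c d y ws t u r l) ⇒⟨ suc (length ws) ⟩ (dbl , st i f n (raw s0 ∷ (ws ʳ++ b)) c d y [] t u r l)
  growD-run []       b = more refl done
  growD-run (a ∷ ws) b = more refl (growD-run ws (a ∷ b))

  doubled : List′ → List′ → List′
  doubled []       d = d
  doubled (a ∷ cs) d = doubled cs (inj₂ zeros ∷ a ∷ d)

  dbl-run : ∀ cs d {i f n b y w t u r l} →
    (dbl , st i f n b cs d y w t u r l) ⇒⟨ suc (length cs * 2) ⟩ (dblR , st i f n b [] (doubled cs d) y w t u r l)
  dbl-run []       d = more refl done
  dbl-run (a ∷ cs) d = more refl (more refl (dbl-run cs (inj₂ zeros ∷ a ∷ d)))

  dblR-run : ∀ ds c {i f n b y w t u r l} →
    (dblR , st i f n b c ds y w t u r l) ⇒⟨ suc (length ds) ⟩ (grow , st i f n b (ds ʳ++ c) [] y w t u r l)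
  dblR-run []       c = more refl done
  dblR-run (a ∷ ds) c = more refl (dblR-run ds (a ∷ c))

  blanks : ℕ → List′
  blanks k = replicate k (inj₂ zeros)

  replicate-ʳ++ : ∀ {X : Set} (x : X) j k → replicate j x ʳ++ replicate k x ≡ replicate (j + k) x
  replicate-ʳ++ x zero    k = refl
  replicate-ʳ++ x (suc j) k = trans (replicate-ʳ++ x j (suc k)) (cong (λ z → replicate z x) (+-suc j k))

  doubled-blanks : ∀ j k → doubled (blanks j) (blanks k) ≡ blanks (j + j + k)
  doubled-blanks zero    k = refl
  doubled-blanks (suc j) k = trans (doubled-blanks j (2 + k)) (cong blanks (begin
    j + j + suc (suc k)   ≡⟨ +-suc (j + j) (suc k) ⟩
    suc (j + j + suc k)   ≡⟨ cong suc (+-suc (j + j) k) ⟩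
    suc (suc (j + j + k)) ≡⟨ cong (λ z → suc (z + k)) (sym (+-suc j j)) ⟩
    suc (j + suc j + k)   ∎))
    where open ≡-Reasoning

  roundCost : ℕ → ℕ → ℕ
  roundCost b m = 1 + (suc (b * (3 + (m + m))) + (suc b + (suc (m * 2) + suc (m + m))))

  grow-round : ∀ a n bs m {i f y t u r l} →
    (grow , st i f (a ∷ n) bs (blanks m) [] y [] t u r l) ⇒⟨ roundCost (length bs) m ⟩
    (grow , st i f (popN (length bs * m) (a ∷ n)) (raw s0 ∷ bs) (blanks (m + m)) [] y [] t u r l)
  grow-round a n bs m {i} {f} {y} {t} {u} {r} {l} = more refl (part₁ ⨾ part₂ ⨾ part₃ ⨾ part₄)
    where
    n′ : List′
    n′ = popN (length bs * m) (a ∷ n)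
    part₁ : (growB , st i f (a ∷ n) bs (blanks m) [] y [] t u r l) ⇒⟨ suc (length bs * (3 + (m + m))) ⟩
            (growD , st i f n′ [] (blanks m) [] y (bs ʳ++ []) t u r l)
    part₁ = subst (λ k → (growB , st i f (a ∷ n) bs (blanks m) [] y [] t u r l) ⇒⟨ suc (length bs * (3 + (k + k))) ⟩
                         (growD , st i f (popN (length bs * k) (a ∷ n)) [] (blanks m) [] y (bs ʳ++ []) t u r l))
              (length-replicate m) (growB-run bs (blanks m))
    part₂ : (growD , st i f n′ [] (blanks m) [] y (bs ʳ++ []) t u r l) ⇒⟨ suc (length bs) ⟩
            (dbl , st i f n′ (raw s0 ∷ bs) (blanks m) [] y [] t u r l)
    part₂ = subst₂ (λ k b′ → (growD , st i f n′ [] (blanks m) [] y (bs ʳ++ []) t u r l) ⇒⟨ suc k ⟩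
                             (dbl , st i f n′ (raw s0 ∷ b′) (blanks m) [] y [] t u r l))
              (length-ʳ++-[] bs) (ʳ++-involutive bs) (growD-run (bs ʳ++ []) [])
    part₃ : (dbl , st i f n′ (raw s0 ∷ bs) (blanks m) [] y [] t u r l) ⇒⟨ suc (m * 2) ⟩
            (dblR , st i f n′ (raw s0 ∷ bs) [] (blanks (m + m)) y [] t u r l)
    part₃ = subst₂ (λ k c′ → (dbl , st i f n′ (raw s0 ∷ bs) (blanks m) [] y [] t u r l) ⇒⟨ suc (k * 2) ⟩
                             (dblR , st i f n′ (raw s0 ∷ bs) [] c′ y [] t u r l))
              (length-replicate m) (trans (doubled-blanks m 0) (cong blanks (+-identityʳ (m + m)))) (dbl-run (blanks m) [])
    part₄ : (dblR , st i f n′ (raw s0 ∷ bs) [] (blanks (m + m)) y [] t u r l) ⇒⟨ suc (m + m) ⟩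
            (grow , st i f n′ (raw s0 ∷ bs) (blanks (m + m)) [] y [] t u r l)
    part₄ = subst₂ (λ k c′ → (dblR , st i f n′ (raw s0 ∷ bs) [] (blanks (m + m)) y [] t u r l) ⇒⟨ suc k ⟩
                             (grow , st i f n′ (raw s0 ∷ bs) c′ [] y [] t u r l))
              (length-replicate (m + m)) (trans (replicate-ʳ++ _ (m + m) 0) (cong blanks (+-identityʳ (m + m)))) (dblR-run (blanks (m + m)) [])

  grow-end : ∀ {i f b c d y w t u r l} → (grow , st i f [] b c d y w t u r l) ⇒⟨ 1 ⟩ (pad , st i f [] b c d y w t u r l)
  grow-end = more refl done

  fulls : ℕ → List′
  fulls k = replicate k (inj₂ ones)

  pad-run : ∀ cs j r {i f n b y w t u l} →
    (pad , st i f n b cs (fulls j) y w t u r l) ⇒⟨ suc (length cs * 9) ⟩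
    (padB , st i f n b [] (fulls (length cs + j)) y w t u (pushN (raw s0) (suc (length cs * 9)) r) l)
  pad-run []       j r = more refl done
  pad-run (a ∷ cs) j r {i} {f} {n} {b} {y} {w} {t} {u} {l} =
    more refl (more refl (more refl (more refl (more refl (more refl (more refl (more refl (more refl rest))))))))
    where
    z : A
    z = raw s0
    rest : (pad , st i f n b cs (fulls (suc j)) y w t u (z ∷ z ∷ z ∷ z ∷ z ∷ z ∷ z ∷ z ∷ z ∷ r) l) ⇒⟨ suc (length cs * 9) ⟩
           (padB , st i f n b [] (fulls (suc (length cs + j))) y w t u (pushN z (suc (length cs * 9)) (z ∷ z ∷ z ∷ z ∷ z ∷ z ∷ z ∷ z ∷ z ∷ r)) l)
    rest = subst (λ k → (pad , st i f n b cs (fulls (suc j)) y w t u (z ∷ z ∷ z ∷ z ∷ z ∷ z ∷ z ∷ z ∷ z ∷ r) l) ⇒⟨ suc (length cs * 9) ⟩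
             (padB , st i f n b [] (fulls k) y w t u (pushN z (suc (length cs * 9)) (z ∷ z ∷ z ∷ z ∷ z ∷ z ∷ z ∷ z ∷ z ∷ r)) l))
             (+-suc (length cs) j) (pad-run cs (suc j) (z ∷ z ∷ z ∷ z ∷ z ∷ z ∷ z ∷ z ∷ z ∷ r))

  padB-run : ∀ bs w r {i f n c d y t u l} →
    (padB , st i f n bs c d y w t u r l) ⇒⟨ suc (length bs) ⟩ (fix (# 7) , st i f n [] c d y (bs ʳ++ w) t u (popN (length bs) r) l)
  padB-run []       w r = more refl done
  padB-run (a ∷ bs) w r = more refl (padB-run bs (a ∷ w) (actOn pop r))

  fix-run : ∀ r {i f n b c d y w t u l} →
    (fix (# 7) , st i f n b c d y w t u r l) ⇒⟨ 8 ⟩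
    (padZ , st i f n b c d y w t u (raw s1 ∷ raw s0 ∷ raw s0 ∷ raw s1 ∷ popN 4 r) l)
  fix-run r = more refl (more refl (more refl (more refl (more refl (more refl (more refl (more refl done)))))))

  padZ-run : ∀ ws r {i f n b c d y t u l} →
    (padZ , st i f n b c d y ws t u r l) ⇒⟨ suc (length ws) ⟩ (padR , st i f n b c d y [] t u (raw s3 ∷ pushN (raw s0) (length ws) r) l)
  padZ-run []       r = more refl done
  padZ-run (a ∷ ws) r = more refl (padZ-run ws (raw s0 ∷ r))

  padR-run : ∀ ds c {i f n b y w t u r l} →
    (padR , st i f n b c ds y w t u r l) ⇒⟨ suc (length ds) ⟩ (scan noFlags , st i f n b (ds ʳ++ c) [] y w t u r l)
  padR-run []       c = more refl done
  padR-run (a ∷ ds) c = more refl (padR-run ds (a ∷ c))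

  scan-run : ∀ cs fl d {i f n b y w t u r l} →
    (scan fl , st i f n b (cols cs) d y w t u r l) ⇒⟨ suc (length cs) ⟩ (copy (foldl addFlags fl cs) , st i f n b [] (cols cs ʳ++ d) y w t u r l)
  scan-run []       fl d = more refl done
  scan-run (v ∷ cs) fl d = more refl (scan-run cs (addFlags fl v) (inj₂ v ∷ d))

  copy-run : ∀ ds fl c y {i f n b w t u r l} →
    (copy fl , st i f n b c ds y w t u r l) ⇒⟨ suc (length ds) ⟩ (tab fl , st i f n b (ds ʳ++ c) [] (ds ʳ++ y) w t u r l)
  copy-run []       fl c y = more refl done
  copy-run (a ∷ ds) fl c y = more refl (copy-run ds fl (a ∷ c) (a ∷ y))

  split-run : ∀ ys fl E O w {i f n b c d t u r l} →
    (split fl E O , st i f n b c d (cols ys) w t u r l) ⇒⟨ suc (length ys) ⟩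
    (splR fl (meetEven E ys) (meetOdd O ys) , st i f n b c d [] (cols (halve ys) ʳ++ w) t u r l)
  split-run []           fl E O w = more refl done
  split-run (e ∷ [])     fl E O w = more refl (more refl done)
  split-run (e ∷ o ∷ ys) fl E O w = more refl (more refl (split-run ys fl (meet E e) (meet O o) (inj₂ (meet e o) ∷ w)))

  splR-run : ∀ ws fl E O y {i f n b c d t u r l} →
    (splR fl E O , st i f n b c d y ws t u r l) ⇒⟨ suc (length ws) ⟩ (app fl E O , st i f n b c d (ws ʳ++ y) [] t u r l)
  splR-run []       fl E O y = more refl done
  splR-run (a ∷ ws) fl E O y = more refl (splR-run ws fl E O (a ∷ y))

  app-run : ∀ cs fl E O d t {i f n b y w u r l} →
    (app fl E O , st i f n b (cols cs) d y w t u r l) ⇒⟨ suc (length cs) ⟩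
    (appR fl , st i f n b [] (cols cs ʳ++ d) y w (cols (map (tableCol E O) cs) ʳ++ t) u r l)
  app-run []       fl E O d t = more refl done
  app-run (v ∷ cs) fl E O d t = more refl (app-run cs fl E O (inj₂ v ∷ d) (inj₂ (tableCol E O v) ∷ t))

  appR-run : ∀ ds fl c {i f n b y w t u r l} →
    (appR fl , st i f n b c ds y w t u r l) ⇒⟨ suc (length ds) ⟩ (tab fl , st i f n b (ds ʳ++ c) [] y w t u r l)
  appR-run []       fl c = more refl done
  appR-run (a ∷ ds) fl c = more refl (appR-run ds fl (a ∷ c))

  revT-run : ∀ ts fl u {i f n b c d y w r l} →
    (revT fl , st i f n b c d y w ts u r l) ⇒⟨ suc (length ts) ⟩ (clause fl false (# 0) true , st i f n b c d y w [] (ts ʳ++ u) r l)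
  revT-run []       fl u = more refl done
  revT-run (a ∷ ts) fl u = more refl (revT-run ts fl (a ∷ u))

  -- The invariant is `t′ ʳ++ cols us′`, the table with the reading position forgotten. It
  -- determines what `resto` rebuilds, even if the walk runs past the end of the table.
  walk-run : ∀ k rest us {fl h p ok pol i n b c d y w r l} t →
    ∃₂ λ us′ t′ → t′ ʳ++ cols us′ ≡ t ʳ++ cols us × length t′ ≤ k + length t ×
    (walk fl h p ok pol , st i (map raw (replicate k s2 ++ s3 ∷ rest)) n b c d y w t (cols us) r l) ⇒⟨ suc k ⟩
    (resto fl h p (ok ∧ litFlag p pol (nthMaybe us k)) ,
     st (map raw (replicate k s2 ++ s3 ∷ []) ʳ++ i) (map raw rest) n b c d y w t′ (cols us′) r l)
  walk-run zero    rest []       t = [] , t , refl , ≤-refl , more refl done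
  walk-run zero    rest (v ∷ us) t = v ∷ us , t , refl , ≤-refl , more refl done
  walk-run (suc k) rest []       {i = i} t with walk-run k rest [] {i = raw s2 ∷ i} t
  ... | us′ , t′ , e , le , run = us′ , t′ , e , m≤n⇒m≤1+n le , more refl run
  walk-run (suc k) rest (v ∷ us) {i = i} t with walk-run k rest us {i = raw s2 ∷ i} (inj₂ v ∷ t)
  ... | us′ , t′ , e , le , run = us′ , t′ , e , ≤-trans le (≤-reflexive (+-suc k (length t))) , more refl run

  resto-run : ∀ ts fl h p ok u {i f n b c d y w r l} →
    (resto fl h p ok , st i f n b c d y w ts u r l) ⇒⟨ suc (length ts) ⟩ (nextLit fl h p ok , st i f n b c d y w [] (ts ʳ++ u) r l)
  resto-run []       fl h p ok u = more refl done
  resto-run (a ∷ ts) fl h p ok u = more refl (resto-run ts fl h p ok (a ∷ u))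

  clrU-run : ∀ us fl h {i f n b c d y w t r l} →
    (clrU fl h , st i f n b c d y w t us r l) ⇒⟨ suc (length us) ⟩ (dec , st i f n b c d y w t [] (raw (encPVal (verdict fl h)) ∷ r) l)
  clrU-run []       fl h = more refl done
  clrU-run (a ∷ us) fl h = more refl (clrU-run us fl h)

  decR-run : ∀ ds c {i f n b y w t u r l} →
    (decR , st i f n b c ds y w t u r l) ⇒⟨ suc (length ds) ⟩ (scan noFlags , st i f n b (ds ʳ++ c) [] y w t u r l)
  decR-run []       c = more refl done
  decR-run (a ∷ ds) c = more refl (decR-run ds (a ∷ c))

  dec-nothing : ∀ cs d → decList cs ≡ nothing → ∃ λ d′ → ∀ {i f n b y w t u r l} →
    (dec , st i f n b (cols cs) d y w t u r l) ⇒⟨ suc (length cs) ⟩ (sim zero , st i f n b [] d′ y w t u r l)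
  dec-nothing []       d e = d , more refl done
  dec-nothing (v ∷ cs) d e with isZero v in z
  ... | true with decList cs in e′
  ...   | nothing with dec-nothing cs (inj₂ ones ∷ d) e′
  ...     | d′ , run = d′ , more (one z) run
    where
    one : isZero v ≡ true → ∀ {i f n b y w t u r l} → stackStep (dec , st i f n b (cols (v ∷ cs)) d y w t u r l)
             ≡ inj₁ (dec , st i f n b (cols cs) (inj₂ ones ∷ d) y w t u r l)
    one z rewrite z = refl

  dec-just : ∀ cs d {cs′} → decList cs ≡ just cs′ → ∃₂ λ c′ d′ → d′ ʳ++ c′ ≡ d ʳ++ cols cs′ × length d′ ≤ length cs + length d ×
    (∀ {i f n b y w t u r l} →
      (dec , st i f n b (cols cs) d y w t u r l) ⇒⟨ suc (length cs) ⟩ (decR , st i f n b c′ d′ y w t u r l))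
  dec-just (v ∷ cs) d e with isZero v in z
  dec-just (v ∷ cs) d refl | false = cols cs , inj₂ (decrement v) ∷ d , refl , s≤s (m≤n+m (length d) (length cs)) , more (one z) done
    where
    one : isZero v ≡ false → ∀ {i f n b y w t u r l} → stackStep (dec , st i f n b (cols (v ∷ cs)) d y w t u r l)
             ≡ inj₁ (decR , st i f n b (cols cs) (inj₂ (decrement v) ∷ d) y w t u r l)
    one z rewrite z = refl
  dec-just (v ∷ cs) d e | true with decList cs in e′
  dec-just (v ∷ cs) d refl | true | just cs″ with dec-just cs (inj₂ ones ∷ d) e′
  ... | c′ , d′ , eq , le , run = c′ , d′ , eq , ≤-trans le (≤-reflexive (+-suc (length cs) (length d))) , more (one z) run
    where
    one : isZero v ≡ true → ∀ {i f n b y w t u r l} → stackStep (dec , st i f n b (cols (v ∷ cs)) d y w t u r l)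
             ≡ inj₁ (dec , st i f n b (cols cs) (inj₂ ones ∷ d) y w t u r l)
    one z rewrite z = refl

-- Processing one row

length-halve : ∀ b ys → length ys ≡ 2 ^ suc b → length (halve ys) ≡ 2 ^ b
length-halve b ys e = go (2 ^ b) ys (trans e (*-comm 2 (2 ^ b)))
  where
  go : ∀ k ys → length ys ≡ k * 2 → length (halve ys) ≡ k
  go zero    []           e = refl
  go (suc k) (x ∷ y ∷ ys) e = cong suc (go k ys (suc-injective (suc-injective e)))

length-halve≤ : ∀ ys → length (halve ys) ≤ length ys
length-halve≤ []           = z≤n
length-halve≤ (x ∷ [])     = z≤n
length-halve≤ (x ∷ y ∷ ys) = s≤s (m≤n⇒m≤1+n (length-halve≤ ys))

length-table : ∀ b ys cs → length (table b ys cs) ≡ b * length cs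
length-table zero    ys cs = refl
length-table (suc b) ys cs = trans (length-++ (map _ cs)) (cong₂ _+_ (length-map _ cs) (length-table b (halve ys) cs))

-- Decrementing a row number held in columns

shiftBits : ℕ → ℕ → ℕ
shiftBits zero    j = j
shiftBits (suc k) j = shiftBits k ⌊ j /2⌋

bitsOf : ∀ k → ℕ → Vec Bool k
bitsOf k j = tabulate (λ c → bit j (toℕ c))

bit-shift : ∀ k j r → bit j (k + r) ≡ bit (shiftBits k j) r
bit-shift zero    j r = refl
bit-shift (suc k) j r = bit-shift k ⌊ j /2⌋ r

fill : ∀ k → Vec Bool k
fill k = vreplicate k true

decrement-borrow : ∀ k j → isZero (bitsOf k (suc j)) ≡ true →
  bitsOf k j ≡ fill k × ∃ λ h → shiftBits k (suc j) ≡ suc h × shiftBits k j ≡ h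
decrement-keep : ∀ k j → isZero (bitsOf k (suc j)) ≡ false →
  bitsOf k j ≡ decrement (bitsOf k (suc j)) × shiftBits k j ≡ shiftBits k (suc j)

private
  evenSuc : ∀ j → bit (suc (suc (j * 2))) 0 ≡ false
  evenSuc j = even-bit (suc j)

decrement-borrow zero    j z = refl , j , refl , refl
decrement-borrow (suc k) j z with parityOf j
decrement-borrow (suc k) .(i * 2) z | even i with bit (suc (i * 2)) 0 | odd-bit i
decrement-borrow (suc k) .(i * 2) () | even i | true | _
decrement-borrow (suc k) .(suc (i * 2)) z | odd i with bit (suc (suc (i * 2))) 0 | evenSuc i
... | false | _ with decrement-borrow k i (subst (λ h → isZero (bitsOf k h) ≡ true) (half-even (suc i)) z)
...   | e , h , e₁ , e₂ = cong₂ _∷_ (odd-bit i) (trans (cong (bitsOf k) (half-odd i)) e) , h ,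
        trans (cong (shiftBits k) (half-even (suc i))) e₁ , trans (cong (shiftBits k) (half-odd i)) e₂

decrement-keep zero    j ()
decrement-keep (suc k) j z with parityOf j
decrement-keep (suc k) .(i * 2) z | even i with bit (suc (i * 2)) 0 | odd-bit i
... | true | _ = cong₂ _∷_ (even-bit i) (cong (bitsOf k) (trans (half-even i) (sym (half-odd i)))) ,
                 cong (shiftBits k) (trans (half-even i) (sym (half-odd i)))
decrement-keep (suc k) .(suc (i * 2)) z | odd i with bit (suc (suc (i * 2))) 0 | evenSuc i
... | false | _ with decrement-keep k i (subst (λ h → isZero (bitsOf k h) ≡ false) (half-even (suc i)) z)
...   | e , e′ = cong₂ _∷_ (odd-bit i) (trans (cong (bitsOf k) (half-odd i)) (trans e (cong (λ h → decrement (bitsOf k h)) (sym (half-even (suc i)))))) ,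
        trans (cong (shiftBits k) (half-odd i)) (trans e′ (cong (shiftBits k) (sym (half-even (suc i)))))

-- The digits of `j` in base `2 ^ w`, lowest first; for `w = 9` this is `rowCols`.
columns : ∀ w → ℕ → ℕ → List (Vec Bool w)
columns w m j = applyUpTo (λ i → tabulate (λ c → bit j (w * i + toℕ c))) m

applyUpTo-cong : ∀ {X : Set} {g h : ℕ → X} m → (∀ i → g i ≡ h i) → applyUpTo g m ≡ applyUpTo h m
applyUpTo-cong zero    e = refl
applyUpTo-cong (suc m) e = cong₂ _∷_ (e 0) (applyUpTo-cong m (λ i → e (suc i)))

columns-suc : ∀ w m j → columns w (suc m) j ≡ bitsOf w j ∷ columns w m (shiftBits w j)
columns-suc w m j = cong₂ _∷_
  (tabulate-cong (λ c → cong (λ z → bit j (z + toℕ c)) (*-zeroʳ w)))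
  (applyUpTo-cong m (λ i → tabulate-cong (λ c →
    trans (cong (bit j) (trans (cong (_+ toℕ c) (*-suc w i)) (+-assoc w (w * i) (toℕ c)))) (bit-shift w j (w * i + toℕ c)))))

shiftBits-< : ∀ k j r → j < 2 ^ (k + r) → shiftBits k j < 2 ^ r
shiftBits-< zero    j r l = l
shiftBits-< (suc k) j r l = shiftBits-< k ⌊ j /2⌋ r (half< j (2 ^ (k + r)) l)
  where
  half< : ∀ j z → j < 2 * z → ⌊ j /2⌋ < z
  half< j z l with undouble j
  ... | false , i , refl = subst (_< z) (sym (half-even i)) (*-cancelʳ-< 2 i z (<-≤-trans l (≤-reflexive (*-comm 2 z))))
  ... | true  , i , refl = subst (_< z) (sym (half-odd i)) (*-cancelʳ-< 2 i z (≤-trans (n≤1+n _) (<-≤-trans l (≤-reflexive (*-comm 2 z)))))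

decListW : ∀ {w} → List (Vec Bool w) → Maybe (List (Vec Bool w))
decListW []      = nothing
decListW (v ∷ l) = if isZero v then mapMaybe (fill _ ∷_) (decListW l) else just (decrement v ∷ l)

decListW-columns : ∀ w m j → suc j < 2 ^ (m * w) → decListW (columns w m (suc j)) ≡ just (columns w m j)
decListW-columns w zero    j (s≤s ())
decListW-columns w (suc m) j l = trans (cong decListW (columns-suc w m (suc j))) (trans main (cong just (sym (columns-suc w m j))))
  where
  main : decListW (bitsOf w (suc j) ∷ columns w m (shiftBits w (suc j))) ≡ just (bitsOf w j ∷ columns w m (shiftBits w j))
  main with isZero (bitsOf w (suc j)) in z
  ... | false = cong just (cong₂ _∷_ (sym (proj₁ (decrement-keep w j z))) (cong (columns w m) (sym (proj₂ (decrement-keep w j z)))))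
  ... | true with decrement-borrow w j z
  ...   | e , h , e₁ , e₂ = trans
          (cong (mapMaybe (fill w ∷_)) (trans (cong (λ k → decListW (columns w m k)) e₁)
            (decListW-columns w m h (subst (_< 2 ^ (m * w)) e₁ (shiftBits-< w (suc j) (m * w) l)))))
          (cong just (cong₂ _∷_ (sym e) (cong (columns w m) (sym e₂))))

isZero-0 : ∀ w → isZero (bitsOf w 0) ≡ true
isZero-0 zero    = refl
isZero-0 (suc w) = isZero-0 w

shiftBits-0 : ∀ w → shiftBits w 0 ≡ 0
shiftBits-0 zero    = refl
shiftBits-0 (suc w) = shiftBits-0 w

decListW-zero : ∀ w m → decListW (columns w m 0) ≡ nothing
decListW-zero w zero    = refl
decListW-zero w (suc m) = trans (cong decListW (columns-suc w m 0)) (trans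
  (cong (λ b → if b then mapMaybe (fill w ∷_) (decListW (columns w m (shiftBits w 0))) else just (decrement (bitsOf w 0) ∷ columns w m (shiftBits w 0))) (isZero-0 w))
  (cong (mapMaybe (fill w ∷_)) (trans (cong (λ k → decListW (columns w m k)) (shiftBits-0 w)) (decListW-zero w m))))

columns-last : ∀ w m z → 0 < z → z ≡ 2 ^ (m * w) → columns w m (z ∸ 1) ≡ replicate m (fill w)
columns-last w zero    z       p e = refl
columns-last w (suc m) (suc j) p e = trans (columns-suc w m j) (cong₂ _∷_ (proj₁ bits) (columns-last w m (suc (shiftBits w j)) (s≤s z≤n) (proj₂ bits)))
  where
  full : ∀ k r j → suc j ≡ 2 ^ (k + r) → bitsOf k j ≡ fill k × suc (shiftBits k j) ≡ 2 ^ r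
  full zero    r j e = refl , e
  full (suc k) r j e with undouble j
  ... | false , i , refl = ⊥-elim (parity≢ i (2 ^ (k + r)) e)
    where
    parity≢ : ∀ i z → suc (i * 2) ≡ 2 * z → ⊥
    parity≢ i z e with trans (sym (odd-bit i)) (trans (cong (λ w → bit w 0) (trans e (*-comm 2 z))) (even-bit z))
    ... | ()
  ... | true , i , refl with full k r i (*-cancelʳ-≡ (suc i) (2 ^ (k + r)) 2 (trans e (*-comm 2 (2 ^ (k + r)))))
  ...   | e₁ , e₂ = cong₂ _∷_ (odd-bit i) (trans (cong (bitsOf k) (half-odd i)) e₁) ,
                    trans (cong (λ h → suc (shiftBits k h)) (half-odd i)) e₂
  bits : bitsOf w j ≡ fill w × suc (shiftBits w j) ≡ 2 ^ (m * w)
  bits = full w (m * w) j e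

decList≡ : ∀ l → decList l ≡ decListW l
decList≡ []      = refl
decList≡ (v ∷ l) = cong (λ z → if isZero v then mapMaybe (ones ∷_) z else just (decrement v ∷ l)) (decList≡ l)

abstract
  decList-rowCols : ∀ m j → suc j < 2 ^ (m * 9) → decList (rowCols m (suc j)) ≡ just (rowCols m j)
  decList-rowCols m j l = trans (decList≡ (columns 9 m (suc j))) (decListW-columns 9 m j l)

  decList-zero : ∀ m → decList (rowCols m 0) ≡ nothing
  decList-zero m = trans (decList≡ (columns 9 m 0)) (decListW-zero 9 m)

  rowCols-last : ∀ m → rowCols m (2 ^ (m * 9) ∸ 1) ≡ replicate m ones
  rowCols-last m = columns-last 9 m (2 ^ (m * 9)) (m^n>0 2 (m * 9)) refl

-- Row 0 ends up on top, since the rows are visited in descending order.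
stack-of : {X : Set} → (ℕ → X) → ℕ → List X → List X
stack-of g zero    r = g 0 ∷ r
stack-of g (suc j) r = stack-of g j (g (suc j) ∷ r)

stack-of-applyUpTo : ∀ {X : Set} (g : ℕ → X) j r → stack-of g j r ≡ applyUpTo g (suc j) ++ r
stack-of-applyUpTo g zero    r = refl
stack-of-applyUpTo g (suc j) r = trans (stack-of-applyUpTo g j (g (suc j) ∷ r))
  (trans (sym (++-assoc (applyUpTo g (suc j)) (g (suc j) ∷ []) r)) (cong (_++ r) (applyUpTo-∷ʳ g (suc j))))

toList-tabulate : ∀ {X Z : Set} (h : X → Z) (g : ℕ → X) k → toList (vmap h (tabulate {n = k} (λ i → g (toℕ i)))) ≡ applyUpTo (λ i → h (g i)) k
toList-tabulate h g zero    = refl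
toList-tabulate h g (suc k) = cong (h (g 0) ∷_) (toList-tabulate h (λ i → g (suc i)) k)

-- The cost of one row, counted in passes

module Phases (M : TM 4) where
  open Program M
  open Exec M

  clauseCode : ∀ {n} → Clause n → List (Fin 4)
  clauseCode c = concat (toList (vmap encLit c))

  body : ∀ {n} → CNF3 n → List (Fin 4)
  body φ = concat (map clauseCode φ)

  -- `q` exceeds the length of every list that a pass runs over. A pass then takes at most `q`
  -- steps, and only the number of passes has to be counted.
  module Costs (q : ℕ) (1≤q : 1 ≤ q) where

    infix 4 _⇒[_]_
    record _⇒[_]_ (c : Q × Store) (k : ℕ) (c′ : Q × Store) : Set where
      constructor wrap
      field unwrap : c ⇒⟨ k * q ⟩ c′
    open _⇒[_]_ public

    infixr 4 _⊕_
    _⊕_ : ∀ {c c′ c″ j k} → c ⇒[ j ] c′ → c′ ⇒[ k ] c″ → c ⇒[ j + k ] c″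
    _⊕_ {j = j} {k} (wrap r) (wrap s) = wrap (⇒-mono (≤-reflexive (sym (*-distribʳ-+ q j k))) (r ⨾ s))

    one : ∀ {c c′ t} → t ≤ q → c ⇒⟨ t ⟩ c′ → c ⇒[ 1 ] c′
    one le r = wrap (⇒-mono (≤-trans le (≤-reflexive (sym (+-identityʳ q)))) r)

    toʷ : ∀ {c c′ c″ t} → c′ ≡ c″ → c ⇒[ t ] c′ → c ⇒[ t ] c″
    toʷ refl r = r

    to : ∀ {c c′ c″ t} → c′ ≡ c″ → c ⇒⟨ t ⟩ c′ → c ⇒⟨ t ⟩ c″
    to refl r = r

    -- Each bit takes four passes: halving, returning the halved list to `Y`, appending a block to
    -- `T`, and restoring `C`. The extra pass discards the single column left at the end.
    tab-run : ∀ cs k ys fl t → length ys ≡ 2 ^ k → length ys < q → length cs < q → ∀ {i f n b u r l} →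
      (tab fl , st i f n b (cols cs) [] (cols ys) [] t u r l) ⇒[ k * 4 + 1 ]
      (revT fl , st i f n b (cols cs) [] [] [] (cols (table k ys cs) ʳ++ t) u r l)
    tab-run cs zero    (e ∷ [])     fl t len ly lc = one ly (more refl (more refl done))
    tab-run cs zero    (e ∷ _ ∷ _)  fl t ()  ly lc
    tab-run cs (suc k) []           fl t len ly lc = ⊥-elim (<-irrefl len (m^n>0 2 (suc k)))
    tab-run cs (suc k) (e ∷ [])     fl t len ly lc with 2 ^ k | m^n>0 2 k
    tab-run cs (suc k) (e ∷ [])     fl t len ly lc | suc z | _ = ⊥-elim (0≢1+n (trans (suc-injective len) (+-suc z (z + 0))))
    tab-run cs (suc k) (e ∷ o ∷ ys) fl t len ly lc {i} {f} {n} {b} {u} {r} {l} =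
      one (≤-trans (s≤s (s≤s (s≤s (≤-refl)))) ly) (more refl (more refl (split-run ys fl (meet ones e) (meet ones o) (inj₂ (meet e o) ∷ []))))
      ⊕ one hl (to (cong (λ y → app fl E O , st i f n b (cols cs) [] y [] t u r l) (ʳ++-involutive (cols H)))
                  (splR-run (cols H ʳ++ []) fl E O []))
      ⊕ one lc (app-run cs fl E O [] t)
      ⊕ one dl (to (cong (λ c → tab fl , st i f n b c [] (cols H) [] (cols (map (tableCol E O) cs) ʳ++ t) u r l) (ʳ++-involutive (cols cs)))
                  (appR-run (cols cs ʳ++ []) fl []))
      ⊕ toʷ (cong (λ t′ → revT fl , st i f n b (cols cs) [] [] [] t′ u r l) tables)
           (tab-run cs k H fl (cols (map (tableCol E O) cs) ʳ++ t) (length-halve k (e ∷ o ∷ ys) len)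
             (≤-<-trans (length-halve≤ (e ∷ o ∷ ys)) ly) lc)
      where
      E O : Col
      E = meetEven (meet ones e) ys
      O = meetOdd (meet ones o) ys
      H : List Col
      H = halve (e ∷ o ∷ ys)
      tables : cols (table k H cs) ʳ++ (cols (map (tableCol E O) cs) ʳ++ t) ≡ cols (map (tableCol E O) cs ++ table k H cs) ʳ++ t
      tables = sym (trans (cong (_ʳ++ t) (map-++ inj₂ (map (tableCol E O) cs) (table k H cs)))
                          (++-ʳ++ (cols (map (tableCol E O) cs))))
      len-rev : ∀ (l : List Col) → length (cols l ʳ++ []) ≡ length l
      len-rev l = trans (length-ʳ++-[] (cols l)) (length-map inj₂ l)
      hl : suc (length (cols H ʳ++ [])) ≤ q
      hl = ≤-trans (s≤s (≤-trans (≤-reflexive (len-rev H)) (length-halve≤ (e ∷ o ∷ ys)))) ly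
      dl : suc (length (cols cs ʳ++ [])) ≤ q
      dl = ≤-trans (s≤s (≤-reflexive (len-rev cs))) lc

    lit-run : ∀ {n′} (lt : Lit n′) rest us fl h p ok → suc (toℕ (proj₂ lt)) ≤ q → ∀ {i n b c d y w r l} →
      (clause fl h p ok , st i (map raw (encLit lt ++ rest)) n b c d y w [] (cols us) r l) ⇒[ 3 ]
      (nextLit fl h p (ok ∧ litFlag p (proj₁ lt) (nthMaybe us (toℕ (proj₂ lt)))) ,
       st (map raw (encLit lt) ʳ++ i) (map raw rest) n b c d y w [] (cols us) r l)
    lit-run (a , v) rest us fl h p ok le {i} {n} {b} {c} {d} {y} {w} {r} {l} = result
      where
      k : ℕ
      k = toℕ v
      x : Fin 4
      x = if a then s1 else s0
      digit-a : ∀ a → isDigit s1 (just (raw (if a then s1 else s0))) ≡ a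
      digit-a true  = refl
      digit-a false = refl
      first : (clause fl h p ok , st i (map raw (encLit (a , v) ++ rest)) n b c d y w [] (cols us) r l) ⇒[ 1 ]
              (walk fl h p ok a , st (raw x ∷ i) (map raw (replicate k s2 ++ s3 ∷ rest)) n b c d y w [] (cols us) r l)
      first = one 1≤q (to (cong₂ (λ z f′ → walk fl h p ok z , st (raw x ∷ i) (map raw f′) n b c d y w [] (cols us) r l)
                                 (digit-a a) (++-assoc (replicate k s2) (s3 ∷ []) rest)) (more refl done))
      result : (clause fl h p ok , st i (map raw (encLit (a , v) ++ rest)) n b c d y w [] (cols us) r l) ⇒[ 3 ]
        (nextLit fl h p (ok ∧ litFlag p a (nthMaybe us k)) , st (map raw (encLit (a , v)) ʳ++ i) (map raw rest) n b c d y w [] (cols us) r l)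
      result with walk-run k rest us {fl} {h} {p} {ok} {a} {raw x ∷ i} {n} {b} {c} {d} {y} {w} {r} {l} []
      ... | us′ , t′ , e , lt′ , run = first ⊕ one le run ⊕
            one (≤-trans (s≤s (≤-trans lt′ (≤-reflexive (+-identityʳ k)))) le)
              (to (cong (λ u → nextLit fl h p (ok ∧ litFlag p a (nthMaybe us k)) ,
                               st (map raw (encLit (a , v)) ʳ++ i) (map raw rest) n b c d y w [] u r l) e)
                  (resto-run t′ fl h p (ok ∧ litFlag p a (nthMaybe us k)) (cols us′)))

    clause-run : ∀ {n′} (cl : Clause n′) rest us fl h → n′ ≤ q → ∀ {i n b c d y w r l} →
      (clause fl h (# 0) true , st i (map raw (clauseCode cl ++ rest)) n b c d y w [] (cols us) r l) ⇒[ 9 ]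
      (clause fl (h ∨ clauseHit us cl) (# 0) true ,
       st (map raw (clauseCode cl) ʳ++ i) (map raw rest) n b c d y w [] (cols us) r l)
    clause-run (l₀ ∷ l₁ ∷ l₂ ∷ []) rest us fl h le {i} {n} {b} {c} {d} {y} {w} {r} {l} =
      from (lit-run l₀ (encLit l₁ ++ encLit l₂ ++ rest) us fl h (# 0) true (bound l₀)
        ⊕ lit-run l₁ (encLit l₂ ++ rest) us fl h (# 1) _ (bound l₁)
        ⊕ toʷ (cong (λ i′ → _ , st i′ (map raw rest) n b c d y w [] (cols us) r l) reversed)
             (lit-run l₂ rest us fl h (# 2) _ (bound l₂)))
      where
      bound : ∀ lt → suc (toℕ (proj₂ lt)) ≤ q
      bound lt = ≤-trans (Fin.toℕ<n (proj₂ lt)) le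
      code≡ : (encLit l₀ ++ encLit l₁ ++ encLit l₂ ++ []) ++ rest ≡ encLit l₀ ++ encLit l₁ ++ encLit l₂ ++ rest
      code≡ = trans (++-assoc (encLit l₀) _ rest) (cong (encLit l₀ ++_) (trans (++-assoc (encLit l₁) _ rest)
                (cong (encLit l₁ ++_) (trans (++-assoc (encLit l₂) [] rest) refl))))
      from : ∀ {c′} → (clause fl h (# 0) true , st i (map raw (encLit l₀ ++ encLit l₁ ++ encLit l₂ ++ rest)) n b c d y w [] (cols us) r l) ⇒[ 9 ] c′ →
        (clause fl h (# 0) true , st i (map raw (clauseCode (l₀ ∷ l₁ ∷ l₂ ∷ []) ++ rest)) n b c d y w [] (cols us) r l) ⇒[ 9 ] c′
      from {c′} = subst (λ f′ → (clause fl h (# 0) true , st i (map raw f′) n b c d y w [] (cols us) r l) ⇒[ 9 ] c′) (sym code≡)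
      reversed : map raw (encLit l₂) ʳ++ (map raw (encLit l₁) ʳ++ (map raw (encLit l₀) ʳ++ i)) ≡ map raw (clauseCode (l₀ ∷ l₁ ∷ l₂ ∷ [])) ʳ++ i
      reversed = sym (begin
        map raw (encLit l₀ ++ encLit l₁ ++ encLit l₂ ++ []) ʳ++ i
          ≡⟨ cong (λ z → map raw (encLit l₀ ++ encLit l₁ ++ z) ʳ++ i) (++-identityʳ (encLit l₂)) ⟩
        map raw (encLit l₀ ++ encLit l₁ ++ encLit l₂) ʳ++ i
          ≡⟨ cong (_ʳ++ i) (trans (map-++ raw (encLit l₀) _) (cong (map raw (encLit l₀) ++_) (map-++ raw (encLit l₁) (encLit l₂)))) ⟩
        (map raw (encLit l₀) ++ map raw (encLit l₁) ++ map raw (encLit l₂)) ʳ++ i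
          ≡⟨ ++-ʳ++ (map raw (encLit l₀)) ⟩
        (map raw (encLit l₁) ++ map raw (encLit l₂)) ʳ++ (map raw (encLit l₀) ʳ++ i)
          ≡⟨ ++-ʳ++ (map raw (encLit l₁)) ⟩
        map raw (encLit l₂) ʳ++ (map raw (encLit l₁) ʳ++ (map raw (encLit l₀) ʳ++ i)) ∎)
        where open ≡-Reasoning

    formula-run : ∀ {n′} (φ : CNF3 n′) us fl h → n′ ≤ q → ∀ {i n b c d y w r l} →
      (clause fl h (# 0) true , st i (map raw (body φ)) n b c d y w [] (cols us) r l) ⇒[ length φ * 9 ]
      (clause fl (formulaHit us h φ) (# 0) true , st (map raw (body φ) ʳ++ i) [] n b c d y w [] (cols us) r l)
    formula-run []       us fl h le = wrap done
    formula-run (cl ∷ φ) us fl h le {i} {n} {b} {c} {d} {y} {w} {r} {l} =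
      clause-run cl (body φ) us fl h le ⊕
      toʷ (cong (λ i′ → _ , st i′ [] n b c d y w [] (cols us) r l)
               (sym (trans (cong (_ʳ++ i) (map-++ raw (clauseCode cl) (body φ))) (++-ʳ++ (map raw (clauseCode cl))))))
         (formula-run φ us fl (h ∨ clauseHit us cl) le)

    module _ {n′ : ℕ} (φ : CNF3 n′) (k : ℕ) (n≤q : n′ ≤ q) (body<q : length (body φ) < q)
             (m<q : 2 ^ k < q) (km<q : k * 2 ^ k < q) where

      atRow : Q → List′ → List′ → List′ → Q × Store
      atRow s c d r = s , st [] (map raw (body φ)) [] [] c d [] [] [] [] r []

      -- Four passes for each bit and three for each literal. The seven others are `scan`, `copy`,
      -- the end of `tab`, `revT`, the end of the formula, `endF` and `clrU`.
      rowCost : ℕ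
      rowCost = k * 4 + (length φ * 9 + 7)

      row-run : ∀ cs r → length cs ≡ 2 ^ k →
        atRow (scan noFlags) (cols cs) [] r ⇒[ rowCost ] atRow dec (cols cs) [] (raw (encPVal (rowVal k φ cs)) ∷ r)
      row-run cs r len = subst (λ z → atRow (scan noFlags) (cols cs) [] r ⇒[ z ] atRow dec (cols cs) [] (raw (encPVal (rowVal k φ cs)) ∷ r)) arith
        (one lc (scan-run cs noFlags [])
         ⊕ one lrev (to (cong₂ (λ c y → tab fl , st [] f [] [] c [] y [] [] [] r []) (ʳ++-involutive (cols cs)) (ʳ++-involutive (cols cs)))
                        (copy-run (cols cs ʳ++ []) fl [] []))
         ⊕ tab-run cs k cs fl [] len lc lc
         ⊕ one lT (to (cong (λ u → clause fl false (# 0) true , st [] f [] [] (cols cs) [] [] [] [] u r []) (ʳ++-involutive (cols tb)))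
                      (revT-run (cols tb ʳ++ []) fl []))
         ⊕ formula-run φ tb fl false n≤q
         ⊕ one 1≤q (more refl done)
         ⊕ one lF (to (cong (λ f′ → clrU fl h , st [] f′ [] [] (cols cs) [] [] [] [] (cols tb) r []) (ʳ++-involutive f))
                      (endF-run fl h (f ʳ++ []) []))
         ⊕ one lU (to (cong (λ v → atRow dec (cols cs) [] (raw (encPVal v) ∷ r)) (sym (rowVal-def k φ cs))) (clrU-run (cols tb) fl h)))
        where
        f : List′
        f = map raw (body φ)
        fl : Flags
        fl = flags cs
        tb : List Col
        tb = table k cs cs
        h : Bool
        h = formulaHit tb false φ
        lc : length cs < q
        lc = ≤-trans (s≤s (≤-reflexive len)) m<q
        len-rev : ∀ (l : List Col) → length (cols l ʳ++ []) ≡ length l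
        len-rev l = trans (length-ʳ++-[] (cols l)) (length-map inj₂ l)
        lrev : suc (length (cols cs ʳ++ [])) ≤ q
        lrev = ≤-trans (s≤s (≤-reflexive (len-rev cs))) lc
        ltb : length tb < q
        ltb = ≤-trans (s≤s (≤-reflexive (trans (length-table k cs cs) (cong (k *_) len)))) km<q
        lT : suc (length (cols tb ʳ++ [])) ≤ q
        lT = ≤-trans (s≤s (≤-reflexive (len-rev tb))) ltb
        lU : suc (length (cols tb)) ≤ q
        lU = ≤-trans (s≤s (≤-reflexive (length-map inj₂ tb))) ltb
        lF : suc (length (f ʳ++ [])) ≤ q
        lF = ≤-trans (s≤s (≤-reflexive (trans (length-ʳ++-[] f) (length-map raw (body φ))))) body<q
        arith : 1 + (1 + (k * 4 + 1 + (1 + (length φ * 9 + (1 + (1 + 1)))))) ≡ rowCost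
        arith = begin
          2 + (k * 4 + 1 + (1 + (length φ * 9 + 3)))   ≡⟨ cong (2 +_) (+-assoc (k * 4) 1 _) ⟩
          2 + (k * 4 + (2 + (length φ * 9 + 3)))       ≡⟨ +-comm 2 _ ⟩
          k * 4 + (2 + (length φ * 9 + 3)) + 2         ≡⟨ +-assoc (k * 4) _ 2 ⟩
          k * 4 + (2 + (length φ * 9 + 3) + 2)         ≡⟨ cong (λ z → k * 4 + (z + 2)) (+-comm 2 (length φ * 9 + 3)) ⟩
          k * 4 + (length φ * 9 + 3 + 2 + 2)           ≡⟨ cong (k * 4 +_) (trans (+-assoc (length φ * 9 + 3) 2 2) (+-assoc (length φ * 9) 3 4)) ⟩
          k * 4 + (length φ * 9 + 7)                   ≡⟨ refl ⟩
          k * 4 + (length φ * 9 + 7)                   ∎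
          where open ≡-Reasoning

-- The whole run

-- The number of variables that b growth rounds provide room for.
cap : ℕ → ℕ
cap zero    = 0
cap (suc b) = cap b + b * 2 ^ b

popN-replicate : ∀ {X : Set} k n (x : X) → popN k (replicate n x) ≡ replicate (n ∸ k) x
popN-replicate zero    n       x = refl
popN-replicate (suc k) zero    x = popN-replicate-[] k
  where
  popN-replicate-[] : ∀ {X : Set} k → popN {X} k [] ≡ []
  popN-replicate-[] zero    = refl
  popN-replicate-[] (suc k) = popN-replicate-[] k
popN-replicate (suc k) (suc n) x = popN-replicate k n x

binary-zero : ∀ w → binary w 0 ≡ replicate w s0
binary-zero zero    = refl
binary-zero (suc w) = cong (s0 ∷_) (binary-zero w)

-- With `s = 9` this is the size parameter: the machine can write it digit by digit without any
-- arithmetic.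
binary-shift : ∀ b w s → binary (b + w) (s * 2 ^ b) ≡ replicate b s0 ++ binary w s
binary-shift zero    w s = cong (binary w) (*-identityʳ s)
binary-shift (suc b) w s = trans (cong (binary (suc (b + w))) shape) (cong₂ _∷_ digit₀
  (trans (cong (binary (b + w)) (half-even (s * 2 ^ b))) (binary-shift b w s)))
  where
  shape : s * (2 * 2 ^ b) ≡ (s * 2 ^ b) * 2
  shape = trans (cong (s *_) (*-comm 2 (2 ^ b))) (sym (*-assoc s (2 ^ b) 2))
  digit₀ : (if bit (s * 2 ^ b * 2) 0 then s1 else s0) ≡ s0
  digit₀ = cong (λ z → if z then s1 else s0) (even-bit (s * 2 ^ b))

n<2^n : ∀ n → n < 2 ^ n
n<2^n zero    = s≤s z≤n
n<2^n (suc n) = ≤-trans (+-mono-≤ (m^n>0 2 n) (n<2^n n)) (≤-reflexive (cong (2 ^ n +_) (sym (+-identityʳ (2 ^ n)))))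

module Whole (M : TM 4) where
  open Program M
  open Exec M
  open Phases M

  module Simulation where

    -- The head symbol is on top of `R`; but a head that has just reached a fresh cell finds `R`
    -- empty, which stands for a blank.
    data RightPart : Letter → List Letter → List′ → Set where
      full  : ∀ {h r} → RightPart h r (inj₁ h ∷ map inj₁ r)
      empty : RightPart nothing [] []

    right-head : ∀ {h r rr} → RightPart h r rr → letterOf (head rr) ≡ h
    right-head full  = refl
    right-head empty = refl

    right-tail : ∀ {h r rr} → RightPart h r rr → actOn pop rr ≡ map inj₁ r
    right-tail full  = refl
    right-tail empty = refl

    module _ {i f n b c d y w t u : List′} where

      S : List Letter → List′ → Store
      S l rr = st i f n b c d y w t u rr (map inj₁ l)

      first : ∀ {q l h r rr z} → RightPart h r rr → TM.δ M q h ≡ z →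
        stackStep (sim q , S l rr) ≡ after (S l rr) (simulate z)
      first {q} {l} {rr = rr} R e = cong (λ z → after (S l rr) (simulate z)) (trans (cong (TM.δ M q) (right-head R)) e)

      to-right : ∀ r → ∃₂ λ h r′ → RightPart h r′ (map inj₁ r) × (∀ {q l w} → move M q l w r right ≡ conf q (w ∷ l) h r′)
      to-right []      = nothing , [] , empty , λ { {l = []} → refl ; {l = _ ∷ _} → refl }
      to-right (a ∷ r) = a , r , full , λ { {l = []} → refl ; {l = _ ∷ _} → refl }

      move-stay′ : ∀ {q w} l r → move M q l w r stay ≡ conf q l w r
      move-stay′ []      []      = refl
      move-stay′ []      (_ ∷ _) = refl
      move-stay′ (_ ∷ _) []      = refl
      move-stay′ (_ ∷ _) (_ ∷ _) = refl

      move-left-[] : ∀ {q w} r → move M q [] w r left ≡ conf q [] w r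
      move-left-[] []      = refl
      move-left-[] (_ ∷ _) = refl

      move-left-∷ : ∀ {q a l w} r → move M q (a ∷ l) w r left ≡ conf q l a (w ∷ r)
      move-left-∷ []      = refl
      move-left-∷ (_ ∷ _) = refl

      moves : ∀ q′ w m l {h r rr} → RightPart h r rr → ∀ {q} → TM.δ M q h ≡ (inj₁ q′ , w , m) →
        ∃ λ rr′ → let c′ = move M q′ l w r m in RightPart (Config.hd c′) (Config.rgt c′) rr′ ×
          (sim q , S l rr) ⇒⟨ 3 ⟩ (sim (Config.state c′) , S (Config.lft c′) rr′)
      moves q′ w right l {r = r} {rr} R {q} e with to-right r
      ... | h′ , r′ , R′ , eq rewrite eq {q′} {l} {w} = map inj₁ r , R′ ,
            more (trans (first {l = l} R e) (cong (λ z → inj₁ (sim q′ , S (w ∷ l) z)) (right-tail R))) done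
      moves q′ w stay l {r = r} {rr} R {q} e rewrite move-stay′ {q′} {w} l r = inj₁ w ∷ map inj₁ r , full ,
            more (trans (first {l = l} R e) (cong (λ z → inj₁ (simW q′ w false , S l z)) (right-tail R))) (more refl done)
      moves q′ w left [] {r = r} {rr} R {q} e rewrite move-left-[] {q′} {w} r = inj₁ w ∷ map inj₁ r , full ,
            more (trans (first {l = []} R e) (cong (λ z → inj₁ (simW q′ w true , S [] z)) (right-tail R))) (more refl (more refl done))
      moves q′ w left (a ∷ l) {r = r} {rr} R {q} e rewrite move-left-∷ {q′} {a} {l} {w} r = inj₁ a ∷ inj₁ w ∷ map inj₁ r , full ,
            more (trans (first {l = a ∷ l} R e) (cong (λ z → inj₁ (simW q′ w true , S (a ∷ l) z)) (right-tail R))) (more refl (more refl done))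

      step-view : ∀ q l h r → (∃ λ b′ → ∃₂ λ w m → TM.δ M q h ≡ (inj₂ b′ , w , m) × step M (conf q l h r) ≡ inj₂ b′)
        ⊎ (∃₂ λ q′ w → ∃ λ m → TM.δ M q h ≡ (inj₁ q′ , w , m) × step M (conf q l h r) ≡ inj₁ (move M q′ l w r m))
      step-view q l h r with TM.δ M q h
      ... | inj₂ b′ , w , m = inj₁ (b′ , w , m , refl , refl)
      ... | inj₁ q′ , w , m = inj₂ (q′ , w , m , refl , refl)

      -- The factor 3 comes from a move to the left: pop the head symbol, write its replacement,
      -- fetch the new head symbol from `L`.
      sim-halts : ∀ k q l h r rr b′ → RightPart h r rr → exec M k (inj₁ (conf q l h r)) ≡ inj₂ b′ →
        ∃ λ z → (sim q , S l rr) ⇒⟨ k * 3 ⟩ z × stackStep z ≡ inj₂ b′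
      sim-halts (suc k) q l h r rr b′ R e with step-view q l h r
      ... | inj₁ (b″ , w , m , eδ , es) = (sim q , S l rr) , done , trans (first {l = l} R eδ) (cong inj₂ (halted k (trans (cong (exec M k) (sym es)) e)))
        where
        halted : ∀ k → exec M k (inj₂ b″) ≡ inj₂ b′ → b″ ≡ b′
        halted zero    refl = refl
        halted (suc k) refl = refl
      ... | inj₂ (q′ , w , m , eδ , es) with moves q′ w m l R eδ
      ...   | rr′ , R′ , run with sim-halts k _ _ _ _ rr′ b′ R′ (trans (cong (exec M k) (sym es)) e)
      ...     | z , run′ , hz = z , run ⨾ run′ , hz

      sim-input : ∀ k x b′ → exec M k (inj₁ (initConf M x)) ≡ inj₂ b′ →
        ∃ λ z → (sim zero , S [] (map raw x)) ⇒⟨ k * 3 ⟩ z × stackStep z ≡ inj₂ b′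
      sim-input k []      b′ e = sim-halts k zero [] nothing [] [] b′ empty e
      sim-input k (a ∷ x) b′ e = subst (λ z → ∃ λ z′ → (sim zero , S [] (raw a ∷ z)) ⇒⟨ k * 3 ⟩ z′ × stackStep z′ ≡ inj₂ b′)
        (raws x) (sim-halts k zero [] (inSym M a) (map (inSym M) x) _ b′ full e)
        where
        raws : ∀ x → map inj₁ (map (inSym M) x) ≡ map raw x
        raws []      = refl
        raws (a ∷ x) = cong (raw a ∷_) (raws x)

  length-body : ∀ {n} (φ : CNF3 n) → length φ ≤ length (body φ)
  length-body []      = z≤n
  length-body (c ∷ φ) = ≤-trans (+-mono-≤ (nonempty c) (length-body φ)) (≤-reflexive (sym (length-++ (clauseCode c))))
    where
    nonempty : ∀ {n} (c : Clause n) → 1 ≤ length (clauseCode c)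
    nonempty ((true  , v) ∷ _ ∷ _ ∷ []) = s≤s z≤n
    nonempty ((false , v) ∷ _ ∷ _ ∷ []) = s≤s z≤n

  -- A single `q` above the input length and not below the number of rows dominates `n`, `b`, `m`
  -- and `b * m` as well.
  module Total {n : ℕ} (φ : CNF3 n) (b : ℕ) (q : ℕ) (enough : n ≤ cap b) (few : ∀ b′ → b′ < b → cap b′ < n)
    (x<q : length (encCNF3 n φ) < q) (big : 2 ^ (2 ^ b * 9) ≤ q) where

    m #rows : ℕ
    m = 2 ^ b
    #rows = 2 ^ (m * 9)

    bm<#rows : suc b * m < #rows
    bm<#rows = begin-strict
      suc b * m      ≤⟨ *-monoˡ-≤ m (n<2^n b) ⟩
      m * m          <⟨ *-mono-< (n<2^n m) (n<2^n m) ⟩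
      2 ^ m * 2 ^ m  ≡⟨ sym (^-distribˡ-+-* 2 m m) ⟩
      2 ^ (m + m)    ≤⟨ ^-monoʳ-≤ 2 (≤-trans (≤-reflexive (trans (cong (m +_) (sym (+-identityʳ m))) (*-comm 2 m))) (*-monoʳ-≤ m (s≤s (s≤s z≤n)))) ⟩
      #rows              ∎
      where open ≤-Reasoning

    bm<q : b * m < q
    bm<q = <-≤-trans (≤-<-trans (m≤n+m (b * m) m) bm<#rows) big

    m<q : m < q
    m<q = <-≤-trans (≤-<-trans (m≤m+n m (b * m)) bm<#rows) big

    1≤q : 1 ≤ q
    1≤q = ≤-trans (s≤s z≤n) m<q

    b<q : b < q
    b<q = <-trans (n<2^n b) m<q

    length-x : length (encCNF3 n φ) ≡ n + suc (length (body φ))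
    length-x = trans (length-++ (replicate n s1)) (cong (_+ suc (length (body φ))) (length-replicate n))

    n<q : n < q
    n<q = ≤-<-trans (≤-trans (m≤m+n n (suc (length (body φ)))) (≤-reflexive (sym length-x))) x<q

    body<q : length (body φ) < q
    body<q = ≤-<-trans (≤-trans (≤-trans (n≤1+n _) (m≤n+m (suc (length (body φ))) n)) (≤-reflexive (sym length-x))) x<q

    open Costs q 1≤q

    F₀ : List′
    F₀ = map raw (body φ)

    g : ℕ → A
    g j = raw (encPVal (rowVal b φ (rowCols m j)))

    rowAt : Q → List′ → List′ → List′ → Q × Store
    rowAt = atRow φ b (<⇒≤ n<q) body<q m<q bm<q

    rowC : ℕ
    rowC = b * 4 + (length φ * 9 + 7)

    -- The 2 added to the cost of a row pays for decrementing and for restoring the columns. At row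
    -- 0 the decrement fails, and the machine enters the simulation with the row entries in
    -- ascending order on the stack.
    rows-run : ∀ j r → j < #rows → ∃ λ d → rowAt (scan noFlags) (cols (rowCols m j)) [] r ⇒[ suc j * (rowC + 2) ] rowAt (sim zero) [] d (stack-of g j r)
    rows-run zero r l with dec-nothing (rowCols m 0) [] (decList-zero m)
    ... | d , run = d , wrap (⇒-mono (*-monoˡ-≤ q (≤-trans (+-monoʳ-≤ rowC (s≤s z≤n)) (m≤m+n (rowC + 2) 0)))
          (unwrap (row-run φ b (<⇒≤ n<q) body<q m<q bm<q (rowCols m 0) r (length-applyUpTo (colAt 0) m)
            ⊕ one (≤-trans (s≤s (≤-reflexive (length-applyUpTo (colAt 0) m))) m<q) run)))
    rows-run (suc j) r l with dec-just (rowCols m (suc j)) [] (decList-rowCols m j l) | rows-run j (g (suc j) ∷ r) (<-trans ≤-refl l)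
    ... | c′ , d′ , e , le , run | d , rest = d , wrap (⇒-mono (≤-reflexive (cong (_* q) (sym (+-assoc rowC 2 (suc j * (rowC + 2))))))
          (unwrap (row-run φ b (<⇒≤ n<q) body<q m<q bm<q (rowCols m (suc j)) r (length-applyUpTo (colAt (suc j)) m)
            ⊕ (one (≤-trans (s≤s (≤-reflexive (length-applyUpTo (colAt (suc j)) m))) m<q) run
            ⊕ one (≤-trans (s≤s (≤-trans le (≤-reflexive (trans (+-identityʳ _) (length-applyUpTo (colAt (suc j)) m))))) m<q)
                  (to (cong (λ c → rowAt (scan noFlags) c [] (g (suc j) ∷ r)) e) (decR-run d′ c′)))
            ⊕ rest)))

    roundBound : ∀ b′ m′ → b′ ≤ q → m′ ≤ q → roundCost b′ m′ ≤ 15 * (q * q)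
    roundBound b′ m′ lb lm = begin
      1 + (suc (b′ * (3 + (m′ + m′))) + (suc b′ + (suc (m′ * 2) + suc (m′ + m′))))
        ≤⟨ +-mono-≤ 1≤p (+-mono-≤ (+-mono-≤ 1≤p (*-mono-≤ lb (+-mono-≤ (*-monoʳ-≤ 3 1≤q) (+-mono-≤ lm lm))))
             (+-mono-≤ (+-mono-≤ 1≤p (≤-trans lb q≤p)) (+-mono-≤ (+-mono-≤ 1≤p (*-monoˡ-≤ 2 (≤-trans lm q≤p)))
                (+-mono-≤ 1≤p (+-mono-≤ (≤-trans lm q≤p) (≤-trans lm q≤p)))))) ⟩
      p + ((p + q * (3 * q + (q + q))) + ((p + p) + ((p + p * 2) + (p + (p + p)))))
        ≡⟨ solve 1 (λ q → let p = q :* q in p :+ ((p :+ q :* (con 3 :* q :+ (q :+ q))) :+ ((p :+ p) :+ ((p :+ p :* con 2) :+ (p :+ (p :+ p)))))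
                    := con 15 :* (q :* q)) refl q ⟩
      15 * (q * q) ∎
      where
      open ≤-Reasoning
      open +-*-Solver
      p : ℕ
      p = q * q
      1≤p : 1 ≤ p
      1≤p = *-mono-≤ 1≤q 1≤q
      q≤p : q ≤ p
      q≤p = ≤-trans (≤-reflexive (sym (*-identityʳ q))) (*-monoʳ-≤ q 1≤q)

    -- `few` keeps `N` nonempty before round `b`, and `enough` makes it empty then; so the machine
    -- finds the same `b` as the correctness proof uses.
    grow-run : ∀ j b′ ns bs → length bs ≡ b′ → length ns ≡ n ∸ cap b′ → j + b′ ≡ b → ∃ λ bs′ → length bs′ ≡ b ×
      (grow , st [] F₀ ns bs (blanks (2 ^ b′)) [] [] [] [] [] [] []) ⇒⟨ 1 + j * (15 * (q * q)) ⟩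
      (pad , st [] F₀ [] bs′ (blanks m) [] [] [] [] [] [] [])
    grow-run zero b′ [] bs eb en refl = bs , eb , ⇒-mono (s≤s z≤n) grow-end
    grow-run zero b′ (a ∷ ns) bs eb en refl = ⊥-elim (1+n≢0 (trans en (m≤n⇒m∸n≡0 enough)))
    grow-run (suc j) b′ [] bs eb en ej = ⊥-elim (<⇒≱ (few b′ (≤-trans (s≤s (m≤n+m b′ j)) (≤-reflexive ej))) (m∸n≡0⇒m≤n (sym en)))
    grow-run (suc j) b′ (a ∷ ns) bs eb en ej
      with grow-run j (suc b′) (popN (length bs * 2 ^ b′) (a ∷ ns)) (raw s0 ∷ bs) (cong suc eb) len (trans (+-suc j b′) ej)
      where
      len : length (popN (length bs * 2 ^ b′) (a ∷ ns)) ≡ n ∸ cap (suc b′)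
      len = trans (length-popN (length bs * 2 ^ b′) (a ∷ ns)) (trans (cong₂ (λ u v → u ∸ v * 2 ^ b′) en eb) (∸-+-assoc n (cap b′) (b′ * 2 ^ b′)))
    ... | bs′ , eb′ , run = bs′ , eb′ , ⇒-mono bound
          (subst (λ k → (grow , st [] F₀ (a ∷ ns) bs (blanks (2 ^ b′)) [] [] [] [] [] [] []) ⇒⟨ roundCost (length bs) (2 ^ b′) ⟩
                        (grow , st [] F₀ (popN (length bs * 2 ^ b′) (a ∷ ns)) (raw s0 ∷ bs) (blanks k) [] [] [] [] [] [] []))
                 (cong (2 ^ b′ +_) (sym (+-identityʳ (2 ^ b′)))) (grow-round a ns bs (2 ^ b′)) ⨾ run)
      where
      b′≤b : b′ ≤ b
      b′≤b = ≤-trans (m≤n+m b′ (suc j)) (≤-reflexive ej)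
      bound : roundCost (length bs) (2 ^ b′) + (1 + j * (15 * (q * q))) ≤ 1 + (15 * (q * q) + j * (15 * (q * q)))
      bound = ≤-trans (≤-reflexive (+-suc (roundCost (length bs) (2 ^ b′)) (j * (15 * (q * q))))) (s≤s (+-monoˡ-≤ (j * (15 * (q * q))) (roundBound (length bs) (2 ^ b′)
        (≤-trans (≤-reflexive eb) (≤-trans b′≤b (<⇒≤ b<q))) (≤-trans (^-monoʳ-≤ 2 b′≤b) (<⇒≤ m<q)))))

    tail₀ : List (Fin 4)
    tail₀ = s3 ∷ binary (suc (m * 9)) (m * 9)

    padded : ∀ k → k ≡ b → raw s3 ∷ pushN (raw s0) k (raw s1 ∷ raw s0 ∷ raw s0 ∷ raw s1 ∷ popN 4 (popN k (pushN (raw s0) (suc (m * 9)) [])))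
      ≡ map raw tail₀
    padded k refl = cong (raw s3 ∷_) (begin
      pushN z b (raw s1 ∷ z ∷ z ∷ raw s1 ∷ popN 4 (popN b (pushN z (suc (m * 9)) [])))
        ≡⟨ pushN-replicate z b _ ⟩
      replicate b z ++ raw s1 ∷ z ∷ z ∷ raw s1 ∷ popN 4 (popN b (pushN z (suc (m * 9)) []))
        ≡⟨ cong (λ l → replicate b z ++ raw s1 ∷ z ∷ z ∷ raw s1 ∷ l) rest ⟩
      replicate b z ++ raw s1 ∷ z ∷ z ∷ raw s1 ∷ replicate v z
        ≡⟨ cong₂ (λ l l′ → l ++ raw s1 ∷ z ∷ z ∷ raw s1 ∷ l′) (sym (map-replicate raw b s0)) (sym (map-replicate raw v s0)) ⟩
      map raw (replicate b s0) ++ map raw (s1 ∷ s0 ∷ s0 ∷ s1 ∷ replicate v s0)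
        ≡⟨ sym (map-++ raw (replicate b s0) _) ⟩
      map raw (replicate b s0 ++ s1 ∷ s0 ∷ s0 ∷ s1 ∷ replicate v s0)
        ≡⟨ cong (λ l → map raw (replicate b s0 ++ s1 ∷ s0 ∷ s0 ∷ s1 ∷ l)) (sym (binary-zero v)) ⟩
      map raw (replicate b s0 ++ binary (4 + v) 9)
        ≡⟨ cong (map raw) (sym (binary-shift b (4 + v) 9)) ⟩
      map raw (binary (b + (4 + v)) (9 * m))
        ≡⟨ cong₂ (λ k s → map raw (binary k s)) width (*-comm 9 m) ⟩
      map raw (binary (suc (m * 9)) (m * 9)) ∎)
      where
      open ≡-Reasoning
      z : A
      z = raw s0
      v : ℕ
      v = suc (m * 9) ∸ b ∸ 4
      rest : popN 4 (popN b (pushN z (suc (m * 9)) [])) ≡ replicate v z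
      rest = trans (cong (λ l → popN 4 (popN b l)) (trans (pushN-replicate z (suc (m * 9)) []) (++-identityʳ _)))
               (trans (cong (popN 4) (popN-replicate b (suc (m * 9)) z)) (popN-replicate 4 (suc (m * 9) ∸ b) z))
      fits : b + 4 ≤ suc (m * 9)
      fits = ≤-trans (+-mono-≤ (<⇒≤ (n<2^n b)) (≤-trans (s≤s (s≤s (s≤s (s≤s z≤n)))) (*-monoˡ-≤ 8 (m^n>0 2 b))))
               (≤-trans (≤-reflexive (trans (cong (_+ m * 8) (sym (*-identityʳ m))) (sym (*-distribˡ-+ m 1 8)))) (n≤1+n (m * 9)))
      width : b + (4 + v) ≡ suc (m * 9)
      width = trans (sym (+-assoc b 4 v)) (trans (cong (b + 4 +_) (∸-+-assoc (suc (m * 9)) b 4)) (m+[n∸m]≡n fits))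

    pad-all : ∀ bs → length bs ≡ b →
      (pad , st [] F₀ [] bs (blanks m) [] [] [] [] [] [] []) ⇒[ 21 ] rowAt (scan noFlags) (cols (rowCols m (#rows ∸ 1))) [] (map raw tail₀)
    pad-all bs eb = wrap (⇒-mono small (pad-run (blanks m) 0 [] ⨾ padB-run bs [] _ ⨾ fix-run _ ⨾ padZ-run (bs ʳ++ []) _ ⨾
        to (cong₂ (λ c r → rowAt (scan noFlags) c [] r) full-cols tail≡) (padR-run (fulls (length (blanks m) + 0)) [])))
      where
      lm : length (blanks m) ≡ m
      lm = length-replicate m
      full-cols : fulls (length (blanks m) + 0) ʳ++ [] ≡ cols (rowCols m (#rows ∸ 1))
      full-cols = trans (replicate-ʳ++ _ (length (blanks m) + 0) 0) (trans (cong fulls (trans (+-identityʳ _) (trans (+-identityʳ _) lm)))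
                    (sym (trans (cong cols (rowCols-last m)) (map-replicate inj₂ m ones))))
      tail≡ : raw s3 ∷ pushN (raw s0) (length (bs ʳ++ [])) (raw s1 ∷ raw s0 ∷ raw s0 ∷ raw s1 ∷ popN 4 (popN (length bs) (pushN (raw s0) (suc (length (blanks m) * 9)) [])))
        ≡ map raw tail₀
      tail≡ = trans (cong₂ (λ k k′ → raw s3 ∷ pushN (raw s0) k (raw s1 ∷ raw s0 ∷ raw s0 ∷ raw s1 ∷ popN 4 (popN (length bs) (pushN (raw s0) (suc (k′ * 9)) []))))
                (length-ʳ++-[] bs) lm) (padded (length bs) eb)
      small : suc (length (blanks m) * 9) + (suc (length bs) + (8 + (suc (length (bs ʳ++ [])) + suc (length (fulls (length (blanks m) + 0)))))) ≤ 21 * q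
      small = begin
        suc (length (blanks m) * 9) + (suc (length bs) + (8 + (suc (length (bs ʳ++ [])) + suc (length (fulls (length (blanks m) + 0))))))
          ≡⟨ cong₂ (λ u v → suc (u * 9) + v) lm (cong₂ (λ u v → suc u + (8 + v)) eb (cong₂ (λ u v → suc u + suc v) (trans (length-ʳ++-[] bs) eb)
               (trans (length-replicate _) (trans (+-identityʳ _) lm)))) ⟩
        suc (m * 9) + (suc b + (8 + (suc b + suc m)))
          ≤⟨ +-mono-≤ (+-mono-≤ 1≤q (*-monoˡ-≤ 9 (<⇒≤ m<q))) (+-mono-≤ b<q (+-mono-≤ (*-monoʳ-≤ 8 1≤q) (+-mono-≤ b<q m<q))) ⟩
        (q + q * 9) + (q + (8 * q + (q + q)))
          ≡⟨ solve 1 (λ q → (q :+ q :* con 9) :+ (q :+ (con 8 :* q :+ (q :+ q))) := con 21 :* q) refl q ⟩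
        21 * q ∎
        where
        open ≤-Reasoning
        open +-*-Solver

    reduced : List (Fin 4)
    reduced = encMBPSP (m * 9) (instanceOf b φ) (m * 9)

    stack-reduced : stack-of g (#rows ∸ 1) (map raw tail₀) ≡ map raw reduced
    stack-reduced = begin
      stack-of g (#rows ∸ 1) (map raw tail₀)                 ≡⟨ stack-of-applyUpTo g (#rows ∸ 1) (map raw tail₀) ⟩
      applyUpTo g (suc (#rows ∸ 1)) ++ map raw tail₀         ≡⟨ cong (λ k → applyUpTo g k ++ map raw tail₀) (m+[n∸m]≡n (m^n>0 2 (m * 9))) ⟩
      applyUpTo g #rows ++ map raw tail₀                     ≡⟨ cong (_++ map raw tail₀) (sym (map-applyUpTo (λ j → encPVal (rowVal b φ (rowCols m j))) raw #rows)) ⟩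
      map raw (applyUpTo (λ j → encPVal (rowVal b φ (rowCols m j))) #rows) ++ map raw tail₀
        ≡⟨ sym (map-++ raw _ tail₀) ⟩
      map raw (applyUpTo (λ j → encPVal (rowVal b φ (rowCols m j))) #rows ++ tail₀)
        ≡⟨ cong (λ l → map raw (l ++ tail₀)) (sym (toList-tabulate encPVal (λ j → rowVal b φ (rowCols m j)) #rows)) ⟩
      map raw (toList (vmap encPVal (tabulate {n = #rows} (λ j → rowVal b φ (rowCols m (toℕ j))))) ++ tail₀)
        ≡⟨ cong (λ v → map raw (toList (vmap encPVal v) ++ tail₀)) (sym (instanceOf-def b φ)) ⟩
      map raw reduced ∎
      where open ≡-Reasoning

    startσ : Store
    startσ = st (map raw (encCNF3 n φ) ʳ++ []) [] [] [] [] [] [] [] [] [] [] []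

    total : ∃ λ d → (rev , startσ) ⇒⟨ 70 * (q * q * q) ⟩ (sim zero , st [] F₀ [] [] [] d [] [] [] [] (map raw reduced) [])
    total with grow-run b 0 (pushN (raw s0) n []) [] refl (trans (length-pushN (raw s0) n []) (+-identityʳ n)) (+-identityʳ b)
             | rows-run (#rows ∸ 1) (map raw tail₀) (≤-reflexive (m+[n∸m]≡n (m^n>0 2 (m * 9))))
    ... | bs , eb , grown | d , rows = d , ⇒-mono bound (part₁ ⨾ part₂ ⨾ grown ⨾ unwrap (pad-all bs eb) ⨾
            to (cong (λ r → rowAt (sim zero) [] d r) stack-reduced) (unwrap rows))
      where
      x′ : List′
      x′ = map raw (encCNF3 n φ)
      part₁ : (rev , startσ) ⇒⟨ 1 * q ⟩ (cnt , st [] x′ [] [] [] [] [] [] [] [] [] [])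
      part₁ = unwrap (one (≤-trans (s≤s (≤-reflexive (trans (length-ʳ++-[] x′) (length-map raw (encCNF3 n φ))))) x<q)
        (to (cong (λ f → cnt , st [] f [] [] [] [] [] [] [] [] [] []) (ʳ++-involutive x′)) (rev-run (x′ ʳ++ []) [])))
      part₂ : (cnt , st [] x′ [] [] [] [] [] [] [] [] [] []) ⇒⟨ 1 * q ⟩
              (grow , st [] F₀ (pushN (raw s0) n []) [] (blanks 1) [] [] [] [] [] [] [])
      part₂ = unwrap (one n<q (cnt-run n (body φ)))
      bound : 1 * q + (1 * q + ((1 + b * (15 * (q * q))) + (21 * q + suc (#rows ∸ 1) * (rowC + 2) * q))) ≤ 70 * (q * q * q)
      bound = begin
        1 * q + (1 * q + ((1 + b * (15 * (q * q))) + (21 * q + suc (#rows ∸ 1) * (rowC + 2) * q)))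
          ≤⟨ +-mono-≤ (*-monoʳ-≤ 1 q≤p) (+-mono-≤ (*-monoʳ-≤ 1 q≤p) (+-mono-≤ (+-mono-≤ (≤-trans 1≤q q≤p) (*-monoˡ-≤ (15 * (q * q)) (<⇒≤ b<q)))
               (+-mono-≤ (*-monoʳ-≤ 21 q≤p) (*-monoˡ-≤ q (*-mono-≤ (≤-trans (≤-reflexive (m+[n∸m]≡n (m^n>0 2 (m * 9)))) big) rowC≤))))) ⟩
        1 * p + (1 * p + ((p + q * (15 * (q * q))) + (21 * p + q * (22 * q) * q)))
          ≡⟨ solve 1 (λ q → let p = q :* q :* q in con 1 :* p :+ (con 1 :* p :+ ((p :+ q :* (con 15 :* (q :* q))) :+ (con 21 :* p :+ q :* (con 22 :* q) :* q)))
                     := con 61 :* (q :* q :* q)) refl q ⟩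
        61 * (q * q * q)
          ≤⟨ *-monoˡ-≤ (q * q * q) (m≤m+n 61 9) ⟩
        70 * (q * q * q) ∎
        where
        open ≤-Reasoning
        open +-*-Solver
        p : ℕ
        p = q * q * q
        q≤p : q ≤ p
        q≤p = ≤-trans (≤-reflexive (sym (trans (*-identityʳ _) (*-identityʳ q)))) (*-mono-≤ (*-mono-≤ (≤-refl {q}) 1≤q) 1≤q)
        rowC≤ : rowC + 2 ≤ 22 * q
        rowC≤ = begin
          b * 4 + (length φ * 9 + 7) + 2 ≤⟨ +-mono-≤ (+-mono-≤ (*-monoˡ-≤ 4 (<⇒≤ b<q)) (+-mono-≤ (*-monoˡ-≤ 9 (≤-trans (length-body φ) (<⇒≤ body<q))) (*-monoʳ-≤ 7 1≤q))) (*-monoʳ-≤ 2 1≤q) ⟩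
          q * 4 + (q * 9 + 7 * q) + 2 * q ≡⟨ solve 1 (λ q → q :* con 4 :+ (q :* con 9 :+ con 7 :* q) :+ con 2 :* q := con 22 :* q) refl q ⟩
          22 * q ∎

-- Running-time estimates

^-distribʳ-* : ∀ a b k → (a * b) ^ k ≡ a ^ k * b ^ k
^-distribʳ-* a b zero    = refl
^-distribʳ-* a b (suc k) = trans (cong (a * b *_) (^-distribʳ-* a b k))
  (solve 4 (λ a b x y → a :* b :* (x :* y) := a :* x :* (b :* y)) refl a b (a ^ k) (b ^ k))
  where open +-*-Solver

root-≤ : ∀ e → 1 ≤ e → ∀ {x y} → x ^ e ≤ y ^ e → x ≤ y
root-≤ e@(suc _) _ {x} {y} le = ≮⇒≥ (λ lt → <⇒≱ (^-monoˡ-< e lt) le)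

sqrt-≤ : ∀ {x y} → x * x ≤ y * y → x ≤ y
sqrt-≤ le = ≮⇒≥ (λ lt → <⇒≱ (*-mono-< lt lt) le)

cap-≤ : ∀ b → cap b ≤ b * 2 ^ b
cap-≤ zero    = z≤n
cap-≤ (suc b) = begin
  cap b + b * 2 ^ b       ≤⟨ +-monoˡ-≤ (b * 2 ^ b) (cap-≤ b) ⟩
  b * 2 ^ b + b * 2 ^ b   ≡⟨ solve 2 (λ b z → b :* z :+ b :* z := b :* (con 2 :* z)) refl b (2 ^ b) ⟩
  b * 2 ^ suc b           ≤⟨ *-monoˡ-≤ (2 ^ suc b) (n≤1+n b) ⟩
  suc b * 2 ^ suc b       ∎
  where
  open ≤-Reasoning
  open +-*-Solver

cap-large : ∀ n → n ≤ cap (suc n)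
cap-large n = ≤-trans (≤-trans (≤-reflexive (sym (*-identityʳ n))) (*-monoʳ-≤ n (m^n>0 2 n))) (m≤n+m (n * 2 ^ n) (cap n))

abstract
  least-cap : ∀ n → ∃ λ b → n ≤ cap b × (∀ b′ → b′ < b → cap b′ < n)
  least-cap n = search (suc n) 0 (≤-trans (cap-large n) (≤-reflexive (cong cap (sym (+-identityʳ (suc n)))))) (λ _ ())
    where
    search : ∀ fuel b → n ≤ cap (fuel + b) → (∀ b′ → b′ < b → cap b′ < n) → ∃ λ b → n ≤ cap b × (∀ b′ → b′ < b → cap b′ < n)
    search zero       b le low = b , le , low
    search (suc fuel) b le low with n ≤? cap b
    ... | yes le′ = b , le′ , low
    ... | no  nope = search fuel (suc b) (≤-trans le (≤-reflexive (cong cap (sym (+-suc fuel b))))) low′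
      where
      low′ : ∀ b′ → b′ < suc b → cap b′ < n
      low′ b′ (s≤s l) with b′ ≟ b
      ... | yes refl = ≰⇒> nope
      ... | no ne    = low b′ (≤∧≢⇒< l ne)

-- A fixed number of variables admits finitely many partial functions. Their maximum bounds the time
-- of `M` on the sizes to which the assumed asymptotic bound does not yet apply.
maxVec : ∀ k → (Vec PVal k → ℕ) → ℕ
maxVec zero    h = h []
maxVec (suc k) h = maxVec k (λ v → h (p0 ∷ v)) ⊔ (maxVec k (λ v → h (p1 ∷ v)) ⊔ maxVec k (λ v → h (star ∷ v)))

maxVec-≥ : ∀ {k} (h : Vec PVal k → ℕ) v → h v ≤ maxVec k h
maxVec-≥ h []         = ≤-refl
maxVec-≥ {suc k} h (p0 ∷ v)   = ≤-trans (maxVec-≥ (λ v → h (p0 ∷ v)) v) (m≤m⊔n _ _)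
maxVec-≥ {suc k} h (p1 ∷ v)   = ≤-trans (maxVec-≥ (λ v → h (p1 ∷ v)) v)
  (≤-trans (m≤m⊔n _ _) (m≤n⊔m (maxVec k (λ v → h (p0 ∷ v))) _))
maxVec-≥ {suc k} h (star ∷ v) = ≤-trans (maxVec-≥ (λ v → h (star ∷ v)) v)
  (≤-trans (m≤n⊔m (maxVec k (λ v → h (p1 ∷ v))) _) (m≤n⊔m (maxVec k (λ v → h (p0 ∷ v))) _))

sumTo : (ℕ → ℕ) → ℕ → ℕ
sumTo h zero    = 0
sumTo h (suc b) = h b + sumTo h b

sumTo-≥ : ∀ h {b b₀} → b < b₀ → h b ≤ sumTo h b₀
sumTo-≥ h {b} {suc b₀} (s≤s le) with b ≟ b₀
... | yes refl = m≤m+n (h b) _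
... | no ne    = ≤-trans (sumTo-≥ h (≤∧≢⇒< le ne)) (m≤n+m _ (h b₀))

abstract
  -- In terms of `P = q * q * q * suc t` the stack machine takes at most `73 * P` steps, and the
  -- simulation at most `2 + 73 * (4 * 75) + 74 = 21976` times `P * P`.
  costFactor : ℕ
  costFactor = 21976

  cost-≤ : ∀ x q t → 1 ≤ q → x ≤ q →
    2 + ((70 * (q * q * q) + t * 3) * (4 * ((x + (70 * (q * q * q) + t * 3)) + 1)) + (x + (70 * (q * q * q) + t * 3)))
    ≤ costFactor * (q * q * q * suc t * (q * q * q * suc t))
  cost-≤ x q t 1≤q x≤q = begin
    2 + (T * (4 * ((x + T) + 1)) + (x + T))
      ≤⟨ +-mono-≤ (*-monoʳ-≤ 2 1≤PP) (+-mono-≤ (*-mono-≤ T≤ (*-monoʳ-≤ 4 (+-mono-≤ (+-mono-≤ x≤P T≤) 1≤P)))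
           (+-mono-≤ (≤-trans x≤P P≤PP) (≤-trans T≤ (*-monoʳ-≤ 73 P≤PP)))) ⟩
    2 * (P * P) + (73 * P * (4 * ((P + 73 * P) + P)) + (P * P + 73 * (P * P)))
      ≡⟨ solve 1 (λ P → con 2 :* (P :* P) :+ (con 73 :* P :* (con 4 :* ((P :+ con 73 :* P) :+ P)) :+ (P :* P :+ con 73 :* (P :* P)))
                 := con 21976 :* (P :* P)) refl P ⟩
    21976 * (P * P) ∎
    where
    open ≤-Reasoning
    open +-*-Solver
    P T : ℕ
    P = q * q * q * suc t
    T = 70 * (q * q * q) + t * 3
    1≤qqq : 1 ≤ q * q * q
    1≤qqq = *-mono-≤ (*-mono-≤ 1≤q 1≤q) 1≤q
    qqq≤P : q * q * q ≤ P
    qqq≤P = ≤-trans (≤-reflexive (sym (*-identityʳ _))) (*-monoʳ-≤ (q * q * q) (s≤s z≤n))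
    1≤P : 1 ≤ P
    1≤P = ≤-trans 1≤qqq qqq≤P
    P≤PP : P ≤ P * P
    P≤PP = ≤-trans (≤-reflexive (sym (*-identityʳ P))) (*-monoʳ-≤ P 1≤P)
    1≤PP : 1 ≤ P * P
    1≤PP = ≤-trans 1≤P P≤PP
    x≤P : x ≤ P
    x≤P = ≤-trans x≤q (≤-trans (≤-trans (≤-reflexive (sym (trans (*-identityʳ _) (*-identityʳ q)))) (*-mono-≤ (*-mono-≤ (≤-refl {q}) 1≤q) 1≤q)) qqq≤P)
    t≤P : t ≤ P
    t≤P = ≤-trans (n≤1+n t) (≤-trans (≤-reflexive (sym (*-identityˡ (suc t)))) (*-monoˡ-≤ (suc t) 1≤qqq))
    T≤ : T ≤ 73 * P
    T≤ = ≤-trans (+-mono-≤ (*-monoʳ-≤ 70 qqq≤P) (*-monoˡ-≤ 3 t≤P))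
           (≤-reflexive (solve 1 (λ P → con 70 :* P :+ P :* con 3 := con 73 :* P) refl P))

-- Separates `S`, the input length, which goes into the polynomial factor, from the row number `Z`
-- and the time `u` of `M`, which must be subexponential.
spread : ∀ S Z u → (S * Z) * (S * Z) * (S * Z) * u * ((S * Z) * (S * Z) * (S * Z) * u) ≡ S ^ 6 * (Z ^ 6 * u ^ 2)
spread S Z u = solve 3 (λ S Z u → (S :* Z) :* (S :* Z) :* (S :* Z) :* u :* ((S :* Z) :* (S :* Z) :* (S :* Z) :* u)
  := S :* (S :* (S :* (S :* (S :* (S :* con 1))))) :* (Z :* (Z :* (Z :* (Z :* (Z :* (Z :* con 1))))) :* (u :* (u :* con 1)))) refl S Z u
  where open +-*-Solver

vars rows : ℕ → ℕ
vars b = 2 ^ b * 9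
rows b = 2 ^ vars b

-- Removing the common factor `e` from the exponents leaves `t ^ (4 * k) ≤ 2 ^ n`. It is kept as a
-- product of two powers because `t ^ (2 * k)` is to be compared with the square root of `2 ^ n`.
halved : ∀ e k t n z → 1 ≤ e → t ^ (2 * k * (2 * e)) ≤ z → z ≤ 2 ^ (n * e) → t ^ (2 * k) * t ^ (2 * k) ≤ 2 ^ n
halved e k t n z 1≤e le le′ = root-≤ e 1≤e (begin
  (w * w) ^ e                 ≡⟨ cong (λ v → (w * v) ^ e) (sym (*-identityʳ w)) ⟩
  (w ^ 2) ^ e                 ≡⟨ ^-*-assoc w 2 e ⟩
  w ^ (2 * e)                 ≡⟨ ^-*-assoc t (2 * k) (2 * e) ⟩
  t ^ (2 * k * (2 * e))       ≤⟨ ≤-trans le le′ ⟩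
  2 ^ (n * e)                 ≡⟨ sym (^-*-assoc 2 n e) ⟩
  (2 ^ n) ^ e                 ∎)
  where
  open ≤-Reasoning
  w : ℕ
  w = t ^ (2 * k)

suc-power : ∀ k t n → t ^ (2 * k) * t ^ (2 * k) ≤ 2 ^ n →
  suc t ^ (2 * k) * suc t ^ (2 * k) ≤ 2 ^ (2 * k) * 2 ^ (2 * k) * 2 ^ n
suc-power k zero n le = begin
  1 ^ (2 * k) * 1 ^ (2 * k)                 ≡⟨ cong₂ _*_ (^-zeroˡ (2 * k)) (^-zeroˡ (2 * k)) ⟩
  1                                         ≤⟨ *-mono-≤ (*-mono-≤ (m^n>0 2 (2 * k)) (m^n>0 2 (2 * k))) (m^n>0 2 n) ⟩
  2 ^ (2 * k) * 2 ^ (2 * k) * 2 ^ n         ∎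
  where open ≤-Reasoning
suc-power k t@(suc t′) n le = begin
  suc t ^ j * suc t ^ j               ≤⟨ *-mono-≤ (^-monoˡ-≤ j twice) (^-monoˡ-≤ j twice) ⟩
  (2 * t) ^ j * (2 * t) ^ j           ≡⟨ cong₂ _*_ (^-distribʳ-* 2 t j) (^-distribʳ-* 2 t j) ⟩
  2 ^ j * t ^ j * (2 ^ j * t ^ j)     ≡⟨ solve 2 (λ x y → x :* y :* (x :* y) := x :* x :* (y :* y)) refl (2 ^ j) (t ^ j) ⟩
  2 ^ j * 2 ^ j * (t ^ j * t ^ j)     ≤⟨ *-monoʳ-≤ (2 ^ j * 2 ^ j) le ⟩
  2 ^ j * 2 ^ j * 2 ^ n               ∎
  where
  open ≤-Reasoning
  open +-*-Solver
  j : ℕ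
  j = 2 * k
  twice : suc t ≤ 2 * t
  twice = ≤-trans (s≤s (m≤n+m t t′)) (≤-reflexive (cong (λ z → suc (t′ + z)) (sym (+-identityʳ t))))

-- There are `36 * 2 ^ a` variables, at most `2 ^ (6 + a)` and so at most `2 ^ (2 * a)`. The
-- exponent of 2 is then at most `2 * a * 36 * 2 ^ a`, which is 72 times `a * 2 ^ a`.
vars-power : ∀ a n → 6 ≤ a → a * 2 ^ a ≤ n → vars (2 + a) ^ vars (2 + a) ≤ 2 ^ (n * 72)
vars-power a n 6≤a le = begin
  V ^ V                   ≤⟨ ^-monoˡ-≤ V V≤ ⟩
  (2 ^ (6 + a)) ^ V       ≡⟨ ^-*-assoc 2 (6 + a) V ⟩
  2 ^ ((6 + a) * V)       ≤⟨ ^-monoʳ-≤ 2 exponent ⟩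
  2 ^ (n * 72)            ∎
  where
  open ≤-Reasoning
  open +-*-Solver
  V w : ℕ
  V = vars (2 + a)
  w = 2 ^ a
  V≡ : V ≡ w * 36
  V≡ = solve 1 (λ w → con 2 :* (con 2 :* w) :* con 9 := w :* con 36) refl w
  V≤ : V ≤ 2 ^ (6 + a)
  V≤ = ≤-trans (≤-reflexive V≡) (≤-trans (*-monoʳ-≤ w (m≤m+n 36 28)) (≤-reflexive (trans (*-comm w 64) (sym (^-distribˡ-+-* 2 6 a)))))
  exponent : (6 + a) * V ≤ n * 72
  exponent = begin
    (6 + a) * V        ≤⟨ *-mono-≤ (+-monoˡ-≤ a 6≤a) (≤-reflexive V≡) ⟩
    (a + a) * (w * 36) ≡⟨ solve 2 (λ a w → (a :+ a) :* (w :* con 36) := a :* w :* con 72) refl a w ⟩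
    a * w * 72         ≤⟨ *-monoˡ-≤ 72 le ⟩
    n * 72             ∎

-- The exponent of 2 on the left is `2 * 6 * k * 36 * 2 ^ a`, whence the 432.
rows-power : ∀ a n k → 432 * k ≤ a → a * 2 ^ a ≤ n → rows (2 + a) ^ (6 * k) * rows (2 + a) ^ (6 * k) ≤ 2 ^ n
rows-power a n k ka le = begin
  rows (2 + a) ^ (6 * k) * rows (2 + a) ^ (6 * k)  ≡⟨ cong₂ _*_ (^-*-assoc 2 V (6 * k)) (^-*-assoc 2 V (6 * k)) ⟩
  2 ^ (V * (6 * k)) * 2 ^ (V * (6 * k))            ≡⟨ sym (^-distribˡ-+-* 2 (V * (6 * k)) (V * (6 * k))) ⟩
  2 ^ (V * (6 * k) + V * (6 * k))                  ≤⟨ ^-monoʳ-≤ 2 exponent ⟩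
  2 ^ n                                            ∎
  where
  open ≤-Reasoning
  open +-*-Solver
  V : ℕ
  V = vars (2 + a)
  exponent : V * (6 * k) + V * (6 * k) ≤ n
  exponent = begin
    V * (6 * k) + V * (6 * k) ≡⟨ solve 2 (λ w k → con 2 :* (con 2 :* w) :* con 9 :* (con 6 :* k) :+ con 2 :* (con 2 :* w) :* con 9 :* (con 6 :* k)
                                   := con 432 :* k :* w) refl (2 ^ a) k ⟩
    432 * k * 2 ^ a           ≤⟨ *-monoˡ-≤ (2 ^ a) ka ⟩
    a * 2 ^ a                 ≤⟨ le ⟩
    n                         ∎

-- The rows and the time of `M` each get half of the exponent: both factors have squares of at most
-- `2 ^ n`, up to a constant for the second, and square roots are taken at the end.
large-case : ∀ a n k t → 432 * k ≤ a → 6 ≤ a → a * 2 ^ a ≤ n → t ^ (2 * k * (2 * 72)) ≤ vars (2 + a) ^ vars (2 + a) →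
  (rows (2 + a) ^ 6 * suc t ^ 2) ^ k ≤ 2 ^ (2 * k) * 2 ^ n
large-case a n k t ka 6≤a le fast = begin
  (Z ^ 6 * suc t ^ 2) ^ k              ≡⟨ ^-distribʳ-* (Z ^ 6) (suc t ^ 2) k ⟩
  (Z ^ 6) ^ k * (suc t ^ 2) ^ k        ≡⟨ cong₂ _*_ (^-*-assoc Z 6 k) (^-*-assoc (suc t) 2 k) ⟩
  W₁ * W₂                              ≤⟨ sqrt-≤ square ⟩
  2 ^ (2 * k) * 2 ^ n                  ∎
  where
  open ≤-Reasoning
  open +-*-Solver
  Z W₁ W₂ : ℕ
  Z = rows (2 + a)
  W₁ = Z ^ (6 * k)
  W₂ = suc t ^ (2 * k)
  square : W₁ * W₂ * (W₁ * W₂) ≤ 2 ^ (2 * k) * 2 ^ n * (2 ^ (2 * k) * 2 ^ n)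
  square = begin
    W₁ * W₂ * (W₁ * W₂)     ≡⟨ solve 2 (λ x y → x :* y :* (x :* y) := x :* x :* (y :* y)) refl W₁ W₂ ⟩
    W₁ * W₁ * (W₂ * W₂)     ≤⟨ *-mono-≤ (rows-power a n k ka le)
                                 (suc-power k t n (halved 72 k t n _ (s≤s z≤n) fast (vars-power a n 6≤a le))) ⟩
    2 ^ n * (2 ^ (2 * k) * 2 ^ (2 * k) * 2 ^ n)
                            ≡⟨ solve 2 (λ x y → y :* (x :* x :* y) := x :* y :* (x :* y)) refl (2 ^ (2 * k)) (2 ^ n) ⟩
    2 ^ (2 * k) * 2 ^ n * (2 ^ (2 * k) * 2 ^ n) ∎

final-bound : ∀ k n S Z t τ c₁ → 1 ≤ S → τ ≤ costFactor * ((S * Z) * (S * Z) * (S * Z) * suc t * ((S * Z) * (S * Z) * (S * Z) * suc t)) →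
  (Z ^ 6 * suc t ^ 2) ^ k ≤ c₁ * 2 ^ n →
  τ ^ k ≤ (costFactor ^ k * c₁ + 6 * k) * 2 ^ n * S ^ (costFactor ^ k * c₁ + 6 * k)
final-bound k n S Z t τ c₁ 1≤S le small = begin
  τ ^ k                                         ≤⟨ ^-monoˡ-≤ k (≤-trans le (≤-reflexive (cong (costFactor *_) (spread S Z (suc t))))) ⟩
  (costFactor * (S ^ 6 * E)) ^ k                ≡⟨ trans (^-distribʳ-* costFactor (S ^ 6 * E) k) (cong (costFactor ^ k *_) (^-distribʳ-* (S ^ 6) E k)) ⟩
  costFactor ^ k * ((S ^ 6) ^ k * E ^ k)        ≡⟨ cong (λ z → costFactor ^ k * (z * E ^ k)) (^-*-assoc S 6 k) ⟩
  costFactor ^ k * (S ^ (6 * k) * E ^ k)        ≤⟨ *-monoʳ-≤ (costFactor ^ k) (*-monoʳ-≤ (S ^ (6 * k)) small) ⟩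
  costFactor ^ k * (S ^ (6 * k) * (c₁ * 2 ^ n)) ≡⟨ solve 4 (λ x y z w → x :* (y :* (z :* w)) := x :* z :* w :* y) refl (costFactor ^ k) (S ^ (6 * k)) c₁ (2 ^ n) ⟩
  costFactor ^ k * c₁ * 2 ^ n * S ^ (6 * k)     ≤⟨ *-mono-≤ (*-monoˡ-≤ (2 ^ n) (m≤m+n (costFactor ^ k * c₁) (6 * k)))
                                                     (^-monoʳ-≤ S {{>-nonZero 1≤S}} (m≤n+m (6 * k) (costFactor ^ k * c₁))) ⟩
  (costFactor ^ k * c₁ + 6 * k) * 2 ^ n * S ^ (costFactor ^ k * c₁ + 6 * k) ∎
  where
  open ≤-Reasoning
  open +-*-Solver
  E : ℕ
  E = Z ^ 6 * suc t ^ 2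

-- The reduction as a Turing machine

module Solver (M : TM 4)
  (correct : ∀ n (f* : PartialTT n) s → 1 ≤ s → s ≤ 2 ^ n → Decides M (encMBPSP n f* s) (MBPSP* n f* s)) where

  open Tracks (Program.enum-A M) (Program.enum-Q M) (Program.raw M) Program.rev (Program.δ M)
    using (machine; machine-halts; runCost)

  module _ {n : ℕ} (φ : CNF3 n) (b q : ℕ) (enough : n ≤ cap b) (few : ∀ b′ → b′ < b → cap b′ < n)
    (x<q : length (encCNF3 n φ) < q) (rows≤q : rows b ≤ q) where

    halts-within : ∀ t z → exec M t (inj₁ (initConf M (encMBPSP (vars b) (instanceOf b φ) (vars b)))) ≡ inj₂ z →
      exec machine (runCost (length (encCNF3 n φ)) (70 * (q * q * q) + t * 3)) (inj₁ (initConf machine (encCNF3 n φ))) ≡ inj₂ z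
    halts-within t z e = machine-halts (encCNF3 n φ) (proj₂ reduce ⨾ proj₁ (proj₂ simulated)) (proj₂ (proj₂ simulated))
      where
      open Stacks (Program.δ M) using (_⨾_)
      reduce = Whole.Total.total M φ b q enough few x<q rows≤q
      simulated = Whole.Simulation.sim-input M {f = Whole.Total.F₀ M φ b q enough few x<q rows≤q} {d = proj₁ reduce} t (encMBPSP (vars b) (instanceOf b φ) (vars b)) z e

  1≤vars : ∀ b → 1 ≤ vars b
  1≤vars b = *-mono-≤ (m^n>0 2 b) (s≤s z≤n)

  vars≤rows : ∀ b → vars b ≤ rows b
  vars≤rows b = <⇒≤ (n<2^n (vars b))

  solve : ∀ b (f* : PartialTT (vars b)) → Decides M (encMBPSP (vars b) f* (vars b)) (MBPSP* (vars b) f* (vars b))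
  solve b f* = correct (vars b) f* (vars b) (1≤vars b) (vars≤rows b)

  slowest : ℕ → ℕ
  slowest b = maxVec (rows b) (λ f* → proj₁ (solve b f*))

  module Instance {n : ℕ} (φ : CNF3 n) (b : ℕ) (enough : n ≤ cap b) (few : ∀ b′ → b′ < b → cap b′ < n) where

    x y : List (Fin 4)
    x = encCNF3 n φ
    y = encMBPSP (vars b) (instanceOf b φ) (vars b)

    size q : ℕ
    size = suc (length x)
    q = size * rows b

    x<q : length x < q
    x<q = ≤-trans (≤-reflexive (sym (*-identityʳ size))) (*-monoʳ-≤ size (m^n>0 2 (vars b)))

    rows≤q : rows b ≤ q
    rows≤q = ≤-trans (≤-reflexive (sym (*-identityˡ (rows b)))) (*-monoˡ-≤ (rows b) (s≤s {0} {length x} z≤n))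

    time : ℕ → ℕ
    time t = runCost (length x) (70 * (q * q * q) + t * 3)

    halts : ∀ t z → exec M t (inj₁ (initConf M y)) ≡ inj₂ z → exec machine (time t) (inj₁ (initConf machine x)) ≡ inj₂ z
    halts = halts-within φ b q enough few x<q rows≤q

    fits : n ≤ b * 2 ^ b
    fits = ≤-trans enough (cap-≤ b)

    transfer : Decides M y (MBPSP* (vars b) (instanceOf b φ) (vars b)) → Decides machine x (Satisfiable φ)
    transfer (t , z , e , sound , complete) = time t , z , halts t z e ,
      (λ ez → Reduction.backward b φ fits (sound ez)) , (λ sat → complete (Reduction.forward b φ fits sat))

    power-bound : ∀ k t c₁ → (rows b ^ 6 * suc t ^ 2) ^ k ≤ c₁ * 2 ^ n →
      time t ^ k ≤ (costFactor ^ k * c₁ + 6 * k) * 2 ^ n * size ^ (costFactor ^ k * c₁ + 6 * k)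
    power-bound k t c₁ = final-bound k n size (rows b) t (time t) c₁ (s≤s z≤n)
      (cost-≤ (length x) q t (≤-trans (s≤s z≤n) x<q) (<⇒≤ x<q))

    decides : Decides machine x (Satisfiable φ)
    decides = transfer (solve b (instanceOf b φ))

  decides-3SAT : ∀ n (φ : CNF3 n) → Decides machine (encCNF3 n φ) (Satisfiable φ)
  decides-3SAT n φ = Instance.decides φ (proj₁ (least-cap n)) (proj₁ (proj₂ (least-cap n))) (proj₂ (proj₂ (least-cap n)))

  -- For fixed `k` the values of `b` split at a threshold: below it the time of `M` is bounded by a
  -- constant, above it by the assumption. Both cases feed the same `c₁`.
  module Fast (k : ℕ) (n₀ : ℕ)
    (fast : ∀ n → n₀ ≤ n → ∀ (f* : PartialTT n) s → 1 ≤ s → s ≤ 2 ^ n →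
            ∃ λ t → HaltsWithin M (encMBPSP n f* s) t × t ^ (2 * k * (2 * 72)) ≤ n ^ n) where

    -- With `b = 2 + a`, the rows require `432 * k ≤ a`, the number of variables `6 ≤ a`, and the
    -- assumed bound is available once `n₀ ≤ a`.
    threshold : ℕ
    threshold = 2 + (432 * k + 6 + n₀)

    smallCost : ℕ → ℕ
    smallCost b = (rows b ^ 6 * suc (slowest b) ^ 2) ^ k

    c₁ : ℕ
    c₁ = 2 ^ (2 * k) + sumTo smallCost threshold

    Cheap : ∀ {n} → CNF3 n → ℕ → Set
    Cheap {n} φ b = ∃ λ t → HaltsWithin M (encMBPSP (vars b) (instanceOf b φ) (vars b)) t × (rows b ^ 6 * suc t ^ 2) ^ k ≤ c₁ * 2 ^ n

    small : ∀ {n} (φ : CNF3 n) b → b < threshold → Cheap φ b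
    small {n} φ b lt = t , (proj₁ (proj₂ D) , proj₁ (proj₂ (proj₂ D))) , (begin
      (rows b ^ 6 * suc t ^ 2) ^ k  ≤⟨ ^-monoˡ-≤ k (*-monoʳ-≤ (rows b ^ 6) (^-monoˡ-≤ 2 (s≤s (maxVec-≥ (λ f* → proj₁ (solve b f*)) (instanceOf b φ))))) ⟩
      smallCost b                   ≤⟨ sumTo-≥ smallCost lt ⟩
      sumTo smallCost threshold     ≤⟨ m≤n+m (sumTo smallCost threshold) (2 ^ (2 * k)) ⟩
      c₁                            ≡⟨ sym (*-identityʳ c₁) ⟩
      c₁ * 1                        ≤⟨ *-monoʳ-≤ c₁ (m^n>0 2 n) ⟩
      c₁ * 2 ^ n                    ∎)
      where
      open ≤-Reasoning
      D : Decides M (encMBPSP (vars b) (instanceOf b φ) (vars b)) (MBPSP* (vars b) (instanceOf b φ) (vars b))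
      D = solve b (instanceOf b φ)
      t : ℕ
      t = proj₁ D

    large : ∀ {n} (φ : CNF3 n) a → 432 * k + 6 + n₀ ≤ a → cap (suc a) < n → Cheap φ (2 + a)
    large {n} φ a le few = proj₁ F , proj₁ (proj₂ F) , ≤-trans
      (large-case a n k (proj₁ F) (≤-trans (≤-trans (m≤m+n (432 * k) 6) (m≤m+n (432 * k + 6) n₀)) le)
        (≤-trans (≤-trans (m≤n+m 6 (432 * k)) (m≤m+n (432 * k + 6) n₀)) le)
        -- Since `2 + a` is the least admissible value, `cap (suc a) < n`, and the last summand of
        -- that `cap` is `a * 2 ^ a`.
        (≤-trans (m≤n+m (a * 2 ^ a) (cap a)) (<⇒≤ few)) (proj₂ (proj₂ F)))
      (*-monoˡ-≤ (2 ^ n) (m≤m+n (2 ^ (2 * k)) (sumTo smallCost threshold)))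
      where
      β : ℕ
      β = 2 + a
      n₀≤ : n₀ ≤ vars β
      n₀≤ = ≤-trans (m≤n+m n₀ (432 * k + 6)) (≤-trans le (≤-trans (m≤n+m a 2)
              (≤-trans (<⇒≤ (n<2^n β)) (≤-trans (≤-reflexive (sym (*-identityʳ (2 ^ β)))) (*-monoʳ-≤ (2 ^ β) (s≤s z≤n))))))
      F : ∃ λ t → HaltsWithin M (encMBPSP (vars β) (instanceOf β φ) (vars β)) t × t ^ (2 * k * (2 * 72)) ≤ vars β ^ vars β
      F = fast (vars β) n₀≤ (instanceOf β φ) (vars β) (1≤vars β) (vars≤rows β)

    cheap : ∀ {n} (φ : CNF3 n) b → (∀ b′ → b′ < b → cap b′ < n) → Cheap φ b
    cheap φ b few with b <? threshold
    ... | yes lt = small φ b lt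
    ... | no nlt = subst (Cheap φ) shape (large φ (b ∸ 2) (∸-monoˡ-≤ 2 (≮⇒≥ nlt)) (few (suc (b ∸ 2)) (≤-reflexive shape)))
      where
      shape : 2 + (b ∸ 2) ≡ b
      shape = m+[n∸m]≡n (≤-trans (m≤m+n 2 _) (≮⇒≥ nlt))

    finish : ∀ {n} (φ : CNF3 n) b → n ≤ cap b → (∀ b′ → b′ < b → cap b′ < n) → Cheap φ b →
      ∃ λ t → HaltsWithin machine (encCNF3 n φ) t ×
        t ^ k ≤ (costFactor ^ k * c₁ + 6 * k) * 2 ^ n * (suc (length (encCNF3 n φ))) ^ (costFactor ^ k * c₁ + 6 * k)
    finish φ b enough few (t , (z , e) , le) = time t , (z , halts t z e) , power-bound k t c₁ le
      where open Instance φ b enough few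

    bound : ∃ λ c → ∀ n (φ : CNF3 n) → ∃ λ t → HaltsWithin machine (encCNF3 n φ) t
              × t ^ k ≤ c * 2 ^ n * (suc (length (encCNF3 n φ))) ^ c
    bound = costFactor ^ k * c₁ + 6 * k , λ n φ → let b = proj₁ (least-cap n) ; few = proj₂ (proj₂ (least-cap n)) in
      finish φ b (proj₁ (proj₂ (least-cap n))) few (cheap φ b few)

-- For N = 2^n the quantity N^(log log N) is `n ^ n`, so the negated statement says that `M` runs in
-- time N^o(log log N).
theorem1 : ETH → (M : TM 4) →
    (∀ n (f* : PartialTT n) s → 1 ≤ s → s ≤ 2 ^ n → Decides M (encMBPSP n f* s) (MBPSP* n f* s)) →
    ¬ (∀ k → 1 ≤ k → ∃ λ n₀ → ∀ n → n₀ ≤ n → ∀ (f* : PartialTT n) s → 1 ≤ s → s ≤ 2 ^ n →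
    ∃ λ t → HaltsWithin M (encMBPSP n f* s) t × t ^ k ≤ n ^ n)
theorem1 eth M correct fast = eth (machine , decides-3SAT , λ k 1≤k →
    Fast.bound k (proj₁ (fast (K k) (1≤K k 1≤k))) (proj₂ (fast (K k) (1≤K k 1≤k))))
  where
  open Solver M correct
  open Tracks (Program.enum-A M) (Program.enum-Q M) (Program.raw M) Program.rev (Program.δ M) using (machine)
  -- The time of `M` enters the total squared, which gives `2 * k`; it may use only half of the
  -- exponent, which gives another 2; and 72 is the constant of `vars-power`.
  K : ℕ → ℕ
  K k = 2 * k * (2 * 72)
  1≤K : ∀ k → 1 ≤ k → 1 ≤ K k
  1≤K k 1≤k = *-mono-≤ {1} {2 * k} {1} {2 * 72} (*-mono-≤ {1} {2} {1} {k} (s≤s z≤n) 1≤k) (s≤s z≤n)
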